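{- With notation as in the context, for every $f\in\mathcal{H}$ there exists a unique $G_f\in\mathcal{A}_1^1$ such that \[ \widetilde{S(f)}(z_s^{\delta}w)=z_s^{\delta}\,(G_f\diamond_s w) \] holds for every $s\in\mu_r$ and every $w\in\mathcal{A}_r$, where $S$ is the antipode of $\mathcal{H}$.
   Context: Let $r\ge1$ and $\mu_r$ the set of $r$-th roots of unity. Let $\mathcal{A}_r=\mathbb{Q}\langle x,y_s\mid s\in\mu_r\rangle$, $y=y_1$, $z=x+y_1$, $z_t=x+y_t$, $z_s^{\delta}=x+\delta(s)y_s$ with $\delta(1)=0$, $\delta(s)=1$ for $s\ne1$, $z_{k,s}=x^{k-1}y_s$, $\mathcal{A}_1=\mathbb{Q}\langle x,y\rangle\subset\mathcal{A}_r$, $\mathcal{A}_1^1=\mathbb{Q}\oplus\mathcal{A}_1y$; $R_w$ is right multiplication by $w$. $\varphi$: the automorphism of $\mathcal{A}_r$ with $\varphi(x)=z$, $\varphi(y_s)=\delta(s)y_s-y_1$. $\mathcal{I}(z_{k_1,s_1}\cdots z_{k_l,s_l}x^a)=z_{k_1,s_1}z_{k_2,s_1s_2}\cdots z_{k_l,s_1\cdots s_l}x^a$, $M_s(z_{k_1,s_1}\cdots z_{k_l,s_l}x^a)=z_{k_1,ss_1}z_{k_2,s_2}\cdots z_{k_l,s_l}x^a$ (linear, $a\ge0$), $\psi_s=\varphi\mathcal{I}M_s$. Diamond product $\diamond_s:\mathcal{A}_1\times\mathcal{A}_r\to\mathcal{A}_r$ ($s\in\mu_r$): $\mathbb{Q}$-bilinear,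 defined recursively for words $v\in\mathcal{A}_1,w\in\mathcal{A}_r$, $1\ne t\in\mu_r$ by $1\diamond_s w=w$, $v\diamond_s1=\psi_s\varphi(v)$, $vx\diamond_s wx=(v\diamond_s wx)x-(vy\diamond_s w)x$, $vy\diamond_s wx=(v\diamond_s wx)y+(vy\diamond_s w)x$, $vx\diamond_s wy=(v\diamond_s wy)x+(vx\diamond_s w)y$, $vy\diamond_s wy=(v\diamond_s wy)y-(vx\diamond_s w)y$, $vx\diamond_s wy_t=(v\diamond_s wy_t)x+(v\diamond_s wz_t)y_t-(vy\diamond_s w)y_t$, $vy\diamond_s wy_t=(v\diamond_s wy_t)y-(v\diamond_s wz_t)y_t+(vy\diamond_s w)y_t$. $\mathcal{H}$: Connes–Kreimer Hopf algebra of rooted trees (commutative algebra with basis the rooted forests, unit the empty forest $\mathbb{I}$; $B_+$ grafts the roots of a forest onto a new root, $B_+(\mathbb{I})=\bullet$; coproduct the algebra map with $\Delta(\mathbb{I})=\mathbb{I}\otimes\mathbb{I}$, $\Delta(B_+(f))=B_+(f)\otimes\mathbb{I}+(\mathrm{id}\otimes B_+)\Delta(f)$; counit vanishing on nonempty forests; antipode $S$ the anti-automorphism with $m(S\otimes\mathrm{id})\Delta=\mathbb{I}\,\hat{\mathbb{I}}=m(\mathrm{id}\otimes S)\Delta$). Rooted tree maps: $\widetilde{\mathbb{I}}=\mathrm{id}$; for forests $f$ of positive degree $\widetilde f\in\mathrm{End}_\mathbb{Q}(\mathcal{A}_r)$ is determined by (I) $\widetilde{\bullet}(z_s^{\delta})=z_s^{\delta}(z-z_s^{\delta})$,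 $\widetilde{\bullet}(z)=0$; (II) $\widetilde{B_+(f)}(z_s^{\delta})=R_{z-z_s^{\delta}}R_{2z-z_s^{\delta}}R_{z-z_s^{\delta}}^{ -1}\widetilde{f}(z_s^{\delta})$, $\widetilde{B_+(f)}(z)=0$; (III) $\widetilde{gh}(u)=\widetilde g(\widetilde h(u))$ for $u\in\{z,z_s^\delta\mid s\in\mu_r\}$; (IV) $\widetilde{f}(wu)=\sum_{(f)}\widetilde{f'}(w)\widetilde{f''}(u)$ for $w\in\mathcal{A}_r$, $u\in\{z,z_s^\delta\}$, $\Delta(f)=\sum_{(f)}f'\otimes f''$; extended linearly to $\mathcal{H}$ (an algebra homomorphism). -}

module Defs where

open import Data.Nat using (ℕ; zero; suc) renaming (_+_ to _+ℕ_)
open import Data.Nat.DivMod using (_mod_)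
open import Data.Fin using (Fin; toℕ) renaming (zero to fz; suc to fs)
open import Data.Fin.Properties using () renaming (_≟_ to _≟F_)
open import Data.Rational using (ℚ; 0ℚ; 1ℚ; _+_; _*_; -_)
open import Data.List using (List; []; _∷_; _++_; map; concatMap; reverse; length; foldr)
open import Data.Product using (Σ; _×_; _,_; ∃)
open import Relation.Binary.PropositionalEquality using (_≡_; refl; cong)
open import Relation.Nullary using (Dec; yes; no)

-- Noncommutative polynomials over ℚ on an alphabet A.
-- An element is a finite formal sum  Σ cᵢ wᵢ  (list of (coefficient, word)),
-- compared by equality of all coefficients (_≈_ below).

Word : Set → Set
Word A = List A

Poly : Set → Set
Poly A = List (ℚ × Word A)

module _ {A : Set} where

  wd : Word A → Poly A
  wd w = (1ℚ , w) ∷ []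

  0P : Poly A
  0P = []

  1P : Poly A
  1P = wd []

  _⊕_ : Poly A → Poly A → Poly A
  p ⊕ q = p ++ q
  infixl 6 _⊕_

  _·_ : ℚ → Poly A → Poly A
  c · p = map (λ { (a , w) → (c * a , w) }) p
  infixr 8 _·_

  ⊖_ : Poly A → Poly A
  ⊖ p = (- 1ℚ) · p

  _⊝_ : Poly A → Poly A → Poly A
  p ⊝ q = p ⊕ (⊖ q)
  infixl 6 _⊝_

  _⊗_ : Poly A → Poly A → Poly A
  p ⊗ q = concatMap (λ { (a , u) → map (λ { (b , v) → (a * b , u ++ v) }) q }) p
  infixl 7 _⊗_

  linExt : {B : Set} → (Word A → Poly B) → Poly A → Poly B
  linExt F p = concatMap (λ { (a , w) → map (λ { (b , v) → (a * b , v) }) (F w) }) p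

  module Coeff (_≟_ : (a b : Word A) → Dec (a ≡ b)) where
    coeff : Poly A → Word A → ℚ
    coeff [] w = 0ℚ
    coeff ((a , u) ∷ p) w with u ≟ w
    ... | yes _ = a + coeff p w
    ... | no  _ = coeff p w

    _≈_ : Poly A → Poly A → Set
    p ≈ q = ∀ w → coeff p w ≡ coeff q w

-- Alphabets.  r = suc n ≥ 1;  μ_r is modelled by Fin r, the index i
-- standing for exp(2πi·i/r); hence fz stands for 1 and the group law is
-- addition mod r.

data Letter (n : ℕ) : Set where
  X : Letter n
  Y : Fin (suc n) → Letter n

data L1 : Set where
  x₁ y₁ : L1

_≟L_ : ∀ {n} (a b : Letter n) → Dec (a ≡ b)
X ≟L X = yes refl
X ≟L Y _ = no (λ ())
Y _ ≟L X = no (λ ())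
Y s ≟L Y t with s ≟F t
... | yes refl = yes refl
... | no ¬p = no (λ { refl → ¬p refl })

_≟1_ : (a b : L1) → Dec (a ≡ b)
x₁ ≟1 x₁ = yes refl
x₁ ≟1 y₁ = no (λ ())
y₁ ≟1 x₁ = no (λ ())
y₁ ≟1 y₁ = yes refl

module _ {A : Set} (_≟_ : (a b : A) → Dec (a ≡ b)) where
  ≟W : (u v : Word A) → Dec (u ≡ v)
  ≟W [] [] = yes refl
  ≟W [] (_ ∷ _) = no (λ ())
  ≟W (_ ∷ _) [] = no (λ ())
  ≟W (a ∷ u) (b ∷ v) with a ≟ b | ≟W u v
  ... | yes refl | yes refl = yes refl
  ... | no ¬p | _ = no (λ { refl → ¬p refl })
  ... | yes _ | no ¬q = no (λ { refl → ¬q refl })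

module Ar (n : ℕ) = Coeff {Letter n} (≟W _≟L_)
module A1 = Coeff {L1} (≟W _≟1_)

module Setup (n : ℕ) where

  μ : Set
  μ = Fin (suc n)

  one : μ
  one = fz

  _∙_ : μ → μ → μ
  s ∙ t = (toℕ s +ℕ toℕ t) mod (suc n)

  𝒜 : Set
  𝒜 = Poly (Letter n)

  𝒜₁ : Set
  𝒜₁ = Poly L1

  _◃_ : 𝒜 → Letter n → 𝒜
  p ◃ l = p ⊗ wd (l ∷ [])

  xP : 𝒜
  xP = wd (X ∷ [])

  yP : μ → 𝒜
  yP s = wd (Y s ∷ [])

  δ : μ → ℚ
  δ fz = 0ℚ
  δ (fs _) = 1ℚ

  z : 𝒜
  z = xP ⊕ yP one

  zt : μ → 𝒜
  zt t = xP ⊕ yP t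

  zδ : μ → 𝒜
  zδ s = xP ⊕ δ s · yP s

  emb : 𝒜₁ → 𝒜
  emb = linExt (λ w → wd (map (λ { x₁ → X ; y₁ → Y one }) w))

  φL : Letter n → 𝒜
  φL X = z
  φL (Y s) = δ s · yP s ⊝ yP one

  φW : Word (Letter n) → 𝒜
  φW [] = 1P
  φW (l ∷ w) = φL l ⊗ φW w

  φ : 𝒜 → 𝒜
  φ = linExt φW

  iotaW : μ → Word (Letter n) → Word (Letter n)
  iotaW acc [] = []
  iotaW acc (X ∷ w) = X ∷ iotaW acc w
  iotaW acc (Y s ∷ w) = Y (acc ∙ s) ∷ iotaW (acc ∙ s) w

  𝓘 : 𝒜 → 𝒜
  𝓘 = linExt (λ w → wd (iotaW one w))

  MW : μ → Word (Letter n) → Word (Letter n)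
  MW s [] = []
  MW s (X ∷ w) = X ∷ MW s w
  MW s (Y t ∷ w) = Y (s ∙ t) ∷ w

  M : μ → 𝒜 → 𝒜
  M s = linExt (λ w → wd (MW s w))

  ψ : μ → 𝒜 → 𝒜
  ψ s p = φ (𝓘 (M s p))

  -- Diamond product  ◇_s : 𝒜_1 × 𝒜_r → 𝒜_r.
  -- diaF fuel s rv rw computes  reverse rv ◇_s reverse rw ; the recursion
  -- (on the last letters) strictly decreases |v|+|w|, and the fuel
  -- |v|+|w| is always sufficient.

  diaF : ℕ → μ → List L1 → List (Letter n) → 𝒜
  diaF k s [] rw = wd (reverse rw)
  diaF k s (l ∷ rv) [] = ψ s (φ (emb (wd (reverse (l ∷ rv)))))
  diaF zero s (_ ∷ _) (_ ∷ _) = 0P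
  diaF (suc k) s (x₁ ∷ rv) (X ∷ rw) =
    (diaF k s rv (X ∷ rw)) ◃ X ⊝ (diaF k s (y₁ ∷ rv) rw) ◃ X
  diaF (suc k) s (y₁ ∷ rv) (X ∷ rw) =
    (diaF k s rv (X ∷ rw)) ◃ Y one ⊕ (diaF k s (y₁ ∷ rv) rw) ◃ X
  diaF (suc k) s (x₁ ∷ rv) (Y fz ∷ rw) =
    (diaF k s rv (Y fz ∷ rw)) ◃ X ⊕ (diaF k s (x₁ ∷ rv) rw) ◃ Y one
  diaF (suc k) s (y₁ ∷ rv) (Y fz ∷ rw) =
    (diaF k s rv (Y fz ∷ rw)) ◃ Y one ⊝ (diaF k s (x₁ ∷ rv) rw) ◃ Y one
  -- t ≠ 1 :  v ◇ w z_t = v ◇ w x + v ◇ w y_t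
  diaF (suc k) s (x₁ ∷ rv) (Y (fs t) ∷ rw) =
    (diaF k s rv (Y (fs t) ∷ rw)) ◃ X
    ⊕ (diaF k s rv (X ∷ rw) ⊕ diaF k s rv (Y (fs t) ∷ rw)) ◃ Y (fs t)
    ⊝ (diaF k s (y₁ ∷ rv) rw) ◃ Y (fs t)
  diaF (suc k) s (y₁ ∷ rv) (Y (fs t) ∷ rw) =
    (diaF k s rv (Y (fs t) ∷ rw)) ◃ Y one
    ⊝ (diaF k s rv (X ∷ rw) ⊕ diaF k s rv (Y (fs t) ∷ rw)) ◃ Y (fs t)
    ⊕ (diaF k s (y₁ ∷ rv) rw) ◃ Y (fs t)

  diaW : μ → Word L1 → Word (Letter n) → 𝒜
  diaW s v w = diaF (length v +ℕ length w) s (reverse v) (reverse w)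

  _◇[_]_ : 𝒜₁ → μ → 𝒜 → 𝒜
  G ◇[ s ] w = linExt (λ v → linExt (λ u → diaW s v u) w) G

  -- 𝒜_1^1 = ℚ ⊕ 𝒜_1 y : no word ending in x has a nonzero coefficient
  InA11 : 𝒜₁ → Set
  InA11 G = ∀ (u : Word L1) → A1.coeff G (u ++ (x₁ ∷ [])) ≡ 0ℚ

-- Connes–Kreimer Hopf algebra.  Rooted trees are node (list of children);
-- forests are lists of trees; an element of ℋ is a ℚ-linear combination
-- of forests.  (Representatives: every element of ℋ has such a
-- representative.)

data Tree : Set where
  node : List Tree → Tree

Forest : Set
Forest = List Tree

B₊ : Forest → Tree
B₊ = node

ℋ : Set
ℋ = List (ℚ × Forest)

mutual
  degT : Tree → ℕ
  degT (node f) = suc (degF f)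

  degF : Forest → ℕ
  degF [] = 0
  degF (t ∷ f) = degT t +ℕ degF f

-- coproduct, as a list of terms f' ⊗ f'' (all coefficients 1)
mutual
  ΔT : Tree → List (Forest × Forest)
  ΔT (node f) = (node f ∷ [] , []) ∷ map (λ { (a , b) → (a , node b ∷ []) }) (ΔF f)

  ΔF : Forest → List (Forest × Forest)
  ΔF [] = ([] , []) ∷ []
  ΔF (t ∷ f) = concatMap (λ { (a , b) → map (λ { (c , d) → (a ++ c , b ++ d) }) (ΔF f) }) (ΔT t)

_⋆_ : ℋ → ℋ → ℋ
p ⋆ q = concatMap (λ { (a , u) → map (λ { (b , v) → (a * b , u ++ v) }) q }) p

-- antipode (fuel ≥ degree):  S(𝕀) = 𝕀,  S multiplicative,
-- S(B₊ f) = − Σ_{(f)} S(f') B₊(f'')   (from m(S ⊗ id)Δ = 𝕀 ε)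
mutual
  SF : ℕ → Forest → ℋ
  SF k [] = (1ℚ , []) ∷ []
  SF k (t ∷ f) = ST k t ⋆ SF k f

  ST : ℕ → Tree → ℋ
  ST zero _ = []
  ST (suc k) (node f) =
    concatMap (λ { (a , b) → map (λ { (c , g) → (- c , g ++ (node b ∷ [])) }) (SF k a) }) (ΔF f)

S : ℋ → ℋ
S h = concatMap (λ { (c , f) → map (λ { (d , g) → (c * d , g) }) (SF (degF f) f) }) h

module TreeMaps (n : ℕ) where
  open Setup n

  data Gen : Set where
    gz : Gen
    gδ : μ → Gen

  genP : Gen → 𝒜
  genP gz = z
  genP (gδ s) = zδ s

  -- R_{z − z_s^δ}^{-1}: right division by z − z_s^δ (∈ {y_1, y_1 − y_s}),
  -- whose coefficient of y_1 is 1: the quotient q of p = q (z − z_s^δ)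
  -- is obtained from the words of p ending in y_1.
  divR : 𝒜 → 𝒜
  divR = linExt dw
    where
      dw : Word (Letter n) → 𝒜
      dw w with reverse w
      ... | Y fz ∷ rw = wd (reverse rw)
      ... | _ = 0P

  -- fuel k ≥ degree of the tree / forest
  mutual
    forestMapF : ℕ → Forest → 𝒜 → 𝒜
    forestMapF k [] p = p
    forestMapF k (t ∷ f) p = treeMapF k t (forestMapF k f p)

    treeMapF : ℕ → Tree → 𝒜 → 𝒜
    treeMapF k t p = linExt (λ w → treeWordF k t (reverse w)) p

    -- value of the tree map on the word  reverse rw ;  (IV) and t̃(1) = 0
    treeWordF : ℕ → Tree → List (Letter n) → 𝒜
    treeWordF zero _ _ = 0P
    treeWordF (suc k) t [] = 0P
    treeWordF (suc k) (node f) (l ∷ rw) =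
      treeWordF (suc k) (node f) rw ◃ l
      ⊕ concatMap (λ { (a , b) → forestMapF k a (wd (reverse rw)) ⊗ letterF k (node b) l }) (ΔF f)

    -- value on a letter, via x = z_1^δ, y_1 = z − z_1^δ, y_s = z_s^δ − z_1^δ (s ≠ 1)
    -- (letterF k / genF k run with fuel suc k)
    letterF : ℕ → Tree → Letter n → 𝒜
    letterF k t X = genF k t (gδ one)
    letterF k t (Y fz) = genF k t gz ⊝ genF k t (gδ one)
    letterF k t (Y (fs s)) = genF k t (gδ (fs s)) ⊝ genF k t (gδ one)

    genF : ℕ → Tree → Gen → 𝒜
    genF k _ gz = 0P
    genF k (node []) (gδ s) = zδ s ⊗ (z ⊝ zδ s)
    genF k (node (t ∷ f)) (gδ s) =
      divR (forestMapF k (t ∷ f) (zδ s)) ⊗ (z ⊕ z ⊝ zδ s) ⊗ (z ⊝ zδ s)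

  forestMap : Forest → 𝒜 → 𝒜
  forestMap f = forestMapF (degF f) f

  treeMapH : ℋ → 𝒜 → 𝒜
  treeMapH h p = concatMap (λ { (c , f) → c · forestMap f p }) h

  Thm24Eq : ℋ → 𝒜₁ → μ → 𝒜 → Set
  Thm24Eq f G s w = Ar._≈_ n (treeMapH (S f) (zδ s ⊗ w)) (zδ s ⊗ (G ◇[ s ] w))

{-# OPTIONS --safe #-}
module Submission where

-- Put e_k = z^k y, so that 𝒜_1^1 has the products of the e_k as a basis.  For v in 𝒜_1^1 let T_v be
-- the operator on 𝒜_r with T_v(z) = ε(v) z and T_v(z_s^δ) = z_s^δ D_s(v), where D_s is the
-- homomorphism z ↦ z, y ↦ z − z_s^δ, extended to products by T_v(pq) = Σ T_v'(p) T_v''(q) for the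
-- deconcatenation coproduct Σ v' ⊗ v'' of v.
--
-- The defining rules of ◇_s say that (v z) ◇ w = (v ◇ w) z, v ◇ (w z) = (v ◇ w) z and
-- (v y) ◇ (w z_t^δ) = (v ◇ (w z_t^δ)) (z − z_t^δ) + ((v y) ◇ w) z_t^δ; hence T_v(z_s^δ w) = z_s^δ (v ◇_s w).
-- Moreover T_v T_w = T_{v ⋄ w}, where ⋄ is the quasi-shuffle product with e_j ∘ e_k = − e_{j+k+1},
-- and 1 ↦ y, u y ↦ u (z + y) y is a Hochschild 1-cocycle for deconcatenation.  Therefore the
-- multiplicative map E determined by sending B₊ to this cocycle is a coalgebra map, and f~ = T_{E(f)}
-- for every f, so that G_f = E(S(f)).
--
-- Uniqueness: z_1^δ (G ◇_1 1) = x G determines G.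

open import Defs
open import Level using (0ℓ)
open import Algebra.Bundles using (CommutativeMonoid)
import Algebra.Properties.CommutativeSemigroup as CSemigroup
open import Data.Bool using (Bool; true; false; not) renaming (T to IsTrue)
open import Data.Bool.Properties using () renaming (_≟_ to _≟B_)
open import Data.Fin using (Fin; toℕ) renaming (zero to fz; suc to fs)
import Data.Fin.Properties as Finₚ
open import Data.List using (List; []; _∷_; _++_; map; concatMap; reverse; length; null)
import Data.List.Properties as Listₚ
open import Data.List.Relation.Unary.All as All using (All; []; _∷_)
import Data.List.Relation.Unary.All.Properties as Allₚ
open import Data.Nat using (ℕ; zero; suc; _≤_; s≤s) renaming (_+_ to _+ℕ_)
open import Data.Nat.DivMod using (_%_; m%n<n; m<n⇒m%n≡m)
import Data.Nat.Properties as ℕₚ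
open import Data.Product using (Σ; _×_; _,_; proj₁; proj₂)
open import Data.Rational using (ℚ; 0ℚ; 1ℚ; _+_; _*_; -_)
open import Data.Rational.Properties using (+-assoc; +-comm; +-identityˡ; +-identityʳ; +-inverseʳ; +-0-commutativeMonoid; *-assoc; *-comm; *-identityˡ; *-identityʳ; *-zeroˡ; *-zeroʳ; *-distribˡ-+; neg-distribˡ-*)
open import Data.Vec using (Vec; []; _∷_; lookup)
open import Relation.Binary.Bundles using (Setoid)
open import Relation.Binary.PropositionalEquality using (_≡_; _≢_; refl; cong; cong₂; sym; trans; subst; module ≡-Reasoning)
import Relation.Binary.Reasoning.Setoid as SetoidReasoning
open import Relation.Nullary using (Dec; yes; no; contradiction)

-- The contraction in `⋄` comes from one computation, `T-D`. With β = z - z_s^δ, a composition with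
-- last letter e_j acts on p β so as to produce the term - T(p) z z^j β, and when p ends in z^k this
-- carries the power z^{j+k+1}. The cocycle is rule (II) read through D_s: as 2z - z_s^δ = z + β,
-- the rule replaces a last factor β by (z + β) β, the image of (z + y) y, while rule (I) gives the
-- value y at 1. Compatibility of E with coproducts is what makes rule (IV), stated with the
-- coproduct of ℋ, agree with the extension of T by deconcatenation. On the side of ◇_s the obstacle
-- is that the recursion strips single letters x and y from the left factor and so leaves 𝒜_1^1. The
-- identity is therefore proved for all words of 𝒜_1, rewritten through x = z - y as combinations of
-- v z^m with v in 𝒜_1^1, where v z^m acts as T_v followed by right multiplication by z^m.

private variable
  A B C I J : Set

-- Formal sums tested against linear functionals

ev : List (ℚ × A) → (A → ℚ) → ℚ
ev [] F = 0ℚ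
ev ((c , a) ∷ p) F = c * F a + ev p F

-- Equality against all linear functionals; unlike equality of coefficients it is visibly preserved
-- by every operation that is defined by linear extension.
infix 4 _≃_
record _≃_ {A : Set} (p q : Poly A) : Set where
  constructor mk≃
  field at : ∀ F → ev p F ≡ ev q F
open _≃_ public

≃-refl : {p : Poly A} → p ≃ p
≃-refl = mk≃ λ F → refl

≃-sym : {p q : Poly A} → p ≃ q → q ≃ p
≃-sym e = mk≃ λ F → sym (at e F)

≃-trans : {p q r : Poly A} → p ≃ q → q ≃ r → p ≃ r
≃-trans e e′ = mk≃ λ F → trans (at e F) (at e′ F)

≃-reflexive : {p q : Poly A} → p ≡ q → p ≃ q
≃-reflexive refl = ≃-refl

PolySetoid : Set → Setoid 0ℓ 0ℓ
PolySetoid A = record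
  { Carrier = Poly A ; _≈_ = _≃_
  ; isEquivalence = record { refl = ≃-refl ; sym = ≃-sym ; trans = ≃-trans } }

module ≃-Reasoning {A : Set} = SetoidReasoning (PolySetoid A)

ev-cong : (p : List (ℚ × A)) {F G : A → ℚ} → (∀ a → F a ≡ G a) → ev p F ≡ ev p G
ev-cong [] e = refl
ev-cong ((c , a) ∷ p) e = cong₂ _+_ (cong (c *_) (e a)) (ev-cong p e)

ev-++ : (p q : List (ℚ × A)) (F : A → ℚ) → ev (p ++ q) F ≡ ev p F + ev q F
ev-++ [] q F = sym (+-identityˡ _)
ev-++ ((c , a) ∷ p) q F =
  trans (cong (c * F a +_) (ev-++ p q F)) (sym (+-assoc (c * F a) _ _))

ev-· : (c : ℚ) (p : Poly A) (F : Word A → ℚ) → ev (c · p) F ≡ c * ev p F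
ev-· c [] F = sym (*-zeroʳ c)
ev-· c ((a , w) ∷ p) F =
  trans (cong₂ _+_ (*-assoc c a (F w)) (ev-· c p F)) (sym (*-distribˡ-+ c _ _))

ev-wd : (w : Word A) (F : Word A → ℚ) → ev (wd w) F ≡ F w
ev-wd w F = trans (+-identityʳ _) (*-identityˡ _)

ev-0 : (p : List (ℚ × A)) → ev p (λ _ → 0ℚ) ≡ 0ℚ
ev-0 [] = refl
ev-0 ((c , a) ∷ p) = cong₂ _+_ (*-zeroʳ c) (ev-0 p)

ev-+ : (p : List (ℚ × A)) (F G : A → ℚ) → ev p (λ a → F a + G a) ≡ ev p F + ev p G
ev-+ [] F G = refl
ev-+ ((c , a) ∷ p) F G =
  trans (cong₂ _+_ (*-distribˡ-+ c _ _) (ev-+ p F G)) (interchange (c * F a) (c * G a) _ _)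
  where
  open CSemigroup (CommutativeMonoid.commutativeSemigroup +-0-commutativeMonoid) using (interchange)

ev-* : (c : ℚ) (p : List (ℚ × A)) (F : A → ℚ) → ev p (λ a → c * F a) ≡ c * ev p F
ev-* c [] F = sym (*-zeroʳ c)
ev-* c ((b , a) ∷ p) F = trans (cong₂ _+_ swap (ev-* c p F)) (sym (*-distribˡ-+ c _ _))
  where
  swap : b * (c * F a) ≡ c * (b * F a)
  swap = trans (sym (*-assoc b c _)) (trans (cong (_* F a) (*-comm b c)) (*-assoc c b _))

ev-swap : (p : List (ℚ × A)) (q : List (ℚ × B)) (F : A → B → ℚ) →
  ev p (λ a → ev q (F a)) ≡ ev q (λ b → ev p (λ a → F a b))
ev-swap [] q F = sym (ev-0 q)
ev-swap ((c , a) ∷ p) q F = begin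
  c * ev q (F a) + ev p (λ a → ev q (F a))
    ≡⟨ cong₂ _+_ (sym (ev-* c q (F a))) (ev-swap p q F) ⟩
  ev q (λ b → c * F a b) + ev q (λ b → ev p (λ a → F a b))
    ≡⟨ sym (ev-+ q _ _) ⟩
  ev q (λ b → c * F a b + ev p (λ a → F a b)) ∎
  where open ≡-Reasoning

ev-linExt : (G : Word A → Poly B) (p : Poly A) (F : Word B → ℚ) →
  ev (linExt G p) F ≡ ev p (λ w → ev (G w) F)
ev-linExt G [] F = refl
ev-linExt G ((c , w) ∷ p) F =
  trans (ev-++ (c · G w) (linExt G p) F) (cong₂ _+_ (ev-· c (G w) F) (ev-linExt G p F))

ev-⊗ : (p q : Poly A) (F : Word A → ℚ) →
  ev (p ⊗ q) F ≡ ev p (λ u → ev q (λ v → F (u ++ v)))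
ev-⊗ [] q F = refl
ev-⊗ {A} ((c , u) ∷ p) q F =
  trans (ev-++ (scaled q) (p ⊗ q) F) (cong₂ _+_ (ev-scaled q) (ev-⊗ p q F))
  where
  scaled : Poly A → Poly A
  scaled = map (λ { (b , v) → (c * b , u ++ v) })
  ev-scaled : ∀ q → ev (scaled q) F ≡ c * ev q (λ v → F (u ++ v))
  ev-scaled [] = sym (*-zeroʳ c)
  ev-scaled ((b , v) ∷ q) =
    trans (cong₂ _+_ (*-assoc c b (F (u ++ v))) (ev-scaled q)) (sym (*-distribˡ-+ c _ _))

infixl 6 _⊞_ _⊟_
infixl 7 _⊠_
infixr 8 _•_

-- Opaque copies of the operations of Defs: those unfold, so unification could not read
-- the operands off an expression.
opaque
  𝟘 𝟙 : Poly A
  𝟘 = 0P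
  𝟙 = 1P

  mon : Word A → Poly A
  mon = wd

  _⊞_ _⊟_ _⊠_ : Poly A → Poly A → Poly A
  _⊞_ = _⊕_
  _⊟_ = _⊝_
  _⊠_ = _⊗_

  _•_ : ℚ → Poly A → Poly A
  _•_ = _·_

  ext : (Word A → Poly B) → Poly A → Poly B
  ext = linExt

  0P≃ : 0P {A} ≃ 𝟘
  0P≃ = ≃-refl

  1P≃ : 1P {A} ≃ 𝟙
  1P≃ = ≃-refl

  wd≃ : {w : Word A} → wd w ≃ mon w
  wd≃ = ≃-refl

  ev-𝟘 : (F : Word A → ℚ) → ev 𝟘 F ≡ 0ℚ
  ev-𝟘 F = refl

  ev-𝟙 : (F : Word A → ℚ) → ev 𝟙 F ≡ F []
  ev-𝟙 F = ev-wd [] F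

  ev-mon : (w : Word A) (F : Word A → ℚ) → ev (mon w) F ≡ F w
  ev-mon = ev-wd

  ev-⊞ : (p q : Poly A) (F : Word A → ℚ) → ev (p ⊞ q) F ≡ ev p F + ev q F
  ev-⊞ = ev-++

  ev-⊟ : (p q : Poly A) (F : Word A → ℚ) → ev (p ⊟ q) F ≡ ev p F + - 1ℚ * ev q F
  ev-⊟ p q F = trans (ev-++ p (⊖ q) F) (cong (ev p F +_) (ev-· (- 1ℚ) q F))

  ev-⊠ : (p q : Poly A) (F : Word A → ℚ) →
    ev (p ⊠ q) F ≡ ev p (λ u → ev q (λ v → F (u ++ v)))
  ev-⊠ = ev-⊗

  ev-• : (c : ℚ) (p : Poly A) (F : Word A → ℚ) → ev (c • p) F ≡ c * ev p F
  ev-• = ev-·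

  ev-ext : (G : Word A → Poly B) (p : Poly A) (F : Word B → ℚ) →
    ev (ext G p) F ≡ ev p (λ w → ev (G w) F)
  ev-ext = ev-linExt

⊞-cong : {p p′ q q′ : Poly A} → p ≃ p′ → q ≃ q′ → p ⊞ q ≃ p′ ⊞ q′
⊞-cong {p = p} {p′} {q} {q′} e e′ = mk≃ λ F →
  trans (ev-⊞ p q F) (trans (cong₂ _+_ (at e F) (at e′ F)) (sym (ev-⊞ p′ q′ F)))

⊟-cong : {p p′ q q′ : Poly A} → p ≃ p′ → q ≃ q′ → p ⊟ q ≃ p′ ⊟ q′
⊟-cong {p = p} {p′} {q} {q′} e e′ = mk≃ λ F →
  trans (ev-⊟ p q F) (trans (cong₂ (λ a b → a + - 1ℚ * b) (at e F) (at e′ F)) (sym (ev-⊟ p′ q′ F)))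

•-cong : (c : ℚ) {p q : Poly A} → p ≃ q → c • p ≃ c • q
•-cong c {p} {q} e = mk≃ λ F →
  trans (ev-• c p F) (trans (cong (c *_) (at e F)) (sym (ev-• c q F)))

⊠-cong : {p p′ q q′ : Poly A} → p ≃ p′ → q ≃ q′ → p ⊠ q ≃ p′ ⊠ q′
⊠-cong {p = p} {p′} {q} {q′} e e′ = mk≃ λ F → begin
  ev (p ⊠ q) F                            ≡⟨ ev-⊠ p q F ⟩
  ev p (λ u → ev q (λ v → F (u ++ v)))    ≡⟨ at e _ ⟩
  ev p′ (λ u → ev q (λ v → F (u ++ v)))   ≡⟨ ev-cong p′ (λ u → at e′ _) ⟩
  ev p′ (λ u → ev q′ (λ v → F (u ++ v)))  ≡⟨ sym (ev-⊠ p′ q′ F) ⟩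
  ev (p′ ⊠ q′) F                          ∎
  where open ≡-Reasoning

⊠-congˡ : {p q q′ : Poly A} → q ≃ q′ → p ⊠ q ≃ p ⊠ q′
⊠-congˡ = ⊠-cong ≃-refl

⊠-congʳ : {p p′ q : Poly A} → p ≃ p′ → p ⊠ q ≃ p′ ⊠ q
⊠-congʳ e = ⊠-cong e ≃-refl

opaque
  unfolding _⊞_

  -- These bridges pass to the opaque copy and rewrite the operands in the same step, so that a term
  -- in the original operations is translated from the inside out.
  ⊕≃ : {p p′ q q′ : Poly A} → p ≃ p′ → q ≃ q′ → p ⊕ q ≃ p′ ⊞ q′
  ⊕≃ = ⊞-cong

  ⊝≃ : {p p′ q q′ : Poly A} → p ≃ p′ → q ≃ q′ → p ⊝ q ≃ p′ ⊟ q′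
  ⊝≃ = ⊟-cong

  ⊗≃ : {p p′ q q′ : Poly A} → p ≃ p′ → q ≃ q′ → p ⊗ q ≃ p′ ⊠ q′
  ⊗≃ = ⊠-cong

  ·≃ : (c : ℚ) {p p′ : Poly A} → p ≃ p′ → c · p ≃ c • p′
  ·≃ = •-cong

⊞-comm : (p q : Poly A) → p ⊞ q ≃ q ⊞ p
⊞-comm p q = mk≃ λ F → trans (ev-⊞ p q F) (trans (+-comm (ev p F) (ev q F)) (sym (ev-⊞ q p F)))

⊞-assoc : (p q r : Poly A) → (p ⊞ q) ⊞ r ≃ p ⊞ (q ⊞ r)
⊞-assoc p q r = mk≃ λ F → begin
  ev ((p ⊞ q) ⊞ r) F           ≡⟨ trans (ev-⊞ (p ⊞ q) r F) (cong (_+ ev r F) (ev-⊞ p q F)) ⟩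
  (ev p F + ev q F) + ev r F   ≡⟨ +-assoc (ev p F) (ev q F) (ev r F) ⟩
  ev p F + (ev q F + ev r F)   ≡⟨ sym (trans (ev-⊞ p (q ⊞ r) F) (cong (ev p F +_) (ev-⊞ q r F))) ⟩
  ev (p ⊞ (q ⊞ r)) F           ∎
  where open ≡-Reasoning

⊞-identityʳ : (p : Poly A) → p ⊞ 𝟘 ≃ p
⊞-identityʳ p = mk≃ λ F →
  trans (ev-⊞ p 𝟘 F) (trans (cong (ev p F +_) (ev-𝟘 F)) (+-identityʳ (ev p F)))

⊞-identityˡ : (p : Poly A) → 𝟘 ⊞ p ≃ p
⊞-identityˡ p = ≃-trans (⊞-comm 𝟘 p) (⊞-identityʳ p)

⊟-via-• : (p q : Poly A) → p ⊟ q ≃ p ⊞ (- 1ℚ) • q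
⊟-via-• p q = mk≃ λ F → trans (ev-⊟ p q F)
  (sym (trans (ev-⊞ p _ F) (cong (ev p F +_) (ev-• (- 1ℚ) q F))))

⊞-inverse : (p : Poly A) → p ⊞ (- 1ℚ) • p ≃ 𝟘
⊞-inverse p = mk≃ λ F → begin
  ev (p ⊞ (- 1ℚ) • p) F     ≡⟨ trans (ev-⊞ p _ F) (cong (ev p F +_) (ev-• (- 1ℚ) p F)) ⟩
  ev p F + - 1ℚ * ev p F    ≡⟨ cong (ev p F +_) (sym (neg-distribˡ-* 1ℚ (ev p F))) ⟩
  ev p F + - (1ℚ * ev p F)  ≡⟨ cong (λ a → ev p F + - a) (*-identityˡ (ev p F)) ⟩
  ev p F + - ev p F         ≡⟨ +-inverseʳ (ev p F) ⟩
  0ℚ                        ≡⟨ sym (ev-𝟘 F) ⟩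
  ev 𝟘 F                    ∎
  where open ≡-Reasoning

•-• : (c d : ℚ) (p : Poly A) → c • d • p ≃ (c * d) • p
•-• c d p = mk≃ λ F → trans (ev-• c (d • p) F) (trans (cong (c *_) (ev-• d p F))
  (trans (sym (*-assoc c d (ev p F))) (sym (ev-• (c * d) p F))))

1• : (p : Poly A) → 1ℚ • p ≃ p
1• p = mk≃ λ F → trans (ev-• 1ℚ p F) (*-identityˡ (ev p F))

0• : (p : Poly A) → 0ℚ • p ≃ 𝟘
0• p = mk≃ λ F → trans (ev-• 0ℚ p F) (trans (*-zeroˡ (ev p F)) (sym (ev-𝟘 F)))

•-⊞ : (c : ℚ) (p q : Poly A) → c • (p ⊞ q) ≃ c • p ⊞ c • q
•-⊞ c p q = mk≃ λ F → begin
  ev (c • (p ⊞ q)) F         ≡⟨ trans (ev-• c (p ⊞ q) F) (cong (c *_) (ev-⊞ p q F)) ⟩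
  c * (ev p F + ev q F)      ≡⟨ *-distribˡ-+ c (ev p F) (ev q F) ⟩
  c * ev p F + c * ev q F    ≡⟨ sym (trans (ev-⊞ (c • p) (c • q) F) (cong₂ _+_ (ev-• c p F) (ev-• c q F))) ⟩
  ev (c • p ⊞ c • q) F       ∎
  where open ≡-Reasoning

•-𝟘 : (c : ℚ) → c • 𝟘 ≃ 𝟘 {A}
•-𝟘 c = mk≃ λ F → trans (ev-• c 𝟘 F) (trans (cong (c *_) (ev-𝟘 F)) (trans (*-zeroʳ c) (sym (ev-𝟘 F))))

⊠-assoc : (p q r : Poly A) → (p ⊠ q) ⊠ r ≃ p ⊠ (q ⊠ r)
⊠-assoc p q r = mk≃ λ F → begin
  ev ((p ⊠ q) ⊠ r) F
    ≡⟨ trans (ev-⊠ (p ⊠ q) r F) (ev-⊠ p q _) ⟩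
  ev p (λ u → ev q (λ v → ev r (λ w → F ((u ++ v) ++ w))))
    ≡⟨ ev-cong p (λ u → ev-cong q (λ v → ev-cong r (λ w → cong F (Listₚ.++-assoc u v w)))) ⟩
  ev p (λ u → ev q (λ v → ev r (λ w → F (u ++ (v ++ w)))))
    ≡⟨ ev-cong p (λ u → sym (ev-⊠ q r _)) ⟩
  ev p (λ u → ev (q ⊠ r) (λ v → F (u ++ v)))
    ≡⟨ sym (ev-⊠ p (q ⊠ r) F) ⟩
  ev (p ⊠ (q ⊠ r)) F ∎
  where open ≡-Reasoning

⊠-identityˡ : (p : Poly A) → 𝟙 ⊠ p ≃ p
⊠-identityˡ p = mk≃ λ F → trans (ev-⊠ 𝟙 p F) (ev-𝟙 _)

⊠-identityʳ : (p : Poly A) → p ⊠ 𝟙 ≃ p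
⊠-identityʳ p = mk≃ λ F → trans (ev-⊠ p 𝟙 F) (ev-cong p (λ u →
  trans (ev-𝟙 _) (cong F (Listₚ.++-identityʳ u))))

mon-⊠ : (u v : Word A) → mon u ⊠ mon v ≃ mon (u ++ v)
mon-⊠ u v = mk≃ λ F → trans (ev-⊠ (mon u) (mon v) F)
  (trans (ev-mon u _) (trans (ev-mon v _) (sym (ev-mon (u ++ v) F))))

𝟙≃mon : 𝟙 {A} ≃ mon []
𝟙≃mon = mk≃ λ F → trans (ev-𝟙 F) (sym (ev-mon [] F))

-- Linear maps and extension from words

record Linear {A B : Set} (h : Poly A → Poly B) : Set where
  field
    -- A separate field: a function on lists of terms can depend on the representative.
    respects : ∀ {p q} → p ≃ q → h p ≃ h q
    add      : ∀ p q → h (p ⊞ q) ≃ h p ⊞ h q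
    scale    : ∀ c p → h (c • p) ≃ c • h p
  zer : h 𝟘 ≃ 𝟘
  zer = ≃-trans (respects (≃-sym (0• 𝟘))) (≃-trans (scale 0ℚ 𝟘) (0• (h 𝟘)))
  sub : ∀ p q → h (p ⊟ q) ≃ h p ⊟ h q
  sub p q = ≃-trans (respects (⊟-via-• p q)) (≃-trans (add p _)
    (≃-trans (⊞-cong ≃-refl (scale (- 1ℚ) q)) (≃-sym (⊟-via-• (h p) (h q)))))
open Linear public

id-linear : Linear {A} (λ p → p)
id-linear = record { respects = λ e → e ; add = λ _ _ → ≃-refl ; scale = λ _ _ → ≃-refl }

linear-∘ : {h : Poly B → Poly C} {k : Poly A → Poly B} → Linear h → Linear k → Linear (λ p → h (k p))
linear-∘ H K = record
  { respects = λ e → respects H (respects K e)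
  ; add = λ p q → ≃-trans (respects H (add K p q)) (add H _ _)
  ; scale = λ c p → ≃-trans (respects H (scale K c p)) (scale H c _) }

ext-linear : (G : Word A → Poly B) → Linear (ext G)
ext-linear G = record
  { respects = λ {p} {q} e → mk≃ λ F →
      trans (ev-ext G p F) (trans (at e _) (sym (ev-ext G q F)))
  ; add = λ p q → mk≃ λ F → trans (ev-ext G (p ⊞ q) F) (trans (ev-⊞ p q _)
      (sym (trans (ev-⊞ (ext G p) (ext G q) F) (cong₂ _+_ (ev-ext G p F) (ev-ext G q F)))))
  ; scale = λ c p → mk≃ λ F → trans (ev-ext G (c • p) F) (trans (ev-• c p _)
      (sym (trans (ev-• c (ext G p) F) (cong (c *_) (ev-ext G p F))))) }

⊠ʳ-linear : (q : Poly A) → Linear (_⊠ q)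
⊠ʳ-linear q = record
  { respects = ⊠-congʳ
  ; add = λ p p′ → mk≃ λ F → trans (ev-⊠ (p ⊞ p′) q F) (trans (ev-⊞ p p′ _)
      (sym (trans (ev-⊞ (p ⊠ q) (p′ ⊠ q) F) (cong₂ _+_ (ev-⊠ p q F) (ev-⊠ p′ q F)))))
  ; scale = λ c p → mk≃ λ F → trans (ev-⊠ (c • p) q F) (trans (ev-• c p _)
      (sym (trans (ev-• c (p ⊠ q) F) (cong (c *_) (ev-⊠ p q F))))) }

⊠ˡ-linear : (p : Poly A) → Linear (p ⊠_)
⊠ˡ-linear p = record
  { respects = ⊠-congˡ
  ; add = λ q q′ → mk≃ λ F → trans (ev-⊠ p (q ⊞ q′) F) (trans (ev-cong p (λ u → ev-⊞ q q′ _))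
      (trans (ev-+ p _ _)
      (sym (trans (ev-⊞ (p ⊠ q) (p ⊠ q′) F) (cong₂ _+_ (ev-⊠ p q F) (ev-⊠ p q′ F))))))
  ; scale = λ c q → mk≃ λ F → trans (ev-⊠ p (c • q) F) (trans (ev-cong p (λ u → ev-• c q _))
      (trans (ev-* c p _)
      (sym (trans (ev-• c (p ⊠ q) F) (cong (c *_) (ev-⊠ p q F)))))) }

ext-cong : {G H : Word A → Poly B} (p : Poly A) → (∀ w → G w ≃ H w) → ext G p ≃ ext H p
ext-cong {G = G} {H} p e = mk≃ λ F →
  trans (ev-ext G p F) (trans (ev-cong p (λ w → at (e w) F)) (sym (ev-ext H p F)))

ext-cong₂ : {G H : Word A → Poly B} {p q : Poly A} → (∀ w → G w ≃ H w) → p ≃ q → ext G p ≃ ext H q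
ext-cong₂ {G = G} {H} {p} e e′ = ≃-trans (ext-cong p e) (respects (ext-linear H) e′)

opaque
  unfolding ext

  linExt≃ : {G H : Word A → Poly B} {p q : Poly A} → (∀ w → G w ≃ H w) → p ≃ q → linExt G p ≃ ext H q
  linExt≃ = ext-cong₂

  linExt-linear : (G : Word A → Poly B) → Linear (linExt G)
  linExt-linear G = ext-linear G

ext-mon : (G : Word A → Poly B) (w : Word A) → ext G (mon w) ≃ G w
ext-mon G w = mk≃ λ F → trans (ev-ext G (mon w) F) (ev-mon w _)

ext-⊞ : (G H : Word A → Poly B) (p : Poly A) →
  ext (λ w → G w ⊞ H w) p ≃ ext G p ⊞ ext H p
ext-⊞ G H p = mk≃ λ F → trans (ev-ext _ p F) (trans (ev-cong p (λ w → ev-⊞ (G w) (H w) F))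
  (trans (ev-+ p _ _) (sym (trans (ev-⊞ (ext G p) (ext H p) F) (cong₂ _+_ (ev-ext G p F) (ev-ext H p F))))))

ext-• : (c : ℚ) (G : Word A → Poly B) (p : Poly A) →
  ext (λ w → c • G w) p ≃ c • ext G p
ext-• c G p = mk≃ λ F → trans (ev-ext _ p F) (trans (ev-cong p (λ w → ev-• c (G w) F))
  (trans (ev-* c p _) (sym (trans (ev-• c (ext G p) F) (cong (c *_) (ev-ext G p F))))))

ext-⊟ : (G H : Word A → Poly B) (p : Poly A) →
  ext (λ w → G w ⊟ H w) p ≃ ext G p ⊟ ext H p
ext-⊟ G H p = begin
  ext (λ w → G w ⊟ H w) p               ≈⟨ ext-cong p (λ w → ⊟-via-• (G w) (H w)) ⟩
  ext (λ w → G w ⊞ (- 1ℚ) • H w) p      ≈⟨ ext-⊞ G (λ w → (- 1ℚ) • H w) p ⟩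
  ext G p ⊞ ext (λ w → (- 1ℚ) • H w) p  ≈⟨ ⊞-cong ≃-refl (ext-• (- 1ℚ) H p) ⟩
  ext G p ⊞ (- 1ℚ) • ext H p            ≈⟨ ≃-sym (⊟-via-• (ext G p) (ext H p)) ⟩
  ext G p ⊟ ext H p                     ∎
  where open ≃-Reasoning

ext-id : (p : Poly A) → ext mon p ≃ p
ext-id p = mk≃ λ F → trans (ev-ext mon p F) (ev-cong p (λ w → ev-mon w F))

ext-swap : (p : Poly A) (q : Poly B) (G : Word A → Word B → Poly C) →
  ext (λ v → ext (G v) q) p ≃ ext (λ w → ext (λ v → G v w) p) q
ext-swap p q G = mk≃ λ F → begin
  ev (ext (λ v → ext (G v) q) p) F
    ≡⟨ trans (ev-ext _ p F) (ev-cong p (λ v → ev-ext (G v) q F)) ⟩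
  ev p (λ v → ev q (λ w → ev (G v w) F))
    ≡⟨ ev-swap p q _ ⟩
  ev q (λ w → ev p (λ v → ev (G v w) F))
    ≡⟨ sym (trans (ev-ext _ q F) (ev-cong q (λ w → ev-ext (λ v → G v w) p F))) ⟩
  ev (ext (λ w → ext (λ v → G v w) p) q) F ∎
  where open ≡-Reasoning

opaque
  unfolding ext _⊞_ _•_ 𝟘

  -- Unfolded, `ext G` of a nonempty list is a scaled value plus `ext G` of the tail, so additivity
  -- and homogeneity suffice. This is how products, `T v` and `divR` are moved through finite sums.
  linear-ext : {h : Poly B → Poly C} → Linear h → (G : Word A → Poly B) (p : Poly A) →
    h (ext G p) ≃ ext (λ w → h (G w)) p
  linear-ext H G [] = zer H
  linear-ext H G ((c , w) ∷ p) =
    ≃-trans (add H (c · G w) (linExt G p)) (⊞-cong (scale H c (G w)) (linear-ext H G p))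

  concatMap-congᴬ : {G H : I → Poly B} {xs : List I} →
    All (λ i → G i ≃ H i) xs → concatMap G xs ≃ concatMap H xs
  concatMap-congᴬ [] = ≃-refl
  concatMap-congᴬ (e ∷ es) = ⊞-cong e (concatMap-congᴬ es)

  linear-concatMap : {h : Poly A → Poly B} → Linear h → (G : I → Poly A) (xs : List I) →
    h (concatMap G xs) ≃ concatMap (λ i → h (G i)) xs
  linear-concatMap H G [] = zer H
  linear-concatMap H G (i ∷ xs) = ≃-trans (add H (G i) _) (⊞-cong ≃-refl (linear-concatMap H G xs))

concatMap-cong : {G H : I → Poly B} (xs : List I) → (∀ i → G i ≃ H i) → concatMap G xs ≃ concatMap H xs
concatMap-cong xs e = concatMap-congᴬ (All.universal e xs)

linear-≃-ext : {h : Poly A → Poly B} → Linear h → (p : Poly A) → h p ≃ ext (λ w → h (mon w)) p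
linear-≃-ext H p = ≃-trans (respects H (≃-sym (ext-id p))) (linear-ext H mon p)

linear-unique : {h k : Poly A → Poly B} → Linear h → Linear k →
  (∀ w → h (mon w) ≃ k (mon w)) → ∀ p → h p ≃ k p
linear-unique H K e p =
  ≃-trans (linear-≃-ext H p) (≃-trans (ext-cong p e) (≃-sym (linear-≃-ext K p)))

-- A solver for identities in noncommutative rings

infixl 6 _:+_ _:-_
infixl 7 _:*_

data Expr (m : ℕ) : Set where
  var            : Fin m → Expr m
  :0 :1          : Expr m
  _:+_ _:-_ _:*_ : Expr m → Expr m → Expr m

a₀ : ∀ {m} → Expr (suc m)
a₀ = var fz
a₁ : ∀ {m} → Expr (suc (suc m))
a₁ = var (fs fz)
a₂ : ∀ {m} → Expr (suc (suc (suc m)))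
a₂ = var (fs (fs fz))
a₃ : ∀ {m} → Expr (suc (suc (suc (suc m))))
a₃ = var (fs (fs (fs fz)))
a₄ : ∀ {m} → Expr (suc (suc (suc (suc (suc m)))))
a₄ = var (fs (fs (fs (fs fz))))
a₅ : ∀ {m} → Expr (suc (suc (suc (suc (suc (suc m))))))
a₅ = var (fs (fs (fs (fs (fs fz)))))
a₆ : ∀ {m} → Expr (suc (suc (suc (suc (suc (suc (suc m)))))))
a₆ = var (fs (fs (fs (fs (fs (fs fz))))))
a₇ : ∀ {m} → Expr (suc (suc (suc (suc (suc (suc (suc (suc m))))))))
a₇ = var (fs (fs (fs (fs (fs (fs (fs fz)))))))

a₈ : ∀ {m} → Expr (suc (suc (suc (suc (suc (suc (suc (suc (suc m)))))))))
a₈ = var (fs (fs (fs (fs (fs (fs (fs (fs fz))))))))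

-- The signed monomials (true is the sign +) of an expanded expression.
NF : ℕ → Set
NF m = List (Bool × List (Fin m))

negate : ∀ {m} → NF m → NF m
negate [] = []
negate ((b , w) ∷ n) = (not b , w) ∷ negate n

xnor : Bool → Bool → Bool
xnor true c = c
xnor false c = not c

mulTerm : ∀ {m} → Bool → List (Fin m) → NF m → NF m
mulTerm b u [] = []
mulTerm b u ((c , w) ∷ n) = (xnor b c , u ++ w) ∷ mulTerm b u n

mulNF : ∀ {m} → NF m → NF m → NF m
mulNF [] n′ = []
mulNF ((b , u) ∷ n) n′ = mulTerm b u n′ ++ mulNF n n′

expand : ∀ {m} → Expr m → NF m
expand (var i) = (true , i ∷ []) ∷ []
expand :0 = []
expand :1 = (true , []) ∷ []
expand (e :+ e′) = expand e ++ expand e′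
expand (e :- e′) = expand e ++ negate (expand e′)
expand (e :* e′) = mulNF (expand e) (expand e′)

-- Inserts a signed monomial into a reduced list, deleting at most one copy of the opposite sign.
-- Equal signs are not merged; multiplicity is kept as repetition.
cancel : ∀ {m} → Bool → List (Fin m) → NF m → NF m
cancel b u [] = (b , u) ∷ []
cancel b u ((c , w) ∷ n) with not b ≟B c | ≟W Finₚ._≟_ u w
... | yes _ | yes _ = n
... | _     | _     = (c , w) ∷ cancel b u n

reduce : ∀ {m} → NF m → NF m
reduce [] = []
reduce ((b , u) ∷ n) = cancel b u (reduce n)

module _ {A : Set} {m : ℕ} (ρ : Vec (Poly A) m) where

  ⟦_⟧ : Expr m → Poly A
  ⟦ var i ⟧ = lookup ρ i
  ⟦ :0 ⟧ = 𝟘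
  ⟦ :1 ⟧ = 𝟙
  ⟦ e :+ e′ ⟧ = ⟦ e ⟧ ⊞ ⟦ e′ ⟧
  ⟦ e :- e′ ⟧ = ⟦ e ⟧ ⊟ ⟦ e′ ⟧
  ⟦ e :* e′ ⟧ = ⟦ e ⟧ ⊠ ⟦ e′ ⟧

  ⟦_⟧W : List (Fin m) → Poly A
  ⟦ [] ⟧W = 𝟙
  ⟦ i ∷ u ⟧W = lookup ρ i ⊠ ⟦ u ⟧W

  sign : Bool → ℚ
  sign true = 1ℚ
  sign false = - 1ℚ

  ⟦_⟧N : NF m → Poly A
  ⟦ [] ⟧N = 𝟘
  ⟦ (b , u) ∷ n ⟧N = sign b • ⟦ u ⟧W ⊞ ⟦ n ⟧N

  open ≃-Reasoning

  ++-sound : ∀ n n′ → ⟦ n ++ n′ ⟧N ≃ ⟦ n ⟧N ⊞ ⟦ n′ ⟧N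
  ++-sound [] n′ = ≃-sym (⊞-identityˡ _)
  ++-sound ((b , u) ∷ n) n′ = ≃-trans (⊞-cong ≃-refl (++-sound n n′)) (≃-sym (⊞-assoc _ _ _))

  -sign : ∀ b → - 1ℚ * sign b ≡ sign (not b)
  -sign true = refl
  -sign false = refl

  sign-xnor : ∀ b c → sign b * sign c ≡ sign (xnor b c)
  sign-xnor true true = refl
  sign-xnor true false = refl
  sign-xnor false true = refl
  sign-xnor false false = refl

  •-≡ : ∀ {c d} {p : Poly A} → c ≡ d → c • p ≃ d • p
  •-≡ refl = ≃-refl

  negate-sound : ∀ n → ⟦ negate n ⟧N ≃ (- 1ℚ) • ⟦ n ⟧N
  negate-sound [] = ≃-sym (•-𝟘 (- 1ℚ))
  negate-sound ((b , u) ∷ n) = begin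
    sign (not b) • ⟦ u ⟧W ⊞ ⟦ negate n ⟧N
      ≈⟨ ⊞-cong (≃-sym (≃-trans (•-• (- 1ℚ) (sign b) _) (•-≡ (-sign b)))) (negate-sound n) ⟩
    (- 1ℚ) • sign b • ⟦ u ⟧W ⊞ (- 1ℚ) • ⟦ n ⟧N
      ≈⟨ ≃-sym (•-⊞ (- 1ℚ) _ _) ⟩
    (- 1ℚ) • (sign b • ⟦ u ⟧W ⊞ ⟦ n ⟧N) ∎

  word-++ : ∀ u w → ⟦ u ++ w ⟧W ≃ ⟦ u ⟧W ⊠ ⟦ w ⟧W
  word-++ [] w = ≃-sym (⊠-identityˡ _)
  word-++ (i ∷ u) w = ≃-trans (⊠-congˡ (word-++ u w)) (≃-sym (⊠-assoc _ _ _))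

  mulTerm-sound : ∀ b u n → ⟦ mulTerm b u n ⟧N ≃ (sign b • ⟦ u ⟧W) ⊠ ⟦ n ⟧N
  mulTerm-sound b u [] = ≃-sym (zer (⊠ˡ-linear _))
  mulTerm-sound b u ((c , w) ∷ n) = begin
    sign (xnor b c) • ⟦ u ++ w ⟧W ⊞ ⟦ mulTerm b u n ⟧N
      ≈⟨ ⊞-cong (•-cong _ (word-++ u w)) (mulTerm-sound b u n) ⟩
    sign (xnor b c) • (⟦ u ⟧W ⊠ ⟦ w ⟧W) ⊞ (sign b • ⟦ u ⟧W) ⊠ ⟦ n ⟧N
      ≈⟨ ⊞-cong (≃-sym (≃-trans (•-• (sign b) (sign c) _) (•-≡ (sign-xnor b c)))) ≃-refl ⟩
    sign b • sign c • (⟦ u ⟧W ⊠ ⟦ w ⟧W) ⊞ (sign b • ⟦ u ⟧W) ⊠ ⟦ n ⟧N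
      ≈⟨ ⊞-cong (≃-sym (≃-trans (scale (⊠ʳ-linear _) (sign b) _) (•-cong (sign b) (scale (⊠ˡ-linear _) (sign c) _)))) ≃-refl ⟩
    (sign b • ⟦ u ⟧W) ⊠ (sign c • ⟦ w ⟧W) ⊞ (sign b • ⟦ u ⟧W) ⊠ ⟦ n ⟧N
      ≈⟨ ≃-sym (add (⊠ˡ-linear _) _ _) ⟩
    (sign b • ⟦ u ⟧W) ⊠ (sign c • ⟦ w ⟧W ⊞ ⟦ n ⟧N) ∎

  mulNF-sound : ∀ n n′ → ⟦ mulNF n n′ ⟧N ≃ ⟦ n ⟧N ⊠ ⟦ n′ ⟧N
  mulNF-sound [] n′ = ≃-sym (zer (⊠ʳ-linear _))
  mulNF-sound ((b , u) ∷ n) n′ =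
    ≃-trans (++-sound (mulTerm b u n′) (mulNF n n′))
    (≃-trans (⊞-cong (mulTerm-sound b u n′) (mulNF-sound n n′)) (≃-sym (add (⊠ʳ-linear _) _ _)))

  expand-sound : ∀ e → ⟦ expand e ⟧N ≃ ⟦ e ⟧
  expand-sound (var i) = ≃-trans (⊞-identityʳ _) (≃-trans (1• _) (⊠-identityʳ _))
  expand-sound :0 = ≃-refl
  expand-sound :1 = ≃-trans (⊞-identityʳ _) (1• _)
  expand-sound (e :+ e′) =
    ≃-trans (++-sound (expand e) (expand e′)) (⊞-cong (expand-sound e) (expand-sound e′))
  expand-sound (e :- e′) = begin
    ⟦ expand e ++ negate (expand e′) ⟧N
      ≈⟨ ++-sound (expand e) (negate (expand e′)) ⟩
    ⟦ expand e ⟧N ⊞ ⟦ negate (expand e′) ⟧N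
      ≈⟨ ⊞-cong (expand-sound e) (≃-trans (negate-sound (expand e′)) (•-cong (- 1ℚ) (expand-sound e′))) ⟩
    ⟦ e ⟧ ⊞ (- 1ℚ) • ⟦ e′ ⟧
      ≈⟨ ≃-sym (⊟-via-• ⟦ e ⟧ ⟦ e′ ⟧) ⟩
    ⟦ e ⟧ ⊟ ⟦ e′ ⟧ ∎
  expand-sound (e :* e′) =
    ≃-trans (mulNF-sound (expand e) (expand e′)) (⊠-cong (expand-sound e) (expand-sound e′))

  opposite : ∀ b (p : Poly A) → sign b • p ⊞ sign (not b) • p ≃ 𝟘
  opposite true p = ≃-trans (⊞-cong (1• p) ≃-refl) (⊞-inverse p)
  opposite false p = ≃-trans (⊞-comm _ _) (opposite true p)

  cancel-sound : ∀ b u n → ⟦ cancel b u n ⟧N ≃ sign b • ⟦ u ⟧W ⊞ ⟦ n ⟧N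
  cancel-keep : ∀ b u c w n →
    ⟦ (c , w) ∷ cancel b u n ⟧N ≃ sign b • ⟦ u ⟧W ⊞ ⟦ (c , w) ∷ n ⟧N
  cancel-sound b u [] = ≃-refl
  cancel-sound b u ((c , w) ∷ n) with not b ≟B c | ≟W Finₚ._≟_ u w
  ... | yes refl | yes refl = begin
    ⟦ n ⟧N
      ≈⟨ ≃-sym (⊞-identityˡ _) ⟩
    𝟘 ⊞ ⟦ n ⟧N
      ≈⟨ ⊞-cong (≃-sym (opposite b ⟦ u ⟧W)) ≃-refl ⟩
    (sign b • ⟦ u ⟧W ⊞ sign (not b) • ⟦ u ⟧W) ⊞ ⟦ n ⟧N
      ≈⟨ ⊞-assoc _ _ _ ⟩
    sign b • ⟦ u ⟧W ⊞ (sign (not b) • ⟦ u ⟧W ⊞ ⟦ n ⟧N) ∎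
  ... | yes _ | no _ = cancel-keep b u c w n
  ... | no _ | _ = cancel-keep b u c w n
  cancel-keep b u c w n = begin
    sign c • ⟦ w ⟧W ⊞ ⟦ cancel b u n ⟧N              ≈⟨ ⊞-cong ≃-refl (cancel-sound b u n) ⟩
    sign c • ⟦ w ⟧W ⊞ (sign b • ⟦ u ⟧W ⊞ ⟦ n ⟧N)     ≈⟨ ≃-sym (⊞-assoc _ _ _) ⟩
    (sign c • ⟦ w ⟧W ⊞ sign b • ⟦ u ⟧W) ⊞ ⟦ n ⟧N     ≈⟨ ⊞-cong (⊞-comm _ _) ≃-refl ⟩
    (sign b • ⟦ u ⟧W ⊞ sign c • ⟦ w ⟧W) ⊞ ⟦ n ⟧N     ≈⟨ ⊞-assoc _ _ _ ⟩
    sign b • ⟦ u ⟧W ⊞ (sign c • ⟦ w ⟧W ⊞ ⟦ n ⟧N)     ∎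

  reduce-sound : ∀ n → ⟦ reduce n ⟧N ≃ ⟦ n ⟧N
  reduce-sound [] = ≃-refl
  reduce-sound ((b , u) ∷ n) =
    ≃-trans (cancel-sound b u (reduce n)) (⊞-cong ≃-refl (reduce-sound n))

  null-sound : ∀ n → IsTrue (null n) → ⟦ n ⟧N ≃ 𝟘
  null-sound [] _ = ≃-refl

  ⊟-zero : ∀ {p q : Poly A} → p ⊟ q ≃ 𝟘 → p ≃ q
  ⊟-zero {p} {q} e = begin
    p                            ≈⟨ ≃-sym (⊞-identityʳ p) ⟩
    p ⊞ 𝟘                        ≈⟨ ⊞-cong ≃-refl (≃-sym (≃-trans (⊞-comm _ _) (⊞-inverse q))) ⟩
    p ⊞ ((- 1ℚ) • q ⊞ q)         ≈⟨ ≃-sym (⊞-assoc _ _ _) ⟩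
    (p ⊞ (- 1ℚ) • q) ⊞ q         ≈⟨ ⊞-cong (≃-sym (⊟-via-• p q)) ≃-refl ⟩
    (p ⊟ q) ⊞ q                  ≈⟨ ⊞-cong e ≃-refl ⟩
    𝟘 ⊞ q                        ≈⟨ ⊞-identityˡ q ⟩
    q                            ∎

  -- The hidden argument has the unit type exactly when the expanded difference cancels completely,
  -- and is then filled in by η; the identity is thus decided during type checking.
  ring : (e e′ : Expr m) {_ : IsTrue (null (reduce (expand (e :- e′))))} → ⟦ e ⟧ ≃ ⟦ e′ ⟧
  ring e e′ {ok} = ⊟-zero (begin
    ⟦ e :- e′ ⟧                       ≈⟨ ≃-sym (expand-sound (e :- e′)) ⟩
    ⟦ expand (e :- e′) ⟧N             ≈⟨ ≃-sym (reduce-sound (expand (e :- e′))) ⟩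
    ⟦ reduce (expand (e :- e′)) ⟧N    ≈⟨ null-sound _ ok ⟩
    𝟘                                 ∎)

-- The quasi-shuffle bialgebra on compositions

-- k₁ ∷ k₂ ∷ … stands for … e_{k₂} e_{k₁}: words are stored with the last letter first.
Comp : Set
Comp = Word ℕ

-- deconc v G is the sum of G v' v'' over the coproduct of v, the right factor keeping the head.
deconc : Comp → (Comp → Comp → Poly B) → Poly B
deconc [] G = G [] []
deconc (k ∷ v) G = G (k ∷ v) [] ⊞ deconc v (λ a b → G a (k ∷ b))

deconc-cong : (v : Comp) {G H : Comp → Comp → Poly B} → (∀ a b → G a b ≃ H a b) → deconc v G ≃ deconc v H
deconc-cong [] e = e [] []
deconc-cong (k ∷ v) e = ⊞-cong (e _ _) (deconc-cong v (λ a b → e a (k ∷ b)))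

linear-deconc : {h : Poly A → Poly B} → Linear h → (v : Comp) (G : Comp → Comp → Poly A) →
  h (deconc v G) ≃ deconc v (λ a b → h (G a b))
linear-deconc H [] G = ≃-refl
linear-deconc H (k ∷ v) G = ≃-trans (add H _ _) (⊞-cong ≃-refl (linear-deconc H v _))

deconc-⊞ : (v : Comp) (G H : Comp → Comp → Poly B) →
  deconc v (λ a b → G a b ⊞ H a b) ≃ deconc v G ⊞ deconc v H
deconc-⊞ [] G H = ≃-refl
deconc-⊞ (k ∷ v) G H = ≃-trans (⊞-cong ≃-refl (deconc-⊞ v _ _))
  (ring (_ ∷ _ ∷ _ ∷ _ ∷ []) (a₀ :+ a₁ :+ (a₂ :+ a₃)) (a₀ :+ a₂ :+ (a₁ :+ a₃)))

deconc-⊟ : (v : Comp) (G H : Comp → Comp → Poly B) →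
  deconc v (λ a b → G a b ⊟ H a b) ≃ deconc v G ⊟ deconc v H
deconc-⊟ [] G H = ≃-refl
deconc-⊟ (k ∷ v) G H = ≃-trans (⊞-cong ≃-refl (deconc-⊟ v _ _))
  (ring (_ ∷ _ ∷ _ ∷ _ ∷ []) (a₀ :- a₁ :+ (a₂ :- a₃)) (a₀ :+ a₂ :- (a₁ :+ a₃)))

ext-deconc : (p : Poly A) (v : Comp) (G : Word A → Comp → Comp → Poly B) →
  ext (λ w → deconc v (G w)) p ≃ deconc v (λ a b → ext (λ w → G w a b) p)
ext-deconc p [] G = ≃-refl
ext-deconc p (k ∷ v) G = ≃-trans (ext-⊞ _ _ p) (⊞-cong ≃-refl (ext-deconc p v _))

-- Both sides cut the word twice. The terms are sorted by the piece that receives the last letter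
-- `k`; only when it is the third piece is induction used.
deconc-coassoc : (v : Comp) (G : Comp → Comp → Comp → Poly B) →
  deconc v (λ a c → deconc a (λ a b → G a b c)) ≃ deconc v (λ a b → deconc b (λ b c → G a b c))
deconc-coassoc [] G = ≃-refl
deconc-coassoc (k ∷ v) G = begin
  (G (k ∷ v) [] [] ⊞ deconc v (λ a b → G a (k ∷ b) [])) ⊞ deconc v (λ a c → deconc a (λ a b → G a b (k ∷ c)))
    ≈⟨ ⊞-cong ≃-refl (deconc-coassoc v (λ a b c → G a b (k ∷ c))) ⟩
  (G (k ∷ v) [] [] ⊞ deconc v (λ a b → G a (k ∷ b) [])) ⊞ deconc v (λ a b → deconc b (λ b c → G a b (k ∷ c)))
    ≈⟨ ⊞-assoc _ _ _ ⟩
  G (k ∷ v) [] [] ⊞ (deconc v (λ a b → G a (k ∷ b) []) ⊞ deconc v (λ a b → deconc b (λ b c → G a b (k ∷ c))))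
    ≈⟨ ⊞-cong ≃-refl (≃-sym (deconc-⊞ v _ _)) ⟩
  G (k ∷ v) [] [] ⊞ deconc v (λ a b → G a (k ∷ b) [] ⊞ deconc b (λ b c → G a b (k ∷ c))) ∎
  where open ≃-Reasoning

ε : Comp → Poly B
ε [] = 𝟙
ε (_ ∷ _) = 𝟘

deconc-counitˡ : (v : Comp) (G : Comp → Poly B) → deconc v (λ a b → ε a ⊠ G b) ≃ G v
deconc-counitˡ [] G = ⊠-identityˡ _
deconc-counitˡ (k ∷ v) G = ≃-trans (⊞-cong (zer (⊠ʳ-linear _)) (deconc-counitˡ v (λ b → G (k ∷ b)))) (⊞-identityˡ _)

deconc-𝟘 : (v : Comp) → deconc v (λ _ _ → 𝟘) ≃ 𝟘 {B}
deconc-𝟘 [] = ≃-refl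
deconc-𝟘 (k ∷ v) = ≃-trans (⊞-cong ≃-refl (deconc-𝟘 v)) (⊞-identityˡ _)

deconc-counitʳ : (v : Comp) (G : Comp → Poly B) → deconc v (λ a b → G a ⊠ ε b) ≃ G v
deconc-counitʳ [] G = ⊠-identityʳ _
deconc-counitʳ (k ∷ v) G = ≃-trans (⊞-cong (⊠-identityʳ _)
  (≃-trans (deconc-cong v (λ a b → zer (⊠ˡ-linear (G a)))) (deconc-𝟘 v))) (⊞-identityʳ _)

cons : ℕ → Poly ℕ → Poly ℕ
cons k = ext (λ v → mon (k ∷ v))

cons-linear : (k : ℕ) → Linear (cons k)
cons-linear k = ext-linear _

ext-ext : (G : Word B → Poly C) (H : Word A → Poly B) (p : Poly A) →
  ext G (ext H p) ≃ ext (λ v → ext G (H v)) p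
ext-ext G H p = linear-ext (ext-linear G) H p

ext-cons : (G : Comp → Poly B) (k : ℕ) (p : Poly ℕ) → ext G (cons k p) ≃ ext (λ v → G (k ∷ v)) p
ext-cons G k p = ≃-trans (ext-ext G _ p) (ext-cong p (λ v → ext-mon G _))

qs : Comp → Comp → Poly ℕ
qs [] w = mon w
qs (j ∷ v) [] = mon (j ∷ v)
qs (j ∷ v) (k ∷ w) =
  cons j (qs v (k ∷ w)) ⊞ cons k (qs (j ∷ v) w) ⊟ cons (suc (j +ℕ k)) (qs v w)

-- `qs` splits on its first argument, so for a variable `v` this equation does not hold by
-- computation.
qs-[] : (v : Comp) → qs v [] ≡ mon v
qs-[] [] = refl
qs-[] (j ∷ v) = refl

linear-⊞⊟ : {h : Poly A → Poly B} → Linear h → (p q r : Poly A) →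
  h (p ⊞ q ⊟ r) ≃ h p ⊞ h q ⊟ h r
linear-⊞⊟ H p q r = ≃-trans (sub H _ _) (⊟-cong (add H _ _) ≃-refl)

ext-⊞⊟ : (G H K : Word A → Poly B) (p : Poly A) →
  ext (λ w → G w ⊞ H w ⊟ K w) p ≃ ext G p ⊞ ext H p ⊟ ext K p
ext-⊞⊟ G H K p = ≃-trans (ext-⊟ _ _ p) (⊟-cong (ext-⊞ G H p) ≃-refl)

ext-qs : (G : Comp → Poly B) (j : ℕ) (v : Comp) (k : ℕ) (w : Comp) →
  ext G (qs (j ∷ v) (k ∷ w)) ≃
  ext (λ u → G (j ∷ u)) (qs v (k ∷ w)) ⊞ ext (λ u → G (k ∷ u)) (qs (j ∷ v) w)
    ⊟ ext (λ u → G (suc (j +ℕ k) ∷ u)) (qs v w)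
ext-qs G j v k w = ≃-trans (linear-⊞⊟ (ext-linear G) _ _ _)
  (⊟-cong (⊞-cong (ext-cons G j _) (ext-cons G k _)) (ext-cons G (suc (j +ℕ k)) _))

ext-𝟘 : (p : Poly A) → ext (λ _ → 𝟘) p ≃ 𝟘 {B}
ext-𝟘 p = ≃-trans (ext-cong p (λ _ → ≃-sym (0• 𝟘))) (≃-trans (ext-• _ _ p) (0• _))

-- Every summand of the recursion keeps a last letter, so the product of two nonempty compositions
-- has no empty part.
qs-ε : (v w : Comp) → ext ε (qs v w) ≃ ε v ⊠ ε {B} w
qs-ε [] w = ≃-trans (ext-mon ε w) (≃-sym (⊠-identityˡ _))
qs-ε (j ∷ v) [] = ≃-trans (ext-mon ε _) (≃-sym (⊠-identityʳ _))
qs-ε (j ∷ v) (k ∷ w) = ≃-trans (ext-qs ε j v k w)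
  (≃-trans (⊟-cong (⊞-cong (ext-𝟘 _) (ext-𝟘 _)) (ext-𝟘 _)) (ring [] (:0 :+ :0 :- :0) (:0 :* :0)))

-- Induction on the last letters. The terms on the right are sorted by which of the right-hand
-- factors `b` and `d` are empty: both give `A1 ⊞ A2 ⊟ A3`, exactly one gives `X1` or `X2`, and
-- neither gives `M1 ⊞ M2 ⊟ M3` by the recursion of `qs`. On the left the same terms come from
-- cutting each of the three summands of the product.
qs-deconc : (v w : Comp) (G : Comp → Comp → Poly B) →
  ext (λ u → deconc u G) (qs v w) ≃
  deconc v (λ a b → deconc w (λ c d → ext (λ p → ext (G p) (qs b d)) (qs a c)))
qs-deconc [] w G = ≃-trans (ext-mon _ w)
  (deconc-cong w (λ c d → ≃-sym (≃-trans (ext-mon _ c) (ext-mon _ d))))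
qs-deconc (j ∷ v) [] G = ≃-trans (ext-mon _ (j ∷ v)) (deconc-cong (j ∷ v) λ a b → collapse a b)
  where
  collapse : ∀ a b → G a b ≃ ext (λ p → ext (G p) (qs b [])) (qs a [])
  collapse a b rewrite qs-[] a | qs-[] b = ≃-sym (≃-trans (ext-mon _ a) (ext-mon _ b))
qs-deconc (j ∷ v) (k ∷ w) G = begin
  ext (λ u → deconc u G) (qs (j ∷ v) (k ∷ w))
    ≈⟨ ext-qs (λ u → deconc u G) j v k w ⟩
  ext (λ u → deconc (j ∷ u) G) (qs v (k ∷ w)) ⊞ ext (λ u → deconc (k ∷ u) G) (qs (j ∷ v) w)
    ⊟ ext (λ u → deconc (suc (j +ℕ k) ∷ u) G) (qs v w)
    ≈⟨ ⊟-cong (⊞-cong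
         (≃-trans (ext-⊞ _ _ _) (⊞-cong ≃-refl (≃-trans (qs-deconc v (k ∷ w) _) (deconc-⊞ v _ _))))
         (≃-trans (ext-⊞ _ _ _) (⊞-cong ≃-refl (qs-deconc (j ∷ v) w _))))
         (≃-trans (ext-⊞ _ _ _) (⊞-cong ≃-refl (qs-deconc v w _))) ⟩
  (A1 ⊞ (X1 ⊞ M1)) ⊞ (A2 ⊞ (X2 ⊞ M2)) ⊟ (A3 ⊞ M3)
    ≈⟨ ring (A1 ∷ A2 ∷ A3 ∷ X1 ∷ X2 ∷ M1 ∷ M2 ∷ M3 ∷ [])
         (a₀ :+ (a₃ :+ a₅) :+ (a₁ :+ (a₄ :+ a₆)) :- (a₂ :+ a₇))
         ((a₀ :+ a₁ :- a₂) :+ a₄ :+ (a₃ :+ (a₅ :+ a₆ :- a₇))) ⟩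
  ((A1 ⊞ A2 ⊟ A3) ⊞ X2) ⊞ (X1 ⊞ (M1 ⊞ M2 ⊟ M3))
    ≈⟨ ⊞-cong (⊞-cong (≃-sym P0) (deconc-cong w P2)) (⊞-cong (deconc-cong v P1) (≃-sym PM)) ⟩
  (ext (λ p → ext (G p) (qs [] [])) (qs (j ∷ v) (k ∷ w))
    ⊞ deconc w (λ c d → ext (λ p → ext (G p) (qs [] (k ∷ d))) (qs (j ∷ v) c)))
    ⊞ (deconc v (λ a b → ext (λ p → ext (G p) (qs (j ∷ b) [])) (qs a (k ∷ w)))
       ⊞ deconc v (λ a b → deconc w (λ c d → ext (λ p → ext (G p) (qs (j ∷ b) (k ∷ d))) (qs a c))))
    ≈⟨ ⊞-cong ≃-refl (≃-sym (deconc-⊞ v _ _)) ⟩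
  deconc (j ∷ v) (λ a b → deconc (k ∷ w) (λ c d → ext (λ p → ext (G p) (qs b d)) (qs a c))) ∎
  where
  open ≃-Reasoning
  m = suc (j +ℕ k)
  A1 = ext (λ u → G (j ∷ u) []) (qs v (k ∷ w))
  A2 = ext (λ u → G (k ∷ u) []) (qs (j ∷ v) w)
  A3 = ext (λ u → G (m ∷ u) []) (qs v w)
  X1 = deconc v (λ a b → ext (λ p → ext (λ q → G p (j ∷ q)) (qs b [])) (qs a (k ∷ w)))
  X2 = deconc w (λ c d → ext (λ p → ext (λ q → G p (k ∷ q)) (qs [] d)) (qs (j ∷ v) c))
  M1 = deconc v (λ a b → deconc w (λ c d → ext (λ p → ext (λ q → G p (j ∷ q)) (qs b (k ∷ d))) (qs a c)))
  M2 = deconc v (λ a b → deconc w (λ c d → ext (λ p → ext (λ q → G p (k ∷ q)) (qs (j ∷ b) d)) (qs a c)))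
  M3 = deconc v (λ a b → deconc w (λ c d → ext (λ p → ext (λ q → G p (m ∷ q)) (qs b d)) (qs a c)))
  P0 : ext (λ p → ext (G p) (qs [] [])) (qs (j ∷ v) (k ∷ w)) ≃ A1 ⊞ A2 ⊟ A3
  P0 = ≃-trans (ext-cong _ (λ p → ext-mon _ [])) (ext-qs _ j v k w)
  P1 : ∀ a b → ext (λ p → ext (λ q → G p (j ∷ q)) (qs b [])) (qs a (k ∷ w))
             ≃ ext (λ p → ext (G p) (qs (j ∷ b) [])) (qs a (k ∷ w))
  P1 a b rewrite qs-[] b = ext-cong _ (λ p → ≃-trans (ext-mon _ b) (≃-sym (ext-mon _ (j ∷ b))))
  P2 : ∀ c d → ext (λ p → ext (λ q → G p (k ∷ q)) (qs [] d)) (qs (j ∷ v) c)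
             ≃ ext (λ p → ext (G p) (qs [] (k ∷ d))) (qs (j ∷ v) c)
  P2 c d = ext-cong _ (λ p → ≃-trans (ext-mon _ d) (≃-sym (ext-mon _ (k ∷ d))))
  PM : deconc v (λ a b → deconc w (λ c d → ext (λ p → ext (G p) (qs (j ∷ b) (k ∷ d))) (qs a c))) ≃ M1 ⊞ M2 ⊟ M3
  PM = ≃-trans
    (deconc-cong v (λ a b → ≃-trans
      (deconc-cong w (λ c d → ≃-trans (ext-cong _ (λ p → ext-qs (G p) j b k d)) (ext-⊞⊟ _ _ _ (qs a c))))
      (≃-trans (deconc-⊟ w _ _) (⊟-cong (deconc-⊞ w _ _) ≃-refl))))
    (≃-trans (deconc-⊟ v _ _) (⊟-cong (deconc-⊞ v _ _) ≃-refl))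

infixl 7 _⋄_
_⋄_ : Poly ℕ → Poly ℕ → Poly ℕ
p ⋄ q = ext (λ v → ext (qs v) q) p

-- The recursion of `qs` when the tail of the first factor is itself a product. In the middle
-- summand `cons i p` stays whole, which allows the regrouping in `qs-assoc`.
qs-consˡ : (i k : ℕ) (p : Poly ℕ) (w : Comp) →
  ext (λ x → qs x (k ∷ w)) (cons i p) ≃
  cons i (ext (λ x → qs x (k ∷ w)) p) ⊞ cons k (ext (λ x → qs x w) (cons i p))
    ⊟ cons (suc (i +ℕ k)) (ext (λ x → qs x w) p)
qs-consˡ i k p w = ≃-trans (ext-cons _ i p) (≃-trans (ext-⊞⊟ _ _ _ p)
  (≃-sym (⊟-cong (⊞-cong (ext-ext _ _ p) (≃-trans (respects (cons-linear k) (ext-cons _ i p)) (ext-ext _ _ p)))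
    (ext-ext _ _ p))))

qs-consʳ : (j i : ℕ) (v : Comp) (p : Poly ℕ) →
  ext (qs (j ∷ v)) (cons i p) ≃
  cons j (ext (qs v) (cons i p)) ⊞ cons i (ext (qs (j ∷ v)) p)
    ⊟ cons (suc (j +ℕ i)) (ext (qs v) p)
qs-consʳ j i v p = ≃-trans (ext-cons _ i p) (≃-trans (ext-⊞⊟ _ _ _ p)
  (≃-sym (⊟-cong (⊞-cong (≃-trans (respects (cons-linear j) (ext-cons _ i p)) (ext-ext _ _ p)) (ext-ext _ _ p))
    (ext-ext _ _ p))))

-- Each summand is sorted by its last letter, made from one, two or all three of `i`, `j`, `k`; what
-- precedes that letter agrees by induction. The letter made from all three has the same index in
-- both bracketings because the contraction (j, k) ↦ j + k + 1 is associative (`idx`), and its two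
-- signs multiply to plus.
qs-assoc : (u v w : Comp) → ext (λ x → qs x w) (qs u v) ≃ ext (qs u) (qs v w)
qs-assoc [] v w = ≃-trans (ext-mon _ v) (≃-sym (ext-id _))
qs-assoc (i ∷ u) [] w = ≃-trans (ext-mon _ _) (≃-sym (ext-mon _ w))
qs-assoc (i ∷ u) (j ∷ v) [] =
  ≃-trans (ext-cong (qs (i ∷ u) (j ∷ v)) (λ x → ≃-reflexive (qs-[] x)))
    (≃-trans (ext-id _) (≃-sym (ext-mon _ (j ∷ v))))
qs-assoc (i ∷ u) (j ∷ v) (k ∷ w) = begin
  ext (λ x → qs x (k ∷ w)) (cons i uv1 ⊞ cons j uv2 ⊟ cons ij uv3)
    ≈⟨ linear-⊞⊟ (ext-linear _) _ _ _ ⟩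
  ext (λ x → qs x (k ∷ w)) (cons i uv1) ⊞ ext (λ x → qs x (k ∷ w)) (cons j uv2)
    ⊟ ext (λ x → qs x (k ∷ w)) (cons ij uv3)
    ≈⟨ ⊟-cong (⊞-cong (qs-consˡ i k uv1 w) (qs-consˡ j k uv2 w)) (qs-consˡ ij k uv3 w) ⟩
  (cons i (ext (λ x → qs x (k ∷ w)) uv1) ⊞ cons k (R (cons i uv1)) ⊟ cons ik (R uv1))
    ⊞ (cons j (ext (λ x → qs x (k ∷ w)) uv2) ⊞ cons k (R (cons j uv2)) ⊟ cons jk (R uv2))
    ⊟ (cons ij (ext (λ x → qs x (k ∷ w)) uv3) ⊞ cons k (R (cons ij uv3)) ⊟ cons (suc (ij +ℕ k)) (R uv3))
    ≈⟨ regroupˡ _ _ _ _ _ _ _ _ _ ⟩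
  ((cons i (ext (λ x → qs x (k ∷ w)) uv1) ⊞ cons j (ext (λ x → qs x (k ∷ w)) uv2))
    ⊟ cons ij (ext (λ x → qs x (k ∷ w)) uv3))
    ⊞ (cons k (R (cons i uv1)) ⊞ cons k (R (cons j uv2)) ⊟ cons k (R (cons ij uv3)))
    ⊟ (cons ik (R uv1) ⊞ cons jk (R uv2) ⊟ cons (suc (ij +ℕ k)) (R uv3))
    ≈⟨ ⊟-cong (⊞-cong
         (⊟-cong (⊞-cong (respects (cons-linear i) (qs-assoc u (j ∷ v) (k ∷ w)))
                         (respects (cons-linear j) (qs-assoc (i ∷ u) v (k ∷ w))))
                 (respects (cons-linear ij) (qs-assoc u v (k ∷ w))))
         -- The three summands ending in `k` reassemble to the full product of `i ∷ u` and `j ∷ v`,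
         -- so that induction applies with `w` in place of `k ∷ w`.
         (≃-trans (≃-sym (linear-⊞⊟ (linear-∘ (cons-linear k) (ext-linear _)) (cons i uv1) (cons j uv2) (cons ij uv3)))
                  (respects (cons-linear k) (qs-assoc (i ∷ u) (j ∷ v) w))))
         (⊟-cong (⊞-cong (respects (cons-linear ik) (qs-assoc u (j ∷ v) w))
                         (respects (cons-linear jk) (qs-assoc (i ∷ u) v w)))
                 (≃-trans (respects (cons-linear _) (qs-assoc u v w)) (≃-reflexive (cong (λ m → cons m (ext (qs u) (qs v w))) idx)))) ⟩
  (cons i (ext (qs u) (qs (j ∷ v) (k ∷ w))) ⊞ cons j (ext (qs (i ∷ u)) vw1) ⊟ cons ij (ext (qs u) vw1))
    ⊞ cons k (ext (qs (i ∷ u)) vw2)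
    ⊟ (cons ik (ext (qs u) vw2) ⊞ cons jk (ext (qs (i ∷ u)) vw3) ⊟ cons (suc (i +ℕ jk)) (ext (qs u) vw3))
    -- Symmetrically, in the other bracketing the summands ending in `i` contain the full product of
    -- `j ∷ v` and `k ∷ w`, which is now expanded.
    ≈⟨ ⊟-cong (⊞-cong (⊟-cong (⊞-cong
         (linear-⊞⊟ (linear-∘ (cons-linear i) (ext-linear _)) (cons j vw1) (cons k vw2) (cons jk vw3)) ≃-refl) ≃-refl) ≃-refl) ≃-refl ⟩
  ((cons i (L (cons j vw1)) ⊞ cons i (L (cons k vw2)) ⊟ cons i (L (cons jk vw3)))
     ⊞ cons j (ext (qs (i ∷ u)) vw1) ⊟ cons ij (ext (qs u) vw1))
    ⊞ cons k (ext (qs (i ∷ u)) vw2)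
    ⊟ (cons ik (ext (qs u) vw2) ⊞ cons jk (ext (qs (i ∷ u)) vw3) ⊟ cons (suc (i +ℕ jk)) (ext (qs u) vw3))
    ≈⟨ regroupʳ _ _ _ _ _ _ _ _ _ ⟩
  (cons i (L (cons j vw1)) ⊞ cons j (ext (qs (i ∷ u)) vw1) ⊟ cons ij (L vw1))
    ⊞ (cons i (L (cons k vw2)) ⊞ cons k (ext (qs (i ∷ u)) vw2) ⊟ cons ik (L vw2))
    ⊟ (cons i (L (cons jk vw3)) ⊞ cons jk (ext (qs (i ∷ u)) vw3) ⊟ cons (suc (i +ℕ jk)) (L vw3))
    ≈⟨ ≃-sym (⊟-cong (⊞-cong (qs-consʳ i j u vw1) (qs-consʳ i k u vw2)) (qs-consʳ i jk u vw3)) ⟩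
  ext (qs (i ∷ u)) (cons j vw1) ⊞ ext (qs (i ∷ u)) (cons k vw2) ⊟ ext (qs (i ∷ u)) (cons jk vw3)
    ≈⟨ ≃-sym (linear-⊞⊟ (ext-linear _) _ _ _) ⟩
  ext (qs (i ∷ u)) (cons j vw1 ⊞ cons k vw2 ⊟ cons jk vw3) ∎
  where
  open ≃-Reasoning
  ij = suc (i +ℕ j)
  ik = suc (i +ℕ k)
  jk = suc (j +ℕ k)
  uv1 = qs u (j ∷ v)
  uv2 = qs (i ∷ u) v
  uv3 = qs u v
  vw1 = qs v (k ∷ w)
  vw2 = qs (j ∷ v) w
  vw3 = qs v w
  R : Poly ℕ → Poly ℕ
  R = ext (λ x → qs x w)
  L : Poly ℕ → Poly ℕ
  L = ext (qs u)
  idx : suc (ij +ℕ k) ≡ suc (i +ℕ jk)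
  idx = cong suc (trans (cong suc (ℕₚ.+-assoc i j k)) (sym (ℕₚ.+-suc i (j +ℕ k))))
  regroupˡ : ∀ p₁ p₂ p₃ q₁ q₂ q₃ r₁ r₂ r₃ →
    (p₁ ⊞ p₂ ⊟ p₃) ⊞ (q₁ ⊞ q₂ ⊟ q₃) ⊟ (r₁ ⊞ r₂ ⊟ r₃)
      ≃ ((p₁ ⊞ q₁) ⊟ r₁) ⊞ (p₂ ⊞ q₂ ⊟ r₂) ⊟ (p₃ ⊞ q₃ ⊟ r₃)
  regroupˡ p₁ p₂ p₃ q₁ q₂ q₃ r₁ r₂ r₃ = ring (p₁ ∷ p₂ ∷ p₃ ∷ q₁ ∷ q₂ ∷ q₃ ∷ r₁ ∷ r₂ ∷ r₃ ∷ [])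
    ((a₀ :+ a₁ :- a₂) :+ (a₃ :+ a₄ :- a₅) :- (a₆ :+ a₇ :- a₈))
    ((a₀ :+ a₃ :- a₆) :+ (a₁ :+ a₄ :- a₇) :- (a₂ :+ a₅ :- a₈))
  regroupʳ : ∀ p₁ p₂ p₃ q₁ q₂ q₃ r₁ r₂ r₃ →
    ((p₁ ⊞ p₂ ⊟ p₃) ⊞ q₁ ⊟ r₁) ⊞ q₂ ⊟ (r₂ ⊞ q₃ ⊟ r₃)
      ≃ (p₁ ⊞ q₁ ⊟ r₁) ⊞ (p₂ ⊞ q₂ ⊟ r₂) ⊟ (p₃ ⊞ q₃ ⊟ r₃)
  regroupʳ p₁ p₂ p₃ q₁ q₂ q₃ r₁ r₂ r₃ = ring (p₁ ∷ p₂ ∷ p₃ ∷ q₁ ∷ q₂ ∷ q₃ ∷ r₁ ∷ r₂ ∷ r₃ ∷ [])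
    (((a₀ :+ a₁ :- a₂) :+ a₃ :- a₆) :+ a₄ :- (a₇ :+ a₅ :- a₈))
    ((a₀ :+ a₃ :- a₆) :+ (a₁ :+ a₄ :- a₇) :- (a₂ :+ a₅ :- a₈))

-- From rooted forests to compositions

⋄-cong : {p p′ q q′ : Poly ℕ} → p ≃ p′ → q ≃ q′ → p ⋄ q ≃ p′ ⋄ q′
⋄-cong e e′ = ext-cong₂ (λ v → respects (ext-linear _) e′) e

⋄-assoc : (p q r : Poly ℕ) → (p ⋄ q) ⋄ r ≃ p ⋄ (q ⋄ r)
⋄-assoc p q r = begin
  ext (λ x → ext (qs x) r) (ext (λ u → ext (qs u) q) p)
    ≈⟨ ext-ext _ _ p ⟩
  ext (λ u → ext (λ x → ext (qs x) r) (ext (qs u) q)) p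
    ≈⟨ ext-cong p (λ u → ext-ext _ _ q) ⟩
  ext (λ u → ext (λ v → ext (λ x → ext (qs x) r) (qs u v)) q) p
    ≈⟨ ext-cong p (λ u → ext-cong q (λ v → ext-swap (qs u v) r qs)) ⟩
  ext (λ u → ext (λ v → ext (λ w → ext (λ x → qs x w) (qs u v)) r) q) p
    ≈⟨ ext-cong p (λ u → ext-cong q (λ v → ext-cong r (λ w → qs-assoc u v w))) ⟩
  ext (λ u → ext (λ v → ext (λ w → ext (qs u) (qs v w)) r) q) p
    ≈⟨ ext-cong p (λ u → ext-cong q (λ v → ≃-sym (ext-ext _ _ r))) ⟩
  ext (λ u → ext (λ v → ext (qs u) (ext (qs v) r)) q) p
    ≈⟨ ext-cong p (λ u → ≃-sym (ext-ext _ _ q)) ⟩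
  ext (λ u → ext (qs u) (ext (λ v → ext (qs v) r) q)) p ∎
  where open ≃-Reasoning

⋄-identityˡ : (p : Poly ℕ) → mon [] ⋄ p ≃ p
⋄-identityˡ p = ≃-trans (ext-mon _ []) (ext-id p)

⋄-identityʳ : (p : Poly ℕ) → p ⋄ mon [] ≃ p
⋄-identityʳ p = ≃-trans
  (ext-cong p (λ v → ≃-trans (ext-mon _ []) (≃-reflexive (qs-[] v)))) (ext-id p)

-- The 1-cocycle 1 ↦ y, u z^k y ↦ u z^k (z + y) y.
graftOp : Comp → Poly ℕ
graftOp [] = mon (0 ∷ [])
graftOp (k ∷ v) = mon (suc k ∷ v) ⊞ mon (0 ∷ k ∷ v)

ext-graftOp-∷ : (G : Comp → Poly B) (k : ℕ) (v : Comp) →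
  ext G (graftOp (k ∷ v)) ≃ G (suc k ∷ v) ⊞ G (0 ∷ k ∷ v)
ext-graftOp-∷ G k v = ≃-trans (add (ext-linear G) _ _) (⊞-cong (ext-mon G _) (ext-mon G _))

-- The cocycle changes a nonempty word only at its end, so cuts further left are respected. The one
-- new cut, just before the added letter of `0 ∷ k ∷ v`, is the term `R`; on the right it comes from
-- `graftOp []`, which forces the value y at 1.
graftOp-deconc : (v : Comp) (G : Comp → Comp → Poly B) →
  ext (λ u → deconc u G) (graftOp v) ≃ ext (λ u → G u []) (graftOp v) ⊞ deconc v (λ a b → ext (G a) (graftOp b))
graftOp-deconc [] G = ≃-trans (ext-mon _ _) (≃-sym (⊞-cong (ext-mon _ _) (ext-mon _ _)))
graftOp-deconc (k ∷ v) G = begin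
  ext (λ u → deconc u G) (graftOp (k ∷ v))
    ≈⟨ ext-graftOp-∷ _ k v ⟩
  (P ⊞ S₁) ⊞ (Q ⊞ (R ⊞ S₂))
    ≈⟨ ring (P ∷ Q ∷ R ∷ S₁ ∷ S₂ ∷ []) (a₀ :+ a₃ :+ (a₁ :+ (a₂ :+ a₄))) (a₀ :+ a₁ :+ (a₂ :+ (a₃ :+ a₄))) ⟩
  (P ⊞ Q) ⊞ (R ⊞ (S₁ ⊞ S₂))
    ≈⟨ ≃-sym (⊞-cong (ext-graftOp-∷ _ k v) (⊞-cong (ext-mon _ _)
         (≃-trans (deconc-cong v (λ a b → ext-graftOp-∷ (G a) k b)) (deconc-⊞ v _ _)))) ⟩
  ext (λ u → G u []) (graftOp (k ∷ v)) ⊞ deconc (k ∷ v) (λ a b → ext (G a) (graftOp b)) ∎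
  where
  open ≃-Reasoning
  P = G (suc k ∷ v) []
  Q = G (0 ∷ k ∷ v) []
  R = G (k ∷ v) (0 ∷ [])
  S₁ = deconc v (λ a b → G a (suc k ∷ b))
  S₂ = deconc v (λ a b → G a (0 ∷ k ∷ b))

mutual
  -- The algebra map E that the universal property of the Connes-Kreimer algebra attaches to the
  -- cocycle `graftOp`.
  compF : Forest → Poly ℕ
  compF [] = mon []
  compF (t ∷ f) = compT t ⋄ compF f

  compT : Tree → Poly ℕ
  compT (node f) = ext graftOp (compF f)

compF-++ : (f g : Forest) → compF (f ++ g) ≃ compF f ⋄ compF g
compF-++ [] g = ≃-sym (⋄-identityˡ _)
compF-++ (t ∷ f) g = ≃-trans (⋄-cong ≃-refl (compF-++ f g)) (≃-sym (⋄-assoc (compT t) (compF f) (compF g)))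

compF-singleton : (t : Tree) → compF (t ∷ []) ≃ compT t
compF-singleton t = ⋄-identityʳ (compT t)

compT-ε : (t : Tree) → ext ε (compT t) ≃ 𝟘 {B}
compT-ε (node f) = ≃-trans (ext-ext _ _ (compF f)) (≃-trans (ext-cong (compF f) zeroL) (ext-𝟘 (compF f)))
  where
  zeroL : ∀ v → ext ε (graftOp v) ≃ 𝟘
  zeroL [] = ext-mon _ _
  zeroL (k ∷ v) = ≃-trans (ext-graftOp-∷ ε k v) (⊞-identityˡ _)

-- The counit is multiplicative and vanishes on trees, since `graftOp` never yields the empty
-- composition. This removes the correction term of `divR-graftOp` when rule (II) is applied.
compF-∷-ε : (t : Tree) (f : Forest) → ext ε (compF (t ∷ f)) ≃ 𝟘 {B}
compF-∷-ε t f = begin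
  ext ε (compT t ⋄ compF f)                                ≈⟨ ext-ext _ _ (compT t) ⟩
  ext (λ v → ext ε (ext (qs v) (compF f))) (compT t)       ≈⟨ ext-cong (compT t) (λ v → ext-ext _ _ (compF f)) ⟩
  ext (λ v → ext (λ w → ext ε (qs v w)) (compF f)) (compT t)
    ≈⟨ ext-cong (compT t) (λ v → ext-cong (compF f) (λ w → qs-ε v w)) ⟩
  ext (λ v → ext (λ w → ε v ⊠ ε w) (compF f)) (compT t)
    ≈⟨ ext-cong (compT t) (λ v → ≃-sym (linear-ext (⊠ˡ-linear (ε v)) ε (compF f))) ⟩
  ext (λ v → ε v ⊠ ext ε (compF f)) (compT t)
    ≈⟨ ≃-sym (linear-ext (⊠ʳ-linear _) ε (compT t)) ⟩
  ext ε (compT t) ⊠ ext ε (compF f)                        ≈⟨ ⊠-congʳ (compT-ε t) ⟩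
  𝟘 ⊠ ext ε (compF f)                                   ≈⟨ zer (⊠ʳ-linear _) ⟩
  𝟘                                                  ∎
  where open ≃-Reasoning

-- The image of f ⊗ g under E ⊗ E, tested by a bilinear map `G`; no tensor product has to be formed.
onPairs : (Comp → Comp → Poly B) → Forest × Forest → Poly B
onPairs G (f , g) = ext (λ p → ext (G p) (compF g)) (compF f)

-- Multiplicativity of E ⊗ E. As (p ⊗ q)(r ⊗ s) = pr ⊗ qs, the sums over q and r have to change
-- places.
onPairs-++ : (G : Comp → Comp → Poly B) (a b c d : Forest) →
  onPairs (λ p q → onPairs (λ r s → ext (λ x → ext (G x) (qs q s)) (qs p r)) (c , d)) (a , b)
    ≃ onPairs G (a ++ c , b ++ d)
onPairs-++ G a b c d = begin
  ext (λ p → ext (λ q → ext (λ r → ext (λ s → ext (λ x → ext (G x) (qs q s)) (qs p r))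
    (compF d)) (compF c)) (compF b)) (compF a)
    ≈⟨ ext-cong (compF a) (λ p → ext-swap (compF b) (compF c) _) ⟩
  ext (λ p → ext (λ r → ext (λ q → ext (λ s → ext (λ x → ext (G x) (qs q s)) (qs p r))
    (compF d)) (compF b)) (compF c)) (compF a)
    ≈⟨ ext-cong (compF a) (λ p → ext-cong (compF c) (λ r → inner p r)) ⟩
  ext (λ p → ext (λ r → ext (λ x → ext (G x) (compF b ⋄ compF d)) (qs p r)) (compF c)) (compF a)
    ≈⟨ ≃-sym (≃-trans (ext-ext _ _ (compF a)) (ext-cong (compF a) (λ p → ext-ext _ _ (compF c)))) ⟩
  ext (λ x → ext (G x) (compF b ⋄ compF d)) (compF a ⋄ compF c)
    ≈⟨ ext-cong₂ (λ x → respects (ext-linear (G x)) (≃-sym (compF-++ b d))) (≃-sym (compF-++ a c)) ⟩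
  ext (λ x → ext (G x) (compF (b ++ d))) (compF (a ++ c)) ∎
  where
  open ≃-Reasoning
  inner : ∀ p r → ext (λ q → ext (λ s → ext (λ x → ext (G x) (qs q s)) (qs p r)) (compF d)) (compF b)
                ≃ ext (λ x → ext (G x) (compF b ⋄ compF d)) (qs p r)
  inner p r = begin
    ext (λ q → ext (λ s → ext (λ x → ext (G x) (qs q s)) (qs p r)) (compF d)) (compF b)
      ≈⟨ ext-cong (compF b) (λ q → ext-swap (compF d) (qs p r) _) ⟩
    ext (λ q → ext (λ x → ext (λ s → ext (G x) (qs q s)) (compF d)) (qs p r)) (compF b)
      ≈⟨ ext-swap (compF b) (qs p r) _ ⟩
    ext (λ x → ext (λ q → ext (λ s → ext (G x) (qs q s)) (compF d)) (compF b)) (qs p r)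
      ≈⟨ ext-cong (qs p r) (λ x → ≃-sym (≃-trans (ext-ext _ _ (compF b))
           (ext-cong (compF b) (λ q → ext-ext _ _ (compF d))))) ⟩
    ext (λ x → ext (G x) (compF b ⋄ compF d)) (qs p r) ∎

concatMap-concatMap : {K : Set} (g : J → List K) (f : I → List J) (xs : List I) →
  concatMap g (concatMap f xs) ≡ concatMap (λ i → concatMap g (f i)) xs
concatMap-concatMap g f [] = refl
concatMap-concatMap g f (i ∷ xs) =
  trans (Listₚ.concatMap-++ g (f i) (concatMap f xs)) (cong (concatMap g (f i) ++_) (concatMap-concatMap g f xs))

ext-concatMap : (p : Poly A) (xs : List I) (G : Word A → I → Poly B) →
  ext (λ w → concatMap (G w) xs) p ≃ concatMap (λ i → ext (λ w → G w i) p) xs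
ext-concatMap p [] G = ≃-trans (ext-cong p (λ _ → 0P≃)) (≃-trans (ext-𝟘 p) (≃-sym 0P≃))
ext-concatMap p (i ∷ xs) G = begin
  ext (λ w → concatMap (G w) (i ∷ xs)) p
    ≈⟨ ext-cong p (λ w → ⊕≃ (≃-refl {p = G w i}) ≃-refl) ⟩
  ext (λ w → G w i ⊞ concatMap (G w) xs) p
    ≈⟨ ext-⊞ _ _ p ⟩
  ext (λ w → G w i) p ⊞ ext (λ w → concatMap (G w) xs) p
    ≈⟨ ⊞-cong ≃-refl (ext-concatMap p xs G) ⟩
  ext (λ w → G w i) p ⊞ concatMap (λ i → ext (λ w → G w i) p) xs
    ≈⟨ ≃-sym (⊕≃ ≃-refl ≃-refl) ⟩
  concatMap (λ i → ext (λ w → G w i) p) (i ∷ xs) ∎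
  where open ≃-Reasoning

mutual
  -- E is a coalgebra map: `qs-deconc` lets the coproduct pass through the product of a tree with
  -- the remaining forest, and trees are handled by `compT-deconc`.
  compF-deconc : (f : Forest) (G : Comp → Comp → Poly B) →
    ext (λ u → deconc u G) (compF f) ≃ concatMap (onPairs G) (ΔF f)
  compF-deconc [] G = begin
    ext (λ u → deconc u G) (mon [])                ≈⟨ ext-mon _ [] ⟩
    G [] []                                     ≈⟨ ≃-sym (≃-trans (ext-mon _ []) (ext-mon _ [])) ⟩
    onPairs G ([] , [])                           ≈⟨ ≃-reflexive (sym (Listₚ.++-identityʳ _)) ⟩
    concatMap (onPairs G) (ΔF [])                 ∎
    where open ≃-Reasoning
  compF-deconc (t ∷ f) G = begin
    ext (λ u → deconc u G) (compT t ⋄ compF f)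
      ≈⟨ ≃-trans (ext-ext _ _ (compT t)) (ext-cong (compT t) (λ v → ext-ext _ _ (compF f))) ⟩
    ext (λ v → ext (λ w → ext (λ u → deconc u G) (qs v w)) (compF f)) (compT t)
      ≈⟨ ext-cong (compT t) (λ v → ext-cong (compF f) (λ w → qs-deconc v w G)) ⟩
    ext (λ v → ext (λ w → deconc v (λ a b → deconc w (K a b))) (compF f)) (compT t)
      ≈⟨ ext-cong (compT t) (λ v → ext-deconc (compF f) v _) ⟩
    ext (λ v → deconc v (λ a b → ext (λ w → deconc w (K a b)) (compF f))) (compT t)
      ≈⟨ ext-cong (compT t) (λ v → deconc-cong v (λ a b → compF-deconc f (K a b))) ⟩
    ext (λ v → deconc v (λ a b → concatMap (onPairs (K a b)) (ΔF f))) (compT t)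
      ≈⟨ compT-deconc t _ ⟩
    concatMap (onPairs (λ a b → concatMap (onPairs (K a b)) (ΔF f))) (ΔT t)
      ≈⟨ concatMap-cong (ΔT t) regroup ⟩
    concatMap (λ ab → concatMap (onPairs G) (map (λ cd → (proj₁ ab ++ proj₁ cd , proj₂ ab ++ proj₂ cd)) (ΔF f))) (ΔT t)
      ≈⟨ ≃-reflexive (sym (concatMap-concatMap (onPairs G) _ (ΔT t))) ⟩
    concatMap (onPairs G) (ΔF (t ∷ f)) ∎
    where
    open ≃-Reasoning
    K : Comp → Comp → Comp → Comp → Poly _
    K a b c d = ext (λ p → ext (G p) (qs b d)) (qs a c)
    regroup : ∀ ab → onPairs (λ p q → concatMap (onPairs (K p q)) (ΔF f)) ab
                   ≃ concatMap (onPairs G) (map (λ cd → (proj₁ ab ++ proj₁ cd , proj₂ ab ++ proj₂ cd)) (ΔF f))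
    regroup (a , b) = begin
      ext (λ p → ext (λ q → concatMap (onPairs (K p q)) (ΔF f)) (compF b)) (compF a)
        ≈⟨ ext-cong (compF a) (λ p → ext-concatMap (compF b) (ΔF f) _) ⟩
      ext (λ p → concatMap (λ cd → ext (λ q → onPairs (K p q) cd) (compF b)) (ΔF f)) (compF a)
        ≈⟨ ext-concatMap (compF a) (ΔF f) _ ⟩
      concatMap (λ cd → onPairs (λ p q → onPairs (K p q) cd) (a , b)) (ΔF f)
        ≈⟨ concatMap-cong (ΔF f) (λ cd → onPairs-++ G a b (proj₁ cd) (proj₂ cd)) ⟩
      concatMap (λ cd → onPairs G (a ++ proj₁ cd , b ++ proj₂ cd)) (ΔF f)
        ≈⟨ ≃-reflexive (sym (Listₚ.concatMap-map (onPairs G) _ (ΔF f))) ⟩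
      concatMap (onPairs G) (map (λ cd → (a ++ proj₁ cd , b ++ proj₂ cd)) (ΔF f)) ∎

  -- The cocycle identity has the same shape as the definition of the coproduct on B₊(f), so each of
  -- its two terms matches one part of `ΔT`.
  compT-deconc : (t : Tree) (G : Comp → Comp → Poly B) →
    ext (λ u → deconc u G) (compT t) ≃ concatMap (onPairs G) (ΔT t)
  compT-deconc (node f) G = begin
    ext (λ u → deconc u G) (ext graftOp (compF f))
      ≈⟨ ext-ext _ _ (compF f) ⟩
    ext (λ v → ext (λ u → deconc u G) (graftOp v)) (compF f)
      ≈⟨ ext-cong (compF f) (λ v → graftOp-deconc v G) ⟩
    ext (λ v → ext (λ u → G u []) (graftOp v) ⊞ deconc v (λ a b → ext (G a) (graftOp b))) (compF f)
      ≈⟨ ext-⊞ _ _ (compF f) ⟩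
    ext (λ v → ext (λ u → G u []) (graftOp v)) (compF f) ⊞ ext (λ v → deconc v (λ a b → ext (G a) (graftOp b))) (compF f)
      ≈⟨ ⊞-cong (≃-sym (ext-ext _ _ (compF f))) (compF-deconc f _) ⟩
    ext (λ u → G u []) (compT (node f)) ⊞ concatMap (onPairs (λ a b → ext (G a) (graftOp b))) (ΔF f)
      ≈⟨ ⊞-cong (ext-cong₂ (λ u → ≃-sym (ext-mon _ [])) (≃-sym (compF-singleton (node f))))
                (concatMap-cong (ΔF f) graft) ⟩
    onPairs G (node f ∷ [] , []) ⊞ concatMap (λ ab → onPairs G (proj₁ ab , node (proj₂ ab) ∷ [])) (ΔF f)
      ≈⟨ ⊞-cong ≃-refl (≃-reflexive (sym (Listₚ.concatMap-map (onPairs G) _ (ΔF f)))) ⟩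
    onPairs G (node f ∷ [] , []) ⊞ concatMap (onPairs G) (map (λ ab → (proj₁ ab , node (proj₂ ab) ∷ [])) (ΔF f))
      ≈⟨ ≃-sym (⊕≃ ≃-refl ≃-refl) ⟩
    concatMap (onPairs G) (ΔT (node f)) ∎
    where
    open ≃-Reasoning
    graft : ∀ ab → onPairs (λ a b → ext (G a) (graftOp b)) ab ≃ onPairs G (proj₁ ab , node (proj₂ ab) ∷ [])
    graft (a , b) = ext-cong (compF a) (λ p → ≃-trans (≃-sym (ext-ext (G p) graftOp (compF b)))
      (respects (ext-linear (G p)) (≃-sym (compF-singleton (node b)))))

-- The action of compositions on noncommutative polynomials

deconc-swap : (v w : Comp) (G : Comp → Comp → Comp → Comp → Poly B) →
  deconc v (λ a b → deconc w (G a b)) ≃ deconc w (λ c d → deconc v (λ a b → G a b c d))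
deconc-swap [] w G = ≃-refl
deconc-swap (k ∷ v) w G = ≃-trans (⊞-cong ≃-refl (deconc-swap v w _)) (≃-sym (deconc-⊞ w _ _))

deconc-• : (c : _) (v : Comp) (G : Comp → Comp → Poly B) → deconc v (λ a b → c • G a b) ≃ c • deconc v G
deconc-• c [] G = ≃-refl
deconc-• c (k ∷ v) G = ≃-trans (⊞-cong ≃-refl (deconc-• c v _)) (≃-sym (•-⊞ c _ _))

deconc-linear : (v : Comp) {h : Comp → Comp → Poly A → Poly B} →
  (∀ a b → Linear (h a b)) → Linear (λ p → deconc v (λ a b → h a b p))
deconc-linear v H = record
  { respects = λ e → deconc-cong v (λ a b → respects (H a b) e)
  ; add = λ p q → ≃-trans (deconc-cong v (λ a b → add (H a b) p q)) (deconc-⊞ v _ _)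
  ; scale = λ c p → ≃-trans (deconc-cong v (λ a b → scale (H a b) c p)) (deconc-• c v _) }

ext-family-linear : (q : Poly C) {h : Word C → Poly A → Poly B} →
  (∀ u → Linear (h u)) → Linear (λ p → ext (λ u → h u p) q)
ext-family-linear q H = record
  { respects = λ e → ext-cong q (λ u → respects (H u) e)
  ; add = λ p p′ → ≃-trans (ext-cong q (λ u → add (H u) p p′)) (ext-⊞ _ _ q)
  ; scale = λ c p → ≃-trans (ext-cong q (λ u → scale (H u) c p)) (ext-• c _ q) }

module Action (n : ℕ) where
  open Setup n

  𝕩 𝕫 : 𝒜
  -- `ζ s` is z_s^δ with the coefficient δ(s) already evaluated, and `β s` is the right factor in
  -- rule (I).
  𝕪 ζ β : μ → 𝒜
  𝕩 = mon (X ∷ [])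
  𝕪 s = mon (Y s ∷ [])
  𝕫 = 𝕩 ⊞ 𝕪 fz
  ζ fz = 𝕩
  ζ (fs t) = 𝕩 ⊞ 𝕪 (fs t)
  β s = 𝕫 ⊟ ζ s

  𝕫^ : ℕ → 𝒜
  𝕫^ zero = 𝟙
  𝕫^ (suc k) = 𝕫^ k ⊠ 𝕫

  -- The order z^k z z^j is the one in which the contraction term appears in `T-D`.
  𝕫^-+ : (j k : ℕ) → 𝕫^ (suc (j +ℕ k)) ≃ 𝕫^ k ⊠ 𝕫 ⊠ 𝕫^ j
  𝕫^-+ zero k = ≃-sym (⊠-identityʳ _)
  𝕫^-+ (suc j) k = ≃-trans (⊠-congʳ (𝕫^-+ j k)) (⊠-assoc _ _ _)

  D : μ → Comp → 𝒜
  D s [] = 𝟙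
  D s (k ∷ v) = D s v ⊠ 𝕫^ k ⊠ β s

  -- T_v on letters, through x = z_1^δ, y_1 = z − z_1^δ and y_t = z_t^δ − z_1^δ.
  actLetter : Comp → Letter n → 𝒜
  actLetter v X = ζ fz ⊠ D fz v
  actLetter v (Y fz) = ε v ⊠ 𝕫 ⊟ ζ fz ⊠ D fz v
  actLetter v (Y (fs t)) = ζ (fs t) ⊠ D (fs t) v ⊟ ζ fz ⊠ D fz v

  -- The last letter is split off, as in rule (IV) and in `treeWordF`, so that the comparison with
  -- tree maps follows the same recursion.
  τ : Comp → List (Letter n) → 𝒜
  τ v [] = ε v
  τ v (l ∷ rw) = deconc v (λ a b → τ a rw ⊠ actLetter b l)

  T : Comp → 𝒜 → 𝒜
  T v = ext (λ w → τ v (reverse w))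

  T-linear : (v : Comp) → Linear (T v)
  T-linear v = ext-linear _

  T-mon : (v : Comp) (w : Word (Letter n)) → T v (mon w) ≃ τ v (reverse w)
  T-mon v w = ext-mon _ w

  T-𝟙 : (v : Comp) → T v 𝟙 ≃ ε v
  T-𝟙 v = ≃-trans (respects (T-linear v) 𝟙≃mon) (T-mon v [])

  actLetter-[] : (l : Letter n) → actLetter [] l ≃ mon (l ∷ [])
  actLetter-[] X = ⊠-identityʳ _
  actLetter-[] (Y fz) = ring (𝕩 ∷ 𝕪 fz ∷ []) (:1 :* (a₀ :+ a₁) :- a₀ :* :1) a₁
  actLetter-[] (Y (fs t)) = ring (𝕩 ∷ 𝕪 (fs t) ∷ []) ((a₀ :+ a₁) :* :1 :- a₀ :* :1) a₁

  τ-[] : (rw : List (Letter n)) → τ [] rw ≃ mon (reverse rw)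
  τ-[] [] = 𝟙≃mon
  τ-[] (l ∷ rw) = begin
    τ [] rw ⊠ actLetter [] l             ≈⟨ ⊠-cong (τ-[] rw) (actLetter-[] l) ⟩
    mon (reverse rw) ⊠ mon (l ∷ []) ≈⟨ mon-⊠ _ _ ⟩
    mon (reverse rw ++ l ∷ [])      ≈⟨ ≃-reflexive (cong mon (sym (Listₚ.unfold-reverse l rw))) ⟩
    mon (reverse (l ∷ rw))          ∎
    where open ≃-Reasoning

  T-[] : (p : 𝒜) → T [] p ≃ p
  T-[] p = ≃-trans (ext-cong p (λ w → ≃-trans (τ-[] (reverse w))
    (≃-reflexive (cong mon (Listₚ.reverse-involutive w))))) (ext-id p)

  -- Coassociativity: splitting off letters one at a time distributes `v` over any factorization of
  -- the word. The lists are reversed, hence `ru` is the left factor.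
  τ-++ : (v : Comp) (rw ru : List (Letter n)) → τ v (rw ++ ru) ≃ deconc v (λ a b → τ a ru ⊠ τ b rw)
  τ-++ v [] ru = ≃-sym (deconc-counitʳ v (λ a → τ a ru))
  τ-++ v (l ∷ rw) ru = begin
    deconc v (λ a b → τ a (rw ++ ru) ⊠ actLetter b l)
      ≈⟨ deconc-cong v (λ a b → ⊠-congʳ (τ-++ a rw ru)) ⟩
    deconc v (λ a c → deconc a (λ a b → τ a ru ⊠ τ b rw) ⊠ actLetter c l)
      ≈⟨ deconc-cong v (λ a c → ≃-trans (linear-deconc (⊠ʳ-linear (actLetter c l)) a _) (deconc-cong a (λ _ _ → ⊠-assoc _ _ _))) ⟩
    deconc v (λ a c → deconc a (λ a b → τ a ru ⊠ (τ b rw ⊠ actLetter c l)))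
      ≈⟨ deconc-coassoc v _ ⟩
    deconc v (λ a b → deconc b (λ b c → τ a ru ⊠ (τ b rw ⊠ actLetter c l)))
      ≈⟨ deconc-cong v (λ a b → ≃-sym (linear-deconc (⊠ˡ-linear (τ a ru)) b _)) ⟩
    deconc v (λ a b → τ a ru ⊠ τ b (l ∷ rw)) ∎
    where open ≃-Reasoning

  T-⊠ : (v : Comp) (p q : 𝒜) → T v (p ⊠ q) ≃ deconc v (λ a b → T a p ⊠ T b q)
  T-⊠ v p q = linear-unique
    (linear-∘ (T-linear v) (⊠ʳ-linear q))
    (deconc-linear v (λ a b → linear-∘ (⊠ʳ-linear (T b q)) (T-linear a)))
    (λ u → linear-unique
      (linear-∘ (T-linear v) (⊠ˡ-linear (mon u)))
      (deconc-linear v (λ a b → linear-∘ (⊠ˡ-linear (T a (mon u))) (T-linear b)))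
      (λ w → on-words u w) q) p
    where
    open ≃-Reasoning
    on-words : ∀ u w → T v (mon u ⊠ mon w) ≃ deconc v (λ a b → T a (mon u) ⊠ T b (mon w))
    on-words u w = begin
      T v (mon u ⊠ mon w)              ≈⟨ respects (T-linear v) (mon-⊠ u w) ⟩
      T v (mon (u ++ w))               ≈⟨ T-mon v (u ++ w) ⟩
      τ v (reverse (u ++ w))           ≈⟨ ≃-reflexive (cong (τ v) (Listₚ.reverse-++ u w)) ⟩
      τ v (reverse w ++ reverse u)     ≈⟨ τ-++ v (reverse w) (reverse u) ⟩
      deconc v (λ a b → τ a (reverse u) ⊠ τ b (reverse w))
        ≈⟨ deconc-cong v (λ a b → ≃-sym (⊠-cong (T-mon a u) (T-mon b w))) ⟩
      deconc v (λ a b → T a (mon u) ⊠ T b (mon w)) ∎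

  T-letter : (v : Comp) (l : Letter n) → T v (mon (l ∷ [])) ≃ actLetter v l
  T-letter v l = ≃-trans (T-mon v _) (deconc-counitˡ v (λ b → actLetter b l))

  T-𝕫 : (v : Comp) → T v 𝕫 ≃ ε v ⊠ 𝕫
  T-𝕫 v = ≃-trans (add (T-linear v) _ _) (≃-trans (⊞-cong (T-letter v X) (T-letter v (Y fz)))
    (ring (ζ fz ⊠ D fz v ∷ ε v ⊠ 𝕫 ∷ []) (a₀ :+ (a₁ :- a₀)) a₁))

  T-ζ : (v : Comp) (s : μ) → T v (ζ s) ≃ ζ s ⊠ D s v
  T-ζ v fz = T-letter v X
  T-ζ v (fs t) = ≃-trans (add (T-linear v) _ _) (≃-trans (⊞-cong (T-letter v X) (T-letter v (Y (fs t))))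
    (ring (ζ fz ⊠ D fz v ∷ ζ (fs t) ⊠ D (fs t) v ∷ []) (a₀ :+ (a₁ :- a₀)) a₁))

  -- Since T_b(z) = ε(b) z, only the term in which `v` falls entirely on `p` survives.
  T-⊠𝕫 : (v : Comp) (p : 𝒜) → T v (p ⊠ 𝕫) ≃ T v p ⊠ 𝕫
  T-⊠𝕫 v p = begin
    T v (p ⊠ 𝕫)                              ≈⟨ T-⊠ v p 𝕫 ⟩
    deconc v (λ a b → T a p ⊠ T b 𝕫)            ≈⟨ deconc-cong v (λ a b → ≃-trans (⊠-congˡ (T-𝕫 b)) (≃-sym (⊠-assoc _ _ _))) ⟩
    deconc v (λ a b → T a p ⊠ ε b ⊠ 𝕫)          ≈⟨ ≃-sym (linear-deconc (⊠ʳ-linear 𝕫) v _) ⟩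
    deconc v (λ a b → T a p ⊠ ε b) ⊠ 𝕫          ≈⟨ ⊠-congʳ (deconc-counitʳ v (λ a → T a p)) ⟩
    T v p ⊠ 𝕫                                ∎
    where open ≃-Reasoning

  T-⊠𝕫^ : (v : Comp) (p : 𝒜) (k : ℕ) → T v (p ⊠ 𝕫^ k) ≃ T v p ⊠ 𝕫^ k
  T-⊠𝕫^ v p zero = ≃-trans (respects (T-linear v) (⊠-identityʳ p)) (≃-sym (⊠-identityʳ _))
  T-⊠𝕫^ v p (suc k) = begin
    T v (p ⊠ (𝕫^ k ⊠ 𝕫))  ≈⟨ respects (T-linear v) (≃-sym (⊠-assoc _ _ _)) ⟩
    T v (p ⊠ 𝕫^ k ⊠ 𝕫)    ≈⟨ T-⊠𝕫 v _ ⟩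
    T v (p ⊠ 𝕫^ k) ⊠ 𝕫    ≈⟨ ⊠-congʳ (T-⊠𝕫^ v p k) ⟩
    T v p ⊠ 𝕫^ k ⊠ 𝕫      ≈⟨ ⊠-assoc _ _ _ ⟩
    T v p ⊠ (𝕫^ k ⊠ 𝕫)    ∎
    where open ≃-Reasoning

  T-⊠ζ : (v : Comp) (p : 𝒜) (s : μ) → T v (p ⊠ ζ s) ≃ deconc v (λ a b → T a p ⊠ (ζ s ⊠ D s b))
  T-⊠ζ v p s = ≃-trans (T-⊠ v p (ζ s)) (deconc-cong v (λ a b → ⊠-congˡ (T-ζ b s)))

  -- Composition of two operators `T`

  ext-D∷ : (s : μ) (k : ℕ) (p : Poly ℕ) → ext (λ u → D s (k ∷ u)) p ≃ ext (D s) p ⊠ 𝕫^ k ⊠ β s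
  ext-D∷ s k p = ≃-sym (linear-ext (linear-∘ (⊠ʳ-linear (β s)) (⊠ʳ-linear (𝕫^ k))) (D s) p)

  module _ (s : μ) where
    open ≃-Reasoning

    tails : Comp → 𝒜 → 𝒜
    tails v p = deconc v (λ a b → T a p ⊠ (ζ s ⊠ D s b))

    T-⊠β : (v : Comp) (p : 𝒜) → T v (p ⊠ β s) ≃ T v p ⊠ 𝕫 ⊟ tails v p
    T-⊠β v p = begin
      T v (p ⊠ (𝕫 ⊟ ζ s))            ≈⟨ respects (T-linear v) (sub (⊠ˡ-linear p) 𝕫 (ζ s)) ⟩
      T v (p ⊠ 𝕫 ⊟ p ⊠ ζ s)          ≈⟨ sub (T-linear v) _ _ ⟩
      T v (p ⊠ 𝕫) ⊟ T v (p ⊠ ζ s)    ≈⟨ ⊟-cong (T-⊠𝕫 v p) (T-⊠ζ v p s) ⟩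
      T v p ⊠ 𝕫 ⊟ tails v p          ∎

    -- The term in which `p` receives all of `j ∷ v` is split off. In all others the last letter `j`
    -- falls on `ζ s`, where D_s turns it into the right factor z^j β. As `tails` expands T(p
    -- z_s^δ), this is also the source of the rule for ◇_s.
    tails-∷ : (j : ℕ) (v : Comp) (p : 𝒜) →
      tails (j ∷ v) p ≃ T (j ∷ v) p ⊠ ζ s ⊞ tails v p ⊠ 𝕫^ j ⊠ β s
    tails-∷ j v p = ⊞-cong (⊠-congˡ (⊠-identityʳ _)) (begin
      deconc v (λ a b → T a p ⊠ (ζ s ⊠ (D s b ⊠ 𝕫^ j ⊠ β s)))
        ≈⟨ deconc-cong v (λ a b → ring (T a p ∷ ζ s ∷ D s b ∷ 𝕫^ j ∷ β s ∷ [])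
             (a₀ :* (a₁ :* (a₂ :* a₃ :* a₄))) (a₀ :* (a₁ :* a₂) :* a₃ :* a₄)) ⟩
      deconc v (λ a b → T a p ⊠ (ζ s ⊠ D s b) ⊠ 𝕫^ j ⊠ β s)
        ≈⟨ ≃-sym (linear-deconc (linear-∘ (⊠ʳ-linear (β s)) (⊠ʳ-linear (𝕫^ j))) v _) ⟩
      tails v p ⊠ 𝕫^ j ⊠ β s ∎)

    -- This is `tails-∷` rewritten with z_s^δ = z - β. Replacing T_v(p z_s^δ) by T_v(p) z - T_v(p β)
    -- creates the term that becomes the contraction.
    T-∷-⊠β : (j : ℕ) (v : Comp) (p : 𝒜) →
      T (j ∷ v) (p ⊠ β s) ≃ T (j ∷ v) p ⊠ β s ⊞ (T v (p ⊠ β s) ⊟ T v p ⊠ 𝕫) ⊠ 𝕫^ j ⊠ β s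
    T-∷-⊠β j v p = begin
      T (j ∷ v) (p ⊠ β s)
        ≈⟨ T-⊠β (j ∷ v) p ⟩
      T (j ∷ v) p ⊠ 𝕫 ⊟ tails (j ∷ v) p
        ≈⟨ ⊟-cong ≃-refl (tails-∷ j v p) ⟩
      T (j ∷ v) p ⊠ 𝕫 ⊟ (T (j ∷ v) p ⊠ ζ s ⊞ tails v p ⊠ 𝕫^ j ⊠ β s)
        ≈⟨ ring (T (j ∷ v) p ∷ 𝕫 ∷ ζ s ∷ tails v p ∷ 𝕫^ j ∷ T v p ∷ [])
             (a₀ :* a₁ :- (a₀ :* a₂ :+ a₃ :* a₄ :* (a₁ :- a₂)))
             (a₀ :* (a₁ :- a₂) :+ (a₅ :* a₁ :- a₃ :- a₅ :* a₁) :* a₄ :* (a₁ :- a₂)) ⟩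
      T (j ∷ v) p ⊠ β s ⊞ (T v p ⊠ 𝕫 ⊟ tails v p ⊟ T v p ⊠ 𝕫) ⊠ 𝕫^ j ⊠ β s
        ≈⟨ ⊞-cong ≃-refl (⊠-congʳ (⊠-congʳ (⊟-cong (≃-sym (T-⊠β v p)) ≃-refl))) ⟩
      T (j ∷ v) p ⊠ β s ⊞ (T v (p ⊠ β s) ⊟ T v p ⊠ 𝕫) ⊠ 𝕫^ j ⊠ β s ∎

    -- Removing the last β of D_s(`k ∷ w`) and applying `T-∷-⊠β` gives three terms, which correspond
    -- to the three summands of `qs`. The one with T_v(p) z, where p ends in z^k, carries z^k z z^j
    -- and a minus sign: it is the contraction.
    T-D : (v w : Comp) → T v (ζ s ⊠ D s w) ≃ ζ s ⊠ ext (D s) (qs v w)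
    T-D [] w = ≃-trans (T-[] _) (⊠-congˡ (≃-sym (ext-mon (D s) w)))
    T-D (j ∷ v) [] = ≃-trans (respects (T-linear _) (⊠-identityʳ _))
      (≃-trans (T-ζ (j ∷ v) s) (⊠-congˡ (≃-sym (ext-mon (D s) (j ∷ v)))))
    T-D (j ∷ v) (k ∷ w) = begin
      T (j ∷ v) (ζ s ⊠ (D s w ⊠ 𝕫^ k ⊠ β s))
        ≈⟨ respects (T-linear _) assoc ⟩
      T (j ∷ v) (P ⊠ β s)
        ≈⟨ T-∷-⊠β j v P ⟩
      T (j ∷ v) P ⊠ β s ⊞ (T v (P ⊠ β s) ⊟ T v P ⊠ 𝕫) ⊠ 𝕫^ j ⊠ β s
        ≈⟨ ⊞-cong (⊠-congʳ (≃-trans (T-⊠𝕫^ (j ∷ v) _ k) (⊠-congʳ (T-D (j ∷ v) w))))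
             (⊠-congʳ (⊠-congʳ (⊟-cong
               (≃-trans (respects (T-linear v) (≃-sym assoc)) (T-D v (k ∷ w)))
               (⊠-congʳ (≃-trans (T-⊠𝕫^ v _ k) (⊠-congʳ (T-D v w))))))) ⟩
      ζ s ⊠ Q₂ ⊠ 𝕫^ k ⊠ β s ⊞ (ζ s ⊠ Q₁ ⊟ ζ s ⊠ Q₃ ⊠ 𝕫^ k ⊠ 𝕫) ⊠ 𝕫^ j ⊠ β s
        ≈⟨ ring (ζ s ∷ Q₁ ∷ Q₂ ∷ Q₃ ∷ 𝕫^ j ∷ 𝕫^ k ∷ 𝕫 ∷ β s ∷ [])
             (a₀ :* a₂ :* a₅ :* a₇ :+ (a₀ :* a₁ :- a₀ :* a₃ :* a₅ :* a₆) :* a₄ :* a₇)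
             (a₀ :* (a₁ :* a₄ :* a₇ :+ a₂ :* a₅ :* a₇ :- a₃ :* (a₅ :* a₆ :* a₄) :* a₇)) ⟩
      ζ s ⊠ (Q₁ ⊠ 𝕫^ j ⊠ β s ⊞ Q₂ ⊠ 𝕫^ k ⊠ β s ⊟ Q₃ ⊠ (𝕫^ k ⊠ 𝕫 ⊠ 𝕫^ j) ⊠ β s)
        ≈⟨ ⊠-congˡ (⊟-cong ≃-refl (⊠-congʳ (⊠-congˡ (≃-sym (𝕫^-+ j k))))) ⟩
      ζ s ⊠ (Q₁ ⊠ 𝕫^ j ⊠ β s ⊞ Q₂ ⊠ 𝕫^ k ⊠ β s ⊟ Q₃ ⊠ 𝕫^ (suc (j +ℕ k)) ⊠ β s)
        ≈⟨ ⊠-congˡ (≃-sym (≃-trans (ext-qs (D s) j v k w)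
             (⊟-cong (⊞-cong (ext-D∷ s j _) (ext-D∷ s k _)) (ext-D∷ s (suc (j +ℕ k)) _)))) ⟩
      ζ s ⊠ ext (D s) (qs (j ∷ v) (k ∷ w)) ∎
      where
      P = ζ s ⊠ D s w ⊠ 𝕫^ k
      Q₁ = ext (D s) (qs v (k ∷ w))
      Q₂ = ext (D s) (qs (j ∷ v) w)
      Q₃ = ext (D s) (qs v w)
      assoc : ζ s ⊠ (D s w ⊠ 𝕫^ k ⊠ β s) ≃ P ⊠ β s
      assoc = ring (ζ s ∷ D s w ∷ 𝕫^ k ∷ β s ∷ []) (a₀ :* (a₁ :* a₂ :* a₃)) (a₀ :* a₁ :* a₂ :* a₃)

  T-D′ : (s : μ) (v w : Comp) → T v (ζ s ⊠ D s w) ≃ ext (λ u → ζ s ⊠ D s u) (qs v w)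
  T-D′ s v w = ≃-trans (T-D s v w) (linear-ext (⊠ˡ-linear (ζ s)) (D s) (qs v w))

  T-ε : (v w : Comp) → T v (ε w) ≃ ext ε (qs v w)
  T-ε v [] = ≃-trans (T-𝟙 v) (≃-sym (≃-trans (qs-ε v []) (⊠-identityʳ _)))
  T-ε v (k ∷ w) = ≃-trans (zer (T-linear v)) (≃-sym (≃-trans (qs-ε v (k ∷ w)) (zer (⊠ˡ-linear _))))

  T-actLetter : (v w : Comp) (l : Letter n) → T v (actLetter w l) ≃ ext (λ u → actLetter u l) (qs v w)
  T-actLetter v w X = T-D′ fz v w
  T-actLetter v w (Y fz) = begin
    T v (ε w ⊠ 𝕫 ⊟ ζ fz ⊠ D fz w)
      ≈⟨ sub (T-linear v) _ _ ⟩
    T v (ε w ⊠ 𝕫) ⊟ T v (ζ fz ⊠ D fz w)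
      ≈⟨ ⊟-cong (≃-trans (T-⊠𝕫 v (ε w)) (⊠-congʳ (T-ε v w))) (T-D′ fz v w) ⟩
    ext ε (qs v w) ⊠ 𝕫 ⊟ ext (λ u → ζ fz ⊠ D fz u) (qs v w)
      ≈⟨ ⊟-cong (linear-ext (⊠ʳ-linear 𝕫) ε (qs v w)) ≃-refl ⟩
    ext (λ u → ε u ⊠ 𝕫) (qs v w) ⊟ ext (λ u → ζ fz ⊠ D fz u) (qs v w)
      ≈⟨ ≃-sym (ext-⊟ _ _ (qs v w)) ⟩
    ext (λ u → actLetter u (Y fz)) (qs v w) ∎
    where open ≃-Reasoning
  T-actLetter v w (Y (fs t)) = ≃-trans (sub (T-linear v) _ _)
    (≃-trans (⊟-cong (T-D′ (fs t) v w) (T-D′ fz v w)) (≃-sym (ext-⊟ _ _ (qs v w))))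

  -- Both sides extend from letters to words by deconcatenation. Because deconcatenation is
  -- multiplicative (`qs-deconc`), the identity on letters propagates.
  T-τ : (v w : Comp) (rw : List (Letter n)) → T v (τ w rw) ≃ ext (λ u → τ u rw) (qs v w)
  T-τ v w [] = T-ε v w
  T-τ v w (l ∷ rw) = begin
    T v (deconc w (λ c d → τ c rw ⊠ actLetter d l))
      ≈⟨ linear-deconc (T-linear v) w _ ⟩
    deconc w (λ c d → T v (τ c rw ⊠ actLetter d l))
      ≈⟨ deconc-cong w (λ c d → T-⊠ v (τ c rw) (actLetter d l)) ⟩
    deconc w (λ c d → deconc v (λ a b → T a (τ c rw) ⊠ T b (actLetter d l)))
      ≈⟨ deconc-swap w v _ ⟩
    deconc v (λ a b → deconc w (λ c d → T a (τ c rw) ⊠ T b (actLetter d l)))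
      ≈⟨ deconc-cong v (λ a b → deconc-cong w (λ c d → factor a b c d)) ⟩
    deconc v (λ a b → deconc w (λ c d → ext (λ p → ext (λ q → τ p rw ⊠ actLetter q l) (qs b d)) (qs a c)))
      ≈⟨ ≃-sym (qs-deconc v w _) ⟩
    ext (λ u → τ u (l ∷ rw)) (qs v w) ∎
    where
    open ≃-Reasoning
    factor : ∀ a b c d → T a (τ c rw) ⊠ T b (actLetter d l)
                       ≃ ext (λ p → ext (λ q → τ p rw ⊠ actLetter q l) (qs b d)) (qs a c)
    factor a b c d = begin
      T a (τ c rw) ⊠ T b (actLetter d l)
        ≈⟨ ⊠-cong (T-τ a c rw) (T-actLetter b d l) ⟩
      ext (λ p → τ p rw) (qs a c) ⊠ ext (λ q → actLetter q l) (qs b d)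
        ≈⟨ linear-ext (⊠ʳ-linear _) _ (qs a c) ⟩
      ext (λ p → τ p rw ⊠ ext (λ q → actLetter q l) (qs b d)) (qs a c)
        ≈⟨ ext-cong (qs a c) (λ p → linear-ext (⊠ˡ-linear (τ p rw)) _ (qs b d)) ⟩
      ext (λ p → ext (λ q → τ p rw ⊠ actLetter q l) (qs b d)) (qs a c) ∎

  T-T : (v w : Comp) (p : 𝒜) → T v (T w p) ≃ ext (λ u → T u p) (qs v w)
  T-T v w = linear-unique (linear-∘ (T-linear v) (T-linear w))
    (ext-family-linear (qs v w) T-linear)
    (λ x → ≃-trans (respects (T-linear v) (T-mon w x)) (≃-trans (T-τ v w (reverse x))
      (ext-cong (qs v w) (λ u → ≃-sym (T-mon u x)))))

-- Rooted tree maps as operators T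

degF-++ : (f g : Forest) → degF (f ++ g) ≡ degF f +ℕ degF g
degF-++ [] g = refl
degF-++ (t ∷ f) g = trans (cong (degT t +ℕ_) (degF-++ f g)) (sym (ℕₚ.+-assoc (degT t) _ _))

HasDegree : ℕ → Forest × Forest → Set
HasDegree d (a , b) = degF a +ℕ degF b ≡ d

mutual
  -- The grading of the coproduct bounds both tensor factors by the degree of `f`, so the fuel
  -- suffices in every recursive call of the tree maps.
  ΔF-degree : (f : Forest) → All (HasDegree (degF f)) (ΔF f)
  ΔF-degree [] = refl ∷ []
  ΔF-degree (t ∷ f) = Allₚ.concat⁺ (Allₚ.map⁺ (All.map
    (λ {ab} e → Allₚ.map⁺ (All.map (λ {cd} e′ → total (proj₁ ab) (proj₂ ab) (proj₁ cd) (proj₂ cd) e e′)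
      (ΔF-degree f))) (ΔT-degree t)))
    where
    total : ∀ a b c d → degF a +ℕ degF b ≡ degT t → degF c +ℕ degF d ≡ degF f →
      degF (a ++ c) +ℕ degF (b ++ d) ≡ degT t +ℕ degF f
    total a b c d e e′ = trans (cong₂ _+ℕ_ (degF-++ a c) (degF-++ b d))
      (trans (CSemigroup.interchange ℕₚ.+-commutativeSemigroup (degF a) (degF c) (degF b) (degF d)) (cong₂ _+ℕ_ e e′))

  ΔT-degree : (t : Tree) → All (HasDegree (degT t)) (ΔT t)
  ΔT-degree (node f) =
    trans (ℕₚ.+-identityʳ _) (ℕₚ.+-identityʳ _) ∷
    Allₚ.map⁺ (All.map (λ {ab} e → grafted (proj₁ ab) (proj₂ ab) e) (ΔF-degree f))
    where
    grafted : ∀ a b → degF a +ℕ degF b ≡ degF f → degF a +ℕ (suc (degF b) +ℕ 0) ≡ suc (degF f)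
    grafted a b e = trans (cong (degF a +ℕ_) (ℕₚ.+-identityʳ _)) (trans (ℕₚ.+-suc _ _) (cong suc e))

compH : ℋ → Poly ℕ
compH = concatMap (λ cf → proj₁ cf · compF (proj₂ cf))

module TreeAction (n : ℕ) where
  open Setup n
  open TreeMaps n
  open Action n

  z≃ : z ≃ 𝕫
  z≃ = ⊕≃ wd≃ wd≃

  zδ≃ : (s : μ) → zδ s ≃ ζ s
  zδ≃ fz = ≃-trans (⊕≃ wd≃ (≃-trans (·≃ 0ℚ wd≃) (0• _))) (⊞-identityʳ _)
  zδ≃ (fs t) = ⊕≃ wd≃ (≃-trans (·≃ 1ℚ wd≃) (1• _))

  z⊝zδ≃ : (s : μ) → z ⊝ zδ s ≃ β s
  z⊝zδ≃ s = ⊝≃ z≃ (zδ≃ s)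

  -- Right division by z - z_s^δ

  divR-linear : Linear divR
  divR-linear = linExt-linear _

  ⟨Y1⟩ : Letter n → Poly (Letter n) → Poly (Letter n)
  ⟨Y1⟩ (Y fz) p = p
  ⟨Y1⟩ _ p = 𝟘

  divR-wd : (w : Word (Letter n)) (l : Letter n) (rw : List (Letter n)) → reverse w ≡ l ∷ rw →
    divR (wd w) ≃ ⟨Y1⟩ l (mon (reverse rw))
  divR-wd w X rw eq rewrite eq = 0P≃
  divR-wd w (Y fz) rw eq rewrite eq = wd≃
  divR-wd w (Y (fs t)) rw eq rewrite eq = 0P≃

  divR-⊠ : (p : 𝒜) (l : Letter n) → divR (p ⊠ mon (l ∷ [])) ≃ ⟨Y1⟩ l p
  divR-⊠ p l = linear-unique (linear-∘ divR-linear (⊠ʳ-linear (mon (l ∷ [])))) (sel-linear l)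
    (λ w → begin
      divR (mon w ⊠ mon (l ∷ []))      ≈⟨ respects divR-linear (≃-trans (mon-⊠ w _) (≃-sym wd≃)) ⟩
      divR (wd (w ++ l ∷ []))          ≈⟨ divR-wd (w ++ l ∷ []) l (reverse w) (Listₚ.reverse-++ w (l ∷ [])) ⟩
      ⟨Y1⟩ l (mon (reverse (reverse w))) ≈⟨ ≃-reflexive (cong (λ u → ⟨Y1⟩ l (mon u)) (Listₚ.reverse-involutive w)) ⟩
      ⟨Y1⟩ l (mon w)                   ∎) p
    where
    open ≃-Reasoning
    const-𝟘 : Linear {A} {B} (λ _ → 𝟘)
    const-𝟘 = record { respects = λ _ → ≃-refl ; add = λ _ _ → ≃-sym (⊞-identityʳ 𝟘) ; scale = λ c _ → ≃-sym (•-𝟘 c) }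
    sel-linear : ∀ l → Linear (⟨Y1⟩ l)
    sel-linear X = const-𝟘
    sel-linear (Y fz) = id-linear
    sel-linear (Y (fs _)) = const-𝟘

  -- β is y_1 or y_1 - y_t with t ≠ 1, so the part of p β ending in y_1 is exactly p y_1.
  divR-⊠β : (s : μ) (p : 𝒜) → divR (p ⊠ β s) ≃ p
  divR-⊠β fz p = ≃-trans (respects divR-linear (⊠-congˡ (ring (𝕩 ∷ 𝕪 fz ∷ []) (a₀ :+ a₁ :- a₀) a₁))) (divR-⊠ p (Y fz))
  divR-⊠β (fs t) p = begin
    divR (p ⊠ (𝕩 ⊞ 𝕪 fz ⊟ (𝕩 ⊞ 𝕪 (fs t))))
      ≈⟨ respects divR-linear (ring (p ∷ 𝕩 ∷ 𝕪 fz ∷ 𝕪 (fs t) ∷ [])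
           (a₀ :* (a₁ :+ a₂ :- (a₁ :+ a₃))) (a₀ :* a₂ :- a₀ :* a₃)) ⟩
    divR (p ⊠ 𝕪 fz ⊟ p ⊠ 𝕪 (fs t))
      ≈⟨ sub divR-linear _ _ ⟩
    divR (p ⊠ 𝕪 fz) ⊟ divR (p ⊠ 𝕪 (fs t))
      ≈⟨ ⊟-cong (divR-⊠ p (Y fz)) (divR-⊠ p (Y (fs t))) ⟩
    p ⊟ 𝟘
      ≈⟨ ring (p ∷ []) (a₀ :- :0) a₀ ⟩
    p ∎
    where open ≃-Reasoning

  -- Here β does not divide: the value is the default of `divR` on words not ending in y_1. It
  -- occurs for the empty composition and is compensated in `divR-graftOp`.
  divR-ζ : (s : μ) → divR (ζ s) ≃ 𝟘
  divR-ζ fz = ≃-trans (respects divR-linear (≃-sym (⊠-identityˡ _))) (divR-⊠ 𝟙 X)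
  divR-ζ (fs t) = begin
    divR (𝕩 ⊞ 𝕪 (fs t))
      ≈⟨ respects divR-linear (ring (𝕩 ∷ 𝕪 (fs t) ∷ []) (a₀ :+ a₁) (:1 :* a₀ :+ :1 :* a₁)) ⟩
    divR (𝟙 ⊠ 𝕩 ⊞ 𝟙 ⊠ 𝕪 (fs t))
      ≈⟨ add divR-linear _ _ ⟩
    divR (𝟙 ⊠ 𝕩) ⊞ divR (𝟙 ⊠ 𝕪 (fs t))
      ≈⟨ ⊞-cong (divR-⊠ 𝟙 X) (divR-⊠ 𝟙 (Y (fs t))) ⟩
    𝟘 ⊞ 𝟘
      ≈⟨ ⊞-identityʳ 𝟘 ⟩
    𝟘 ∎
    where open ≃-Reasoning

  -- Rule (II) is right multiplication by z + (z − z_s^δ) after division by z − z_s^δ, which is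
  -- what graftOp does to a nonempty composition; the correction term takes care of the empty one.
  divR-graftOp : (s : μ) (v : Comp) →
    divR (ζ s ⊠ D s v) ⊠ (𝕫 ⊞ 𝕫 ⊟ ζ s) ⊠ β s ≃ ext (λ u → ζ s ⊠ D s u) (graftOp v) ⊟ ε v ⊠ (ζ s ⊠ β s)
  divR-graftOp s [] = begin
    divR (ζ s ⊠ 𝟙) ⊠ (𝕫 ⊞ 𝕫 ⊟ ζ s) ⊠ β s
      ≈⟨ ⊠-congʳ (⊠-congʳ (≃-trans (respects divR-linear (⊠-identityʳ _)) (divR-ζ s))) ⟩
    𝟘 ⊠ (𝕫 ⊞ 𝕫 ⊟ ζ s) ⊠ β s
      ≈⟨ ring (𝕫 ∷ ζ s ∷ β s ∷ []) (:0 :* (a₀ :+ a₀ :- a₁) :* a₂) (a₁ :* (:1 :* :1 :* a₂) :- :1 :* (a₁ :* a₂)) ⟩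
    ζ s ⊠ (𝟙 ⊠ 𝟙 ⊠ β s) ⊟ 𝟙 ⊠ (ζ s ⊠ β s)
      ≈⟨ ⊟-cong (≃-sym (ext-mon _ _)) ≃-refl ⟩
    ext (λ u → ζ s ⊠ D s u) (mon (0 ∷ [])) ⊟ 𝟙 ⊠ (ζ s ⊠ β s) ∎
    where open ≃-Reasoning
  divR-graftOp s (k ∷ v) = begin
    divR (ζ s ⊠ (D s v ⊠ 𝕫^ k ⊠ β s)) ⊠ (𝕫 ⊞ 𝕫 ⊟ ζ s) ⊠ β s
      ≈⟨ ⊠-congʳ (⊠-congʳ (≃-trans (respects divR-linear (≃-sym (⊠-assoc _ _ _))) (divR-⊠β s _))) ⟩
    ζ s ⊠ (D s v ⊠ 𝕫^ k) ⊠ (𝕫 ⊞ 𝕫 ⊟ ζ s) ⊠ β s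
      ≈⟨ ring (ζ s ∷ D s v ∷ 𝕫^ k ∷ 𝕫 ∷ [])
           (a₀ :* (a₁ :* a₂) :* (a₃ :+ a₃ :- a₀) :* (a₃ :- a₀))
           (a₀ :* (a₁ :* (a₂ :* a₃) :* (a₃ :- a₀)) :+ a₀ :* (a₁ :* a₂ :* (a₃ :- a₀) :* :1 :* (a₃ :- a₀))
             :- :0 :* (a₀ :* (a₃ :- a₀))) ⟩
    ζ s ⊠ D s (suc k ∷ v) ⊞ ζ s ⊠ D s (0 ∷ k ∷ v) ⊟ 𝟘 ⊠ (ζ s ⊠ β s)
      ≈⟨ ⊟-cong (≃-sym (ext-graftOp-∷ _ k v)) ≃-refl ⟩
    ext (λ u → ζ s ⊠ D s u) (graftOp (k ∷ v)) ⊟ 𝟘 ⊠ (ζ s ⊠ β s) ∎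
    where open ≃-Reasoning

  open ≃-Reasoning

  mutual
    -- By rule (III) a forest acts through the composition of its trees, which `T-T` converts into
    -- `⋄`. The degree bound excludes a nonempty forest with fuel zero, where the program returns
    -- zero.
    forestMapF≃ : (k : ℕ) (f : Forest) → degF f ≤ k → (p : 𝒜) →
      forestMapF k f p ≃ ext (λ v → T v p) (compF f)
    forestMapF≃ k [] _ p = ≃-sym (≃-trans (ext-mon _ []) (T-[] p))
    forestMapF≃ (suc k) (node g ∷ f) (s≤s le) p = begin
      treeMapF (suc k) (node g) (forestMapF (suc k) f p)
        ≈⟨ linExt≃ (λ w → treeWordF≃ k g (ℕₚ.m+n≤o⇒m≤o _ le) (reverse w))
                   (forestMapF≃ (suc k) f (ℕₚ.m≤n⇒m≤1+n (ℕₚ.m+n≤o⇒n≤o (degF g) le)) p) ⟩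
      ext (λ w → ext (λ v → τ v (reverse w)) (compT (node g))) (ext (λ w → T w p) (compF f))
        ≈⟨ ext-swap (ext (λ w → T w p) (compF f)) (compT (node g)) _ ⟩
      ext (λ v → T v (ext (λ w → T w p) (compF f))) (compT (node g))
        ≈⟨ ext-cong (compT (node g)) (λ v → linear-ext (T-linear v) _ (compF f)) ⟩
      ext (λ v → ext (λ w → T v (T w p)) (compF f)) (compT (node g))
        ≈⟨ ext-cong (compT (node g)) (λ v → ext-cong (compF f) (λ w → T-T v w p)) ⟩
      ext (λ v → ext (λ w → ext (λ u → T u p) (qs v w)) (compF f)) (compT (node g))
        ≈⟨ ≃-sym (≃-trans (ext-ext _ _ (compT (node g))) (ext-cong (compT (node g)) (λ v → ext-ext _ _ (compF f)))) ⟩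
      ext (λ u → T u p) (compT (node g) ⋄ compF f) ∎

    -- Rule (IV) is a sum over `ΔT`, whose first term t ⊗ 1 gives the summand that leaves the last
    -- letter alone; `compT-deconc` turns this sum into deconcatenation. On the empty word both
    -- sides vanish, as E of a tree has no empty part.
    treeWordF≃ : (k : ℕ) (f : Forest) → degF f ≤ k → (rw : List (Letter n)) →
      treeWordF (suc k) (node f) rw ≃ ext (λ v → τ v rw) (compT (node f))
    treeWordF≃ k f le [] = ≃-trans 0P≃ (≃-sym (compT-ε (node f)))
    treeWordF≃ k f le (l ∷ rw) = begin
      treeWordF (suc k) (node f) (l ∷ rw)
        ≈⟨ ⊕≃ (⊗≃ (treeWordF≃ k f le rw) wd≃)
              (concatMap-congᴬ {H = λ ab → onPairs G (proj₁ ab , node (proj₂ ab) ∷ [])}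
                (All.map (λ {ab} e → term (proj₁ ab) (proj₂ ab) e) (ΔF-degree f))) ⟩
      ext (λ v → τ v rw) (compT (node f)) ⊠ mon (l ∷ [])
        ⊞ concatMap (λ ab → onPairs G (proj₁ ab , node (proj₂ ab) ∷ [])) (ΔF f)
        ≈⟨ ⊞-cong first (≃-reflexive (sym (Listₚ.concatMap-map (onPairs G) _ (ΔF f)))) ⟩
      onPairs G (node f ∷ [] , []) ⊞ concatMap (onPairs G) (map (λ ab → (proj₁ ab , node (proj₂ ab) ∷ [])) (ΔF f))
        ≈⟨ ≃-sym (⊕≃ ≃-refl ≃-refl) ⟩
      concatMap (onPairs G) (ΔT (node f))
        ≈⟨ ≃-sym (compT-deconc (node f) G) ⟩
      ext (λ v → τ v (l ∷ rw)) (compT (node f)) ∎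
      where
      G : Comp → Comp → 𝒜
      G a b = τ a rw ⊠ actLetter b l
      first : ext (λ v → τ v rw) (compT (node f)) ⊠ mon (l ∷ []) ≃ onPairs G (node f ∷ [] , [])
      first = begin
        ext (λ v → τ v rw) (compT (node f)) ⊠ mon (l ∷ [])
          ≈⟨ linear-ext (⊠ʳ-linear _) _ (compT (node f)) ⟩
        ext (λ v → τ v rw ⊠ mon (l ∷ [])) (compT (node f))
          ≈⟨ ext-cong₂ (λ v → ≃-sym (≃-trans (ext-mon _ []) (⊠-congˡ (actLetter-[] l)))) (≃-sym (compF-singleton (node f))) ⟩
        onPairs G (node f ∷ [] , []) ∎
      term : ∀ a b → degF a +ℕ degF b ≡ degF f →
        forestMapF k a (wd (reverse rw)) ⊗ letterF k (node b) l ≃ onPairs G (a , node b ∷ [])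
      term a b e = begin
        forestMapF k a (wd (reverse rw)) ⊗ letterF k (node b) l
          ≈⟨ ⊗≃ (forestMapF≃ k a (ℕₚ.m+n≤o⇒m≤o (degF a) sum≤) _)
                (letterF≃ k b (ℕₚ.m+n≤o⇒n≤o (degF a) sum≤) l) ⟩
        ext (λ v → T v (wd (reverse rw))) (compF a) ⊠ ext (λ v → actLetter v l) (compT (node b))
          ≈⟨ ⊠-cong (ext-cong (compF a) (λ v → ≃-trans (respects (T-linear v) wd≃) (≃-trans (T-mon v _)
               (≃-reflexive (cong (τ v) (Listₚ.reverse-involutive rw))))))
               (respects (ext-linear _) (≃-sym (compF-singleton (node b)))) ⟩
        ext (λ v → τ v rw) (compF a) ⊠ ext (λ v → actLetter v l) (compF (node b ∷ []))
          ≈⟨ linear-ext (⊠ʳ-linear _) _ (compF a) ⟩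
        ext (λ v → τ v rw ⊠ ext (λ v → actLetter v l) (compF (node b ∷ []))) (compF a)
          ≈⟨ ext-cong (compF a) (λ v → linear-ext (⊠ˡ-linear (τ v rw)) _ (compF (node b ∷ []))) ⟩
        onPairs G (a , node b ∷ []) ∎
        where
        sum≤ : degF a +ℕ degF b ≤ k
        sum≤ = subst (_≤ k) (sym e) le

    letterF≃ : (k : ℕ) (f : Forest) → degF f ≤ k → (l : Letter n) →
      letterF k (node f) l ≃ ext (λ v → actLetter v l) (compT (node f))
    letterF≃ k f le X = genF≃ k f le fz
    letterF≃ k f le (Y fz) = begin
      0P ⊝ genF k (node f) (gδ fz)
        ≈⟨ ⊝≃ 0P≃ (genF≃ k f le fz) ⟩
      𝟘 ⊟ ext (λ v → ζ fz ⊠ D fz v) (compT (node f))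
        ≈⟨ ⊟-cong (≃-sym (≃-trans (⊠-congʳ (compT-ε (node f))) (zer (⊠ʳ-linear 𝕫)))) ≃-refl ⟩
      ext ε (compT (node f)) ⊠ 𝕫 ⊟ ext (λ v → ζ fz ⊠ D fz v) (compT (node f))
        ≈⟨ ⊟-cong (linear-ext (⊠ʳ-linear 𝕫) ε _) ≃-refl ⟩
      ext (λ v → ε v ⊠ 𝕫) (compT (node f)) ⊟ ext (λ v → ζ fz ⊠ D fz v) (compT (node f))
        ≈⟨ ≃-sym (ext-⊟ _ _ (compT (node f))) ⟩
      ext (λ v → actLetter v (Y fz)) (compT (node f)) ∎
    letterF≃ k f le (Y (fs t)) =
      ≃-trans (⊝≃ (genF≃ k f le (fs t)) (genF≃ k f le fz)) (≃-sym (ext-⊟ _ _ (compT (node f))))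

    -- Rule (I) is the value of `graftOp` at the empty composition, and rule (II) its value on the
    -- nonempty ones, via `divR-graftOp`.
    genF≃ : (k : ℕ) (f : Forest) → degF f ≤ k → (s : μ) →
      genF k (node f) (gδ s) ≃ ext (λ v → ζ s ⊠ D s v) (compT (node f))
    genF≃ k [] le s = begin
      zδ s ⊗ (z ⊝ zδ s)                         ≈⟨ ⊗≃ (zδ≃ s) (z⊝zδ≃ s) ⟩
      ζ s ⊠ β s                                 ≈⟨ ring (ζ s ∷ β s ∷ []) (a₀ :* a₁) (a₀ :* (:1 :* :1 :* a₁)) ⟩
      ζ s ⊠ D s (0 ∷ [])                        ≈⟨ ≃-sym (ext-mon _ _) ⟩
      ext (λ v → ζ s ⊠ D s v) (mon (0 ∷ []))    ≈⟨ respects (ext-linear _) (≃-sym (ext-mon graftOp [])) ⟩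
      ext (λ v → ζ s ⊠ D s v) (compT (node []))    ∎
    genF≃ k f@(t ∷ g) le s = begin
      divR (forestMapF k f (zδ s)) ⊗ (z ⊕ z ⊝ zδ s) ⊗ (z ⊝ zδ s)
        ≈⟨ ⊗≃ (⊗≃ (respects divR-linear (forestMapF≃ k f le (zδ s))) (⊝≃ (⊕≃ z≃ z≃) (zδ≃ s))) (z⊝zδ≃ s) ⟩
      divR (ext (λ v → T v (zδ s)) (compF f)) ⊠ (𝕫 ⊞ 𝕫 ⊟ ζ s) ⊠ β s
        ≈⟨ ⊠-congʳ (⊠-congʳ (respects divR-linear
             (ext-cong (compF f) (λ v → ≃-trans (respects (T-linear v) (zδ≃ s)) (T-ζ v s))))) ⟩
      divR (ext (λ v → ζ s ⊠ D s v) (compF f)) ⊠ (𝕫 ⊞ 𝕫 ⊟ ζ s) ⊠ β s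
        ≈⟨ linear-ext (linear-∘ (⊠ʳ-linear (β s)) (linear-∘ (⊠ʳ-linear (𝕫 ⊞ 𝕫 ⊟ ζ s)) divR-linear)) _ (compF f) ⟩
      ext (λ v → divR (ζ s ⊠ D s v) ⊠ (𝕫 ⊞ 𝕫 ⊟ ζ s) ⊠ β s) (compF f)
        ≈⟨ ext-cong (compF f) (divR-graftOp s) ⟩
      ext (λ v → ext (λ u → ζ s ⊠ D s u) (graftOp v) ⊟ ε v ⊠ (ζ s ⊠ β s)) (compF f)
        ≈⟨ ext-⊟ _ _ (compF f) ⟩
      ext (λ v → ext (λ u → ζ s ⊠ D s u) (graftOp v)) (compF f) ⊟ ext (λ v → ε v ⊠ (ζ s ⊠ β s)) (compF f)
        -- The forest is nonempty, so the correction for the empty composition vanishes.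
        ≈⟨ ⊟-cong (≃-sym (ext-ext _ graftOp (compF f)))
             (≃-trans (≃-sym (linear-ext (⊠ʳ-linear _) ε (compF f))) (⊠-congʳ (compF-∷-ε t g))) ⟩
      ext (λ u → ζ s ⊠ D s u) (compT (node f)) ⊟ 𝟘 ⊠ (ζ s ⊠ β s)
        ≈⟨ ring (ext (λ u → ζ s ⊠ D s u) (compT (node f)) ∷ ζ s ⊠ β s ∷ []) (a₀ :- :0 :* a₁) a₀ ⟩
      ext (λ u → ζ s ⊠ D s u) (compT (node f)) ∎

  treeMapH≃ : (h : ℋ) (p : 𝒜) → treeMapH h p ≃ ext (λ v → T v p) (compH h)
  treeMapH≃ h p = ≃-trans
    (concatMap-cong h (λ cf → ≃-trans
      (·≃ (proj₁ cf) (forestMapF≃ _ (proj₂ cf) ℕₚ.≤-refl p))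
      (≃-trans (≃-sym (scale (ext-linear _) (proj₁ cf) (compF (proj₂ cf))))
        (respects (ext-linear _) (≃-sym (·≃ (proj₁ cf) ≃-refl))))))
    (≃-sym (linear-concatMap (ext-linear _) _ h))

-- The diamond product in terms of T

-- expandWord (reverse w) G rewrites the word w in x and y as a combination of products
-- e_{k₁} ⋯ e_{k_l} z^m, on which G is evaluated.
expandWord : List L1 → (ℕ → Comp → Poly B) → Poly B
expandWord [] G = G 0 []
expandWord (y₁ ∷ rv) G = expandWord rv (λ m v → G 0 (m ∷ v))
expandWord (x₁ ∷ rv) G = expandWord rv (λ m v → G (suc m) v) ⊟ expandWord rv (λ m v → G 0 (m ∷ v))

expandWord-cong : (rv : List L1) {G H : ℕ → Comp → Poly B} → (∀ m v → G m v ≃ H m v) → expandWord rv G ≃ expandWord rv H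
expandWord-cong [] e = e _ _
expandWord-cong (y₁ ∷ rv) e = expandWord-cong rv (λ _ _ → e _ _)
expandWord-cong (x₁ ∷ rv) e = ⊟-cong (expandWord-cong rv (λ _ _ → e _ _)) (expandWord-cong rv (λ _ _ → e _ _))

linear-expandWord : {h : Poly A → Poly B} → Linear h → (rv : List L1) (G : ℕ → Comp → Poly A) →
  h (expandWord rv G) ≃ expandWord rv (λ m v → h (G m v))
linear-expandWord H [] G = ≃-refl
linear-expandWord H (y₁ ∷ rv) G = linear-expandWord H rv _
linear-expandWord H (x₁ ∷ rv) G = ≃-trans (sub H _ _) (⊟-cong (linear-expandWord H rv _) (linear-expandWord H rv _))

expandWord-⊞ : (rv : List L1) (G H : ℕ → Comp → Poly B) →
  expandWord rv (λ m v → G m v ⊞ H m v) ≃ expandWord rv G ⊞ expandWord rv H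
expandWord-⊞ [] G H = ≃-refl
expandWord-⊞ (y₁ ∷ rv) G H = expandWord-⊞ rv _ _
expandWord-⊞ (x₁ ∷ rv) G H = ≃-trans (⊟-cong (expandWord-⊞ rv _ _) (expandWord-⊞ rv _ _))
  (ring (_ ∷ _ ∷ _ ∷ _ ∷ []) (a₀ :+ a₁ :- (a₂ :+ a₃)) (a₀ :- a₂ :+ (a₁ :- a₃)))

expandWord-• : (c : ℚ) (rv : List L1) (G : ℕ → Comp → Poly B) → expandWord rv (λ m v → c • G m v) ≃ c • expandWord rv G
expandWord-• c rv G = ≃-sym (linear-expandWord (record
  { respects = •-cong c ; add = •-⊞ c
  ; scale = λ d p → ≃-trans (•-• c d p) (≃-trans (≃-reflexive (cong (_• p) (*-comm c d))) (≃-sym (•-• d c p))) }) rv G)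

expandWord-linear : (rv : List L1) {h : ℕ → Comp → Poly A → Poly B} →
  (∀ m v → Linear (h m v)) → Linear (λ p → expandWord rv (λ m v → h m v p))
expandWord-linear rv H = record
  { respects = λ e → expandWord-cong rv (λ m v → respects (H m v) e)
  ; add = λ p q → ≃-trans (expandWord-cong rv (λ m v → add (H m v) p q)) (expandWord-⊞ rv _ _)
  ; scale = λ c p → ≃-trans (expandWord-cong rv (λ m v → scale (H m v) c p)) (expandWord-• c rv _) }

module Diamond (n : ℕ) where
  open Setup n
  open Action n
  open TreeAction n using (z≃; zδ≃)
  open ≃-Reasoning

  -- The product with the word reverse rv, extended from 𝒜_1^1 to 𝒜_1 = ⊕ 𝒜_1^1 z^m.
  K : List L1 → 𝒜 → 𝒜
  K rv p = expandWord rv (λ m v → T v p ⊠ 𝕫^ m)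

  K-linear : (rv : List L1) → Linear (K rv)
  K-linear rv = expandWord-linear rv (λ m v → linear-∘ (⊠ʳ-linear (𝕫^ m)) (T-linear v))

  K-x : (rv : List L1) (p : 𝒜) → K (x₁ ∷ rv) p ≃ K rv p ⊠ 𝕫 ⊟ K (y₁ ∷ rv) p
  K-x rv p = ⊟-cong (≃-trans (expandWord-cong rv (λ m v → ≃-sym (⊠-assoc _ _ _)))
    (≃-sym (linear-expandWord (⊠ʳ-linear 𝕫) rv _))) ≃-refl

  𝕫-𝕫^ : (m : ℕ) → 𝕫 ⊠ 𝕫^ m ≃ 𝕫^ m ⊠ 𝕫
  𝕫-𝕫^ zero = ring (𝕫 ∷ []) (a₀ :* :1) (:1 :* a₀)
  𝕫-𝕫^ (suc m) = ≃-trans (≃-sym (⊠-assoc _ _ _)) (⊠-congʳ (𝕫-𝕫^ m))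

  K-⊠𝕫 : (rv : List L1) (p : 𝒜) → K rv (p ⊠ 𝕫) ≃ K rv p ⊠ 𝕫
  K-⊠𝕫 rv p = ≃-trans (expandWord-cong rv (λ m v → begin
      T v (p ⊠ 𝕫) ⊠ 𝕫^ m     ≈⟨ ⊠-congʳ (T-⊠𝕫 v p) ⟩
      T v p ⊠ 𝕫 ⊠ 𝕫^ m       ≈⟨ ⊠-assoc _ _ _ ⟩
      T v p ⊠ (𝕫 ⊠ 𝕫^ m)     ≈⟨ ⊠-congˡ (𝕫-𝕫^ m) ⟩
      T v p ⊠ (𝕫^ m ⊠ 𝕫)     ≈⟨ ≃-sym (⊠-assoc _ _ _) ⟩
      T v p ⊠ 𝕫^ m ⊠ 𝕫       ∎))
    (≃-sym (linear-expandWord (⊠ʳ-linear 𝕫) rv _))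

  -- If a word is v z^m, then appending y gives the composition `m ∷ v` with no power of z left; the
  -- rule is `tails-∷` with `m` for `j`.
  K-y-ζ : (rv : List L1) (p : 𝒜) (t : μ) →
    K (y₁ ∷ rv) (p ⊠ ζ t) ≃ K rv (p ⊠ ζ t) ⊠ β t ⊞ K (y₁ ∷ rv) p ⊠ ζ t
  K-y-ζ rv p t = begin
    expandWord rv (λ m v → T (m ∷ v) (p ⊠ ζ t) ⊠ 𝟙)
      ≈⟨ expandWord-cong rv (λ m v → step m v) ⟩
    expandWord rv (λ m v → T v (p ⊠ ζ t) ⊠ 𝕫^ m ⊠ β t ⊞ T (m ∷ v) p ⊠ 𝟙 ⊠ ζ t)
      ≈⟨ expandWord-⊞ rv _ _ ⟩
    expandWord rv (λ m v → T v (p ⊠ ζ t) ⊠ 𝕫^ m ⊠ β t) ⊞ expandWord rv (λ m v → T (m ∷ v) p ⊠ 𝟙 ⊠ ζ t)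
      ≈⟨ ≃-sym (⊞-cong (linear-expandWord (⊠ʳ-linear (β t)) rv _) (linear-expandWord (⊠ʳ-linear (ζ t)) rv _)) ⟩
    K rv (p ⊠ ζ t) ⊠ β t ⊞ K (y₁ ∷ rv) p ⊠ ζ t ∎
    where
    step : ∀ m v → T (m ∷ v) (p ⊠ ζ t) ⊠ 𝟙 ≃ T v (p ⊠ ζ t) ⊠ 𝕫^ m ⊠ β t ⊞ T (m ∷ v) p ⊠ 𝟙 ⊠ ζ t
    step m v = begin
      T (m ∷ v) (p ⊠ ζ t) ⊠ 𝟙
        ≈⟨ ⊠-congʳ (≃-trans (T-⊠ζ (m ∷ v) p t) (tails-∷ t m v p)) ⟩
      (T (m ∷ v) p ⊠ ζ t ⊞ tails t v p ⊠ 𝕫^ m ⊠ β t) ⊠ 𝟙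
        ≈⟨ ⊠-congʳ (⊞-cong ≃-refl (⊠-congʳ (⊠-congʳ (≃-sym (T-⊠ζ v p t))))) ⟩
      (T (m ∷ v) p ⊠ ζ t ⊞ T v (p ⊠ ζ t) ⊠ 𝕫^ m ⊠ β t) ⊠ 𝟙
        ≈⟨ ring (T (m ∷ v) p ∷ ζ t ∷ T v (p ⊠ ζ t) ∷ 𝕫^ m ∷ β t ∷ [])
             ((a₀ :* a₁ :+ a₂ :* a₃ :* a₄) :* :1) (a₂ :* a₃ :* a₄ :+ a₀ :* :1 :* a₁) ⟩
      T v (p ⊠ ζ t) ⊠ 𝕫^ m ⊠ β t ⊞ T (m ∷ v) p ⊠ 𝟙 ⊠ ζ t ∎

  -- The six recursive rules of the diamond product

  module Rules (rv : List L1) (p : 𝒜) where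

    K-⊠⊞ : (rv : List L1) (q r : 𝒜) → K rv (p ⊠ (q ⊞ r)) ≃ K rv (p ⊠ q) ⊞ K rv (p ⊠ r)
    K-⊠⊞ rv = add (linear-∘ (K-linear rv) (⊠ˡ-linear p))

    K-⊠⊟ : (rv : List L1) (q r : 𝒜) → K rv (p ⊠ (q ⊟ r)) ≃ K rv (p ⊠ q) ⊟ K rv (p ⊠ r)
    K-⊠⊟ rv = sub (linear-∘ (K-linear rv) (⊠ˡ-linear p))

    yx : K (y₁ ∷ rv) (p ⊠ 𝕩) ≃ K rv (p ⊠ 𝕩) ⊠ 𝕪 fz ⊞ K (y₁ ∷ rv) p ⊠ 𝕩
    yx = ≃-trans (K-y-ζ rv p fz)
      (ring (K rv (p ⊠ 𝕩) ∷ K (y₁ ∷ rv) p ∷ 𝕩 ∷ 𝕪 fz ∷ [])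
        (a₀ :* (a₂ :+ a₃ :- a₂) :+ a₁ :* a₂) (a₀ :* a₃ :+ a₁ :* a₂))

    -- Since x = z - y acts through `K-x`, a rule for a left factor ending in x follows from the
    -- rule for one ending in y; the same holds for `xy` and `xt`.
    xx : K (x₁ ∷ rv) (p ⊠ 𝕩) ≃ K rv (p ⊠ 𝕩) ⊠ 𝕩 ⊟ K (y₁ ∷ rv) p ⊠ 𝕩
    xx = ≃-trans (K-x rv _) (≃-trans (⊟-cong ≃-refl yx)
      (ring (K rv (p ⊠ 𝕩) ∷ K (y₁ ∷ rv) p ∷ 𝕩 ∷ 𝕪 fz ∷ [])
        (a₀ :* (a₂ :+ a₃) :- (a₀ :* a₃ :+ a₁ :* a₂)) (a₀ :* a₂ :- a₁ :* a₂)))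

    K-⊠𝕪₁ : (rv : List L1) → K rv (p ⊠ 𝕪 fz) ≃ K rv p ⊠ 𝕫 ⊟ K rv (p ⊠ 𝕩)
    K-⊠𝕪₁ rv = begin
      K rv (p ⊠ 𝕪 fz)                   ≈⟨ respects (K-linear rv) (⊠-congˡ (ring (𝕩 ∷ 𝕪 fz ∷ []) a₁ (a₀ :+ a₁ :- a₀))) ⟩
      K rv (p ⊠ (𝕫 ⊟ 𝕩))                ≈⟨ K-⊠⊟ rv 𝕫 𝕩 ⟩
      K rv (p ⊠ 𝕫) ⊟ K rv (p ⊠ 𝕩)       ≈⟨ ⊟-cong (K-⊠𝕫 rv p) ≃-refl ⟩
      K rv p ⊠ 𝕫 ⊟ K rv (p ⊠ 𝕩)         ∎

    -- With y_1 = z - x on the right and x = z - y on the left, both sides are expressed by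
    -- `K rv p`, `K (y₁ ∷ rv) p` and `K rv (p ⊠ 𝕩)`, and the contributions of `K rv p` cancel.
    yy : K (y₁ ∷ rv) (p ⊠ 𝕪 fz) ≃ K rv (p ⊠ 𝕪 fz) ⊠ 𝕪 fz ⊟ K (x₁ ∷ rv) p ⊠ 𝕪 fz
    yy = begin
      K (y₁ ∷ rv) (p ⊠ 𝕪 fz)
        ≈⟨ ≃-trans (K-⊠𝕪₁ (y₁ ∷ rv)) (⊟-cong ≃-refl yx) ⟩
      K (y₁ ∷ rv) p ⊠ 𝕫 ⊟ (K rv (p ⊠ 𝕩) ⊠ 𝕪 fz ⊞ K (y₁ ∷ rv) p ⊠ 𝕩)
        ≈⟨ ring (K (y₁ ∷ rv) p ∷ K rv (p ⊠ 𝕩) ∷ K rv p ∷ 𝕩 ∷ 𝕪 fz ∷ [])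
             (a₀ :* (a₃ :+ a₄) :- (a₁ :* a₄ :+ a₀ :* a₃))
             ((a₂ :* (a₃ :+ a₄) :- a₁) :* a₄ :- (a₂ :* (a₃ :+ a₄) :- a₀) :* a₄) ⟩
      (K rv p ⊠ 𝕫 ⊟ K rv (p ⊠ 𝕩)) ⊠ 𝕪 fz ⊟ (K rv p ⊠ 𝕫 ⊟ K (y₁ ∷ rv) p) ⊠ 𝕪 fz
        ≈⟨ ≃-sym (⊟-cong (⊠-congʳ (K-⊠𝕪₁ rv)) (⊠-congʳ (K-x rv p))) ⟩
      K rv (p ⊠ 𝕪 fz) ⊠ 𝕪 fz ⊟ K (x₁ ∷ rv) p ⊠ 𝕪 fz ∎

    xy : K (x₁ ∷ rv) (p ⊠ 𝕪 fz) ≃ K rv (p ⊠ 𝕪 fz) ⊠ 𝕩 ⊞ K (x₁ ∷ rv) p ⊠ 𝕪 fz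
    xy = ≃-trans (K-x rv _) (≃-trans (⊟-cong ≃-refl yy)
      (ring (K rv (p ⊠ 𝕪 fz) ∷ K (x₁ ∷ rv) p ∷ 𝕩 ∷ 𝕪 fz ∷ [])
        (a₀ :* (a₂ :+ a₃) :- (a₀ :* a₃ :- a₁ :* a₃)) (a₀ :* a₂ :+ a₁ :* a₃)))

    -- As y_t = z_t^δ - x, this is the difference of the rule for z_t^δ, where β is y_1 - y_t, and
    -- the rule `yx`.
    yt : (t : Fin n) → K (y₁ ∷ rv) (p ⊠ 𝕪 (fs t)) ≃
      K rv (p ⊠ 𝕪 (fs t)) ⊠ 𝕪 fz ⊟ (K rv (p ⊠ 𝕩) ⊞ K rv (p ⊠ 𝕪 (fs t))) ⊠ 𝕪 (fs t)
        ⊞ K (y₁ ∷ rv) p ⊠ 𝕪 (fs t)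
    yt t = begin
      K (y₁ ∷ rv) (p ⊠ 𝕪 (fs t))
        ≈⟨ respects (K-linear (y₁ ∷ rv)) (⊠-congˡ (ring (𝕩 ∷ 𝕪 (fs t) ∷ []) a₁ (a₀ :+ a₁ :- a₀))) ⟩
      K (y₁ ∷ rv) (p ⊠ (ζ (fs t) ⊟ 𝕩))
        ≈⟨ K-⊠⊟ (y₁ ∷ rv) _ _ ⟩
      K (y₁ ∷ rv) (p ⊠ ζ (fs t)) ⊟ K (y₁ ∷ rv) (p ⊠ 𝕩)
        ≈⟨ ⊟-cong (≃-trans (K-y-ζ rv p (fs t)) (⊞-cong (⊠-congʳ (K-⊠⊞ rv 𝕩 (𝕪 (fs t)))) ≃-refl)) yx ⟩
      (K rv (p ⊠ 𝕩) ⊞ K rv (p ⊠ 𝕪 (fs t))) ⊠ β (fs t) ⊞ K (y₁ ∷ rv) p ⊠ ζ (fs t)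
        ⊟ (K rv (p ⊠ 𝕩) ⊠ 𝕪 fz ⊞ K (y₁ ∷ rv) p ⊠ 𝕩)
        ≈⟨ ring (K rv (p ⊠ 𝕩) ∷ K rv (p ⊠ 𝕪 (fs t)) ∷ K (y₁ ∷ rv) p ∷ 𝕩 ∷ 𝕪 fz ∷ 𝕪 (fs t) ∷ [])
             ((a₀ :+ a₁) :* (a₃ :+ a₄ :- (a₃ :+ a₅)) :+ a₂ :* (a₃ :+ a₅) :- (a₀ :* a₄ :+ a₂ :* a₃))
             (a₁ :* a₄ :- (a₀ :+ a₁) :* a₅ :+ a₂ :* a₅) ⟩
      K rv (p ⊠ 𝕪 (fs t)) ⊠ 𝕪 fz ⊟ (K rv (p ⊠ 𝕩) ⊞ K rv (p ⊠ 𝕪 (fs t))) ⊠ 𝕪 (fs t)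
        ⊞ K (y₁ ∷ rv) p ⊠ 𝕪 (fs t) ∎

    xt : (t : Fin n) → K (x₁ ∷ rv) (p ⊠ 𝕪 (fs t)) ≃
      K rv (p ⊠ 𝕪 (fs t)) ⊠ 𝕩 ⊞ (K rv (p ⊠ 𝕩) ⊞ K rv (p ⊠ 𝕪 (fs t))) ⊠ 𝕪 (fs t)
        ⊟ K (y₁ ∷ rv) p ⊠ 𝕪 (fs t)
    xt t = ≃-trans (K-x rv _) (≃-trans (⊟-cong ≃-refl (yt t))
      (ring (K rv (p ⊠ 𝕩) ∷ K rv (p ⊠ 𝕪 (fs t)) ∷ K (y₁ ∷ rv) p ∷ 𝕩 ∷ 𝕪 fz ∷ 𝕪 (fs t) ∷ [])
        (a₁ :* (a₃ :+ a₄) :- (a₁ :* a₄ :- (a₀ :+ a₁) :* a₅ :+ a₂ :* a₅))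
        (a₁ :* a₃ :+ (a₀ :+ a₁) :* a₅ :- a₂ :* a₅)))

  -- Initial values: ψ_s φ on words of 𝒜_1

  letter : μ → L1 → Letter n
  letter s x₁ = X
  letter s y₁ = Y s

  toℕ-∙ : (s t : μ) → toℕ (s ∙ t) ≡ (toℕ s +ℕ toℕ t) % suc n
  toℕ-∙ s t = Finₚ.toℕ-fromℕ< (m%n<n (toℕ s +ℕ toℕ t) (suc n))

  ∙-identityˡ : (s : μ) → fz ∙ s ≡ s
  ∙-identityˡ s = Finₚ.toℕ-injective (trans (toℕ-∙ fz s) (m<n⇒m%n≡m (Finₚ.toℕ<n s)))

  ∙-identityʳ : (s : μ) → s ∙ fz ≡ s
  ∙-identityʳ s = Finₚ.toℕ-injective (trans (toℕ-∙ s fz)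
    (trans (cong (_% suc n) (ℕₚ.+-identityʳ (toℕ s))) (m<n⇒m%n≡m (Finₚ.toℕ<n s))))

  iotaW-letter : (s : μ) (w : Word L1) → iotaW s (map (letter fz) w) ≡ map (letter s) w
  iotaW-letter s [] = refl
  iotaW-letter s (x₁ ∷ w) = cong (X ∷_) (iotaW-letter s w)
  iotaW-letter s (y₁ ∷ w) rewrite ∙-identityʳ s = cong (Y s ∷_) (iotaW-letter s w)

  -- All letters y have index 1, so M_s sets the first index to s and every later partial product
  -- formed by 𝓘 is again s.
  iotaW-MW-letter : (s : μ) (w : Word L1) → iotaW one (MW s (map (letter fz) w)) ≡ map (letter s) w
  iotaW-MW-letter s [] = refl
  iotaW-MW-letter s (x₁ ∷ w) = cong (X ∷_) (iotaW-MW-letter s w)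
  iotaW-MW-letter s (y₁ ∷ w) rewrite ∙-identityʳ s | ∙-identityˡ s = cong (Y s ∷_) (iotaW-letter s w)

  subst₁ : μ → 𝒜₁ → 𝒜
  subst₁ s = ext (λ w → mon (map (letter s) w))

  subst₁-⊠ : (s : μ) (l : L1) (q : 𝒜₁) → subst₁ s (mon (l ∷ []) ⊠ q) ≃ mon (letter s l ∷ []) ⊠ subst₁ s q
  subst₁-⊠ s l = linear-unique (linear-∘ (ext-linear _) (⊠ˡ-linear _)) (linear-∘ (⊠ˡ-linear _) (ext-linear _))
    (λ w → ≃-trans (respects (ext-linear _) (mon-⊠ (l ∷ []) w)) (≃-trans (ext-mon _ (l ∷ w))
      (≃-sym (≃-trans (⊠-congˡ (ext-mon _ w)) (mon-⊠ _ _)))))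

  emb≃ : (p : 𝒜₁) → emb p ≃ subst₁ fz p
  emb≃ p = linExt≃ (λ u → ≃-trans wd≃
    (≃-reflexive (cong mon (Listₚ.map-cong (λ { x₁ → refl ; y₁ → refl }) u)))) (≃-refl {p = p})

  𝓘-linear : Linear 𝓘
  𝓘-linear = linExt-linear (λ w → wd (iotaW one w))

  M-linear : (s : μ) → Linear (M s)
  M-linear s = linExt-linear (λ w → wd (MW s w))

  φ-linear : Linear φ
  φ-linear = linExt-linear _

  φ-mon : (w : Word (Letter n)) → φ (mon w) ≃ φW w
  φ-mon w = ≃-trans (linExt≃ (λ _ → ≃-refl) ≃-refl) (ext-mon φW w)

  φ-letter-⊠ : (l : Letter n) (q : 𝒜) → φ (mon (l ∷ []) ⊠ q) ≃ φL l ⊠ φ q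
  φ-letter-⊠ l = linear-unique (linear-∘ φ-linear (⊠ˡ-linear _)) (linear-∘ (⊠ˡ-linear _) φ-linear)
    (λ w → ≃-trans (respects φ-linear (mon-⊠ (l ∷ []) w)) (≃-trans (φ-mon (l ∷ w))
      (≃-trans (⊗≃ ≃-refl ≃-refl) (⊠-congˡ (≃-sym (φ-mon w))))))

  φL-Y : (s : μ) → φL (Y s) ≃ ζ s ⊟ 𝕫
  φL-Y fz = ≃-trans (⊝≃ (≃-trans (·≃ 0ℚ wd≃) (0• (𝕪 fz))) wd≃)
    (ring (𝕩 ∷ 𝕪 fz ∷ []) (:0 :- a₁) (a₀ :- (a₀ :+ a₁)))
  φL-Y (fs t) = ≃-trans (⊝≃ (≃-trans (·≃ 1ℚ wd≃) (1• (𝕪 (fs t)))) wd≃)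
    (ring (𝕩 ∷ 𝕪 fz ∷ 𝕪 (fs t) ∷ []) (a₂ :- a₁) (a₀ :+ a₂ :- (a₀ :+ a₁)))

  -- φ restricted to 𝒜_1.
  φ₁ : Word L1 → 𝒜₁
  φ₁ [] = 𝟙
  φ₁ (x₁ ∷ w) = mon (x₁ ∷ []) ⊠ φ₁ w ⊞ mon (y₁ ∷ []) ⊠ φ₁ w
  φ₁ (y₁ ∷ w) = 𝟘 ⊟ mon (y₁ ∷ []) ⊠ φ₁ w

  φ-emb : (w : Word L1) → φ (mon (map (letter fz) w)) ≃ subst₁ fz (φ₁ w)
  φ-emb [] = ≃-trans (φ-mon []) (≃-trans wd≃ (≃-sym (≃-trans (respects (ext-linear _) 𝟙≃mon) (ext-mon _ []))))
  φ-emb (x₁ ∷ w) = begin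
    φ (mon (X ∷ map (letter fz) w))
      ≈⟨ respects φ-linear (≃-sym (mon-⊠ _ _)) ⟩
    φ (mon (X ∷ []) ⊠ mon (map (letter fz) w))
      ≈⟨ φ-letter-⊠ X _ ⟩
    z ⊠ φ (mon (map (letter fz) w))
      ≈⟨ ⊠-cong z≃ (φ-emb w) ⟩
    (𝕩 ⊞ 𝕪 fz) ⊠ subst₁ fz (φ₁ w)
      ≈⟨ add (⊠ʳ-linear _) _ _ ⟩
    𝕩 ⊠ subst₁ fz (φ₁ w) ⊞ 𝕪 fz ⊠ subst₁ fz (φ₁ w)
      ≈⟨ ≃-sym (≃-trans (add (ext-linear _) _ _) (⊞-cong (subst₁-⊠ fz x₁ _) (subst₁-⊠ fz y₁ _))) ⟩
    subst₁ fz (φ₁ (x₁ ∷ w)) ∎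
  φ-emb (y₁ ∷ w) = begin
    φ (mon (Y fz ∷ map (letter fz) w))
      ≈⟨ respects φ-linear (≃-sym (mon-⊠ _ _)) ⟩
    φ (mon (Y fz ∷ []) ⊠ mon (map (letter fz) w))
      ≈⟨ φ-letter-⊠ (Y fz) _ ⟩
    φL (Y fz) ⊠ φ (mon (map (letter fz) w))
      ≈⟨ ⊠-cong (φL-Y fz) (φ-emb w) ⟩
    (𝕩 ⊟ (𝕩 ⊞ 𝕪 fz)) ⊠ subst₁ fz (φ₁ w)
      ≈⟨ ring (𝕩 ∷ 𝕪 fz ∷ subst₁ fz (φ₁ w) ∷ []) ((a₀ :- (a₀ :+ a₁)) :* a₂) (:0 :- a₁ :* a₂) ⟩
    𝟘 ⊟ 𝕪 fz ⊠ subst₁ fz (φ₁ w)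
      ≈⟨ ≃-sym (≃-trans (sub (ext-linear _) _ _) (⊟-cong (zer (ext-linear _)) (subst₁-⊠ fz y₁ _))) ⟩
    subst₁ fz (φ₁ (y₁ ∷ w)) ∎

  𝓘M-subst₁ : (s : μ) (p : 𝒜₁) → 𝓘 (M s (subst₁ fz p)) ≃ subst₁ s p
  𝓘M-subst₁ s = linear-unique
    (linear-∘ 𝓘-linear (linear-∘ (M-linear s) (ext-linear _))) (ext-linear _)
    (λ w → begin
      𝓘 (M s (subst₁ fz (mon w)))
        ≈⟨ linExt≃ (λ _ → wd≃) (linExt≃ (λ _ → wd≃) (ext-mon _ w)) ⟩
      ext (λ u → mon (iotaW one u)) (ext (λ u → mon (MW s u)) (mon (map (letter fz) w)))
        ≈⟨ respects (ext-linear _) (ext-mon _ _) ⟩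
      ext (λ u → mon (iotaW one u)) (mon (MW s (map (letter fz) w)))
        ≈⟨ ext-mon _ _ ⟩
      mon (iotaW one (MW s (map (letter fz) w)))
        ≈⟨ ≃-reflexive (cong mon (iotaW-MW-letter s w)) ⟩
      mon (map (letter s) w)
        ≈⟨ ≃-sym (ext-mon _ w) ⟩
      subst₁ s (mon w) ∎)

  -- The homomorphism D_s in the generators x and y, where x = z - y is sent to z - β = z_s^δ.
  homD₁ : μ → L1 → 𝒜
  homD₁ s x₁ = ζ s
  homD₁ s y₁ = β s

  homD : μ → Word L1 → 𝒜
  homD s [] = 𝟙
  homD s (l ∷ w) = homD₁ s l ⊠ homD s w

  homD-∷ʳ : (s : μ) (w : Word L1) (l : L1) → homD s (w ++ l ∷ []) ≃ homD s w ⊠ homD₁ s l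
  homD-∷ʳ s [] l = ring (homD₁ s l ∷ []) (a₀ :* :1) (:1 :* a₀)
  homD-∷ʳ s (k ∷ w) l = ≃-trans (⊠-congˡ (homD-∷ʳ s w l)) (≃-sym (⊠-assoc _ _ _))

  φ-letter-subst₁ : (s : μ) (l : L1) (q : 𝒜₁) →
    φ (subst₁ s (mon (l ∷ []) ⊠ q)) ≃ φL (letter s l) ⊠ φ (subst₁ s q)
  φ-letter-subst₁ s l q = ≃-trans (respects φ-linear (subst₁-⊠ s l q)) (φ-letter-⊠ (letter s l) _)

  -- The inner map sends x to x + y and y to -y; the outer φ is applied after y has become y_s, with
  -- φ(y_s) = z_s^δ - z. Hence x goes to z + (z_s^δ - z) and y to z - z_s^δ, so ψ_s φ is D_s on 𝒜_1.
  φ-subst₁-φ₁ : (s : μ) (w : Word L1) → φ (subst₁ s (φ₁ w)) ≃ homD s w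
  φ-subst₁-φ₁ s [] = ≃-trans (respects φ-linear (≃-trans (respects (ext-linear _) 𝟙≃mon) (ext-mon _ [])))
    (≃-trans (φ-mon []) 1P≃)
  φ-subst₁-φ₁ s (x₁ ∷ w) = begin
    φ (subst₁ s (φ₁ (x₁ ∷ w)))
      ≈⟨ add (linear-∘ φ-linear (ext-linear _)) _ _ ⟩
    φ (subst₁ s (mon (x₁ ∷ []) ⊠ φ₁ w)) ⊞ φ (subst₁ s (mon (y₁ ∷ []) ⊠ φ₁ w))
      ≈⟨ ⊞-cong (φ-letter-subst₁ s x₁ _) (φ-letter-subst₁ s y₁ _) ⟩
    z ⊠ φ (subst₁ s (φ₁ w)) ⊞ φL (Y s) ⊠ φ (subst₁ s (φ₁ w))
      ≈⟨ ⊞-cong (⊠-cong z≃ (φ-subst₁-φ₁ s w)) (⊠-cong (φL-Y s) (φ-subst₁-φ₁ s w)) ⟩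
    𝕫 ⊠ homD s w ⊞ (ζ s ⊟ 𝕫) ⊠ homD s w
      ≈⟨ ring (𝕫 ∷ ζ s ∷ homD s w ∷ []) (a₀ :* a₂ :+ (a₁ :- a₀) :* a₂) (a₁ :* a₂) ⟩
    homD s (x₁ ∷ w) ∎
  φ-subst₁-φ₁ s (y₁ ∷ w) = begin
    φ (subst₁ s (φ₁ (y₁ ∷ w)))
      ≈⟨ sub (linear-∘ φ-linear (ext-linear _)) _ _ ⟩
    φ (subst₁ s 𝟘) ⊟ φ (subst₁ s (mon (y₁ ∷ []) ⊠ φ₁ w))
      ≈⟨ ⊟-cong (zer (linear-∘ φ-linear (ext-linear _))) (φ-letter-subst₁ s y₁ _) ⟩
    𝟘 ⊟ φL (Y s) ⊠ φ (subst₁ s (φ₁ w))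
      ≈⟨ ⊟-cong ≃-refl (⊠-cong (φL-Y s) (φ-subst₁-φ₁ s w)) ⟩
    𝟘 ⊟ (ζ s ⊟ 𝕫) ⊠ homD s w
      ≈⟨ ring (𝕫 ∷ ζ s ∷ homD s w ∷ []) (:0 :- (a₁ :- a₀) :* a₂) ((a₀ :- a₁) :* a₂) ⟩
    homD s (y₁ ∷ w) ∎

  ψφ-emb : (s : μ) (w : Word L1) → ψ s (φ (emb (wd w))) ≃ homD s w
  ψφ-emb s w = begin
    φ (𝓘 (M s (φ (emb (wd w)))))
      ≈⟨ respects φ𝓘M (respects φ-linear
           (≃-trans (emb≃ (wd w)) (≃-trans (respects (ext-linear _) wd≃) (ext-mon _ w)))) ⟩
    φ (𝓘 (M s (φ (mon (map (letter fz) w)))))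
      ≈⟨ respects φ𝓘M (φ-emb w) ⟩
    φ (𝓘 (M s (subst₁ fz (φ₁ w))))
      ≈⟨ respects φ-linear (𝓘M-subst₁ s (φ₁ w)) ⟩
    φ (subst₁ s (φ₁ w))
      ≈⟨ φ-subst₁-φ₁ s w ⟩
    homD s w ∎
    where
    φ𝓘M : Linear (λ p → φ (𝓘 (M s p)))
    φ𝓘M = linear-∘ φ-linear (linear-∘ 𝓘-linear (M-linear s))

  -- D_s fixes z, so T_v(z_s^δ) z^m = z_s^δ D_s(v z^m). By `ψφ-emb` this is z_s^δ times the initial
  -- value v ◇_s 1.
  K-ζ : (s : μ) (rv : List L1) → K rv (ζ s) ≃ ζ s ⊠ homD s (reverse rv)
  K-ζ s [] = ≃-trans (⊠-identityʳ _) (≃-trans (T-[] _) (≃-sym (⊠-identityʳ _)))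
  K-ζ s (l ∷ rv) = ≃-trans (step l) (≃-trans (⊠-assoc _ _ _)
    (⊠-congˡ (≃-sym (≃-trans (≃-reflexive (cong (homD s) (Listₚ.unfold-reverse l rv))) (homD-∷ʳ s (reverse rv) l)))))
    where
    step-y : K (y₁ ∷ rv) (ζ s) ≃ ζ s ⊠ homD s (reverse rv) ⊠ β s
    step-y = begin
      expandWord rv (λ m v → T (m ∷ v) (ζ s) ⊠ 𝟙)
        ≈⟨ expandWord-cong rv (λ m v → ≃-trans (⊠-congʳ (T-ζ (m ∷ v) s))
             (≃-trans (ring (ζ s ∷ D s v ∷ 𝕫^ m ∷ β s ∷ []) (a₀ :* (a₁ :* a₂ :* a₃) :* :1) (a₀ :* a₁ :* a₂ :* a₃))
               (⊠-congʳ (⊠-congʳ (≃-sym (T-ζ v s)))))) ⟩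
      expandWord rv (λ m v → T v (ζ s) ⊠ 𝕫^ m ⊠ β s)
        ≈⟨ ≃-sym (linear-expandWord (⊠ʳ-linear (β s)) rv _) ⟩
      K rv (ζ s) ⊠ β s
        ≈⟨ ⊠-congʳ (K-ζ s rv) ⟩
      ζ s ⊠ homD s (reverse rv) ⊠ β s ∎
    step : ∀ l → K (l ∷ rv) (ζ s) ≃ ζ s ⊠ homD s (reverse rv) ⊠ homD₁ s l
    step y₁ = step-y
    step x₁ = ≃-trans (K-x rv _) (≃-trans (⊟-cong (⊠-congʳ (K-ζ s rv)) step-y)
      (ring (ζ s ⊠ homD s (reverse rv) ∷ 𝕫 ∷ ζ s ∷ []) (a₀ :* a₁ :- a₀ :* (a₁ :- a₂)) (a₀ :* a₂)))

  -- The product is built from the left so that the last letter is exposed by computation, in the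
  -- form in which `Rules` expects it.
  zδTimes : μ → List (Letter n) → 𝒜
  zδTimes s [] = ζ s
  zδTimes s (l ∷ rw) = zδTimes s rw ⊠ mon (l ∷ [])

  zδTimes≃ : (s : μ) (rw : List (Letter n)) → zδTimes s rw ≃ ζ s ⊠ mon (reverse rw)
  zδTimes≃ s [] = ≃-sym (≃-trans (⊠-congˡ (≃-sym 𝟙≃mon)) (⊠-identityʳ _))
  zδTimes≃ s (l ∷ rw) = ≃-trans (⊠-congʳ (zδTimes≃ s rw)) (≃-trans (⊠-assoc _ _ _) (⊠-congˡ
    (≃-trans (mon-⊠ _ _) (≃-reflexive (cong mon (sym (Listₚ.unfold-reverse l rw)))))))

  ◃≃ : {p p′ : 𝒜} (l : Letter n) → p ≃ p′ → p ◃ l ≃ p′ ⊠ mon (l ∷ [])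
  ◃≃ l e = ⊗≃ e wd≃

  -- The rules multiply only on the right, hence are compatible with the left factor z_s^δ and
  -- become those in `Rules`. Each call removes one letter in total, also when a last y_t is
  -- replaced by x, so the length bound passes to it.
  diaF≃ : (k : ℕ) (s : μ) (rv : List L1) (rw : List (Letter n)) → length rv +ℕ length rw ≤ k →
    ζ s ⊠ diaF k s rv rw ≃ K rv (zδTimes s rw)
  diaF≃ k s [] rw le = begin
    ζ s ⊠ wd (reverse rw)     ≈⟨ ⊠-congˡ wd≃ ⟩
    ζ s ⊠ mon (reverse rw)    ≈⟨ ≃-sym (zδTimes≃ s rw) ⟩
    zδTimes s rw                ≈⟨ ≃-sym (≃-trans (⊠-identityʳ _) (T-[] _)) ⟩
    K [] (zδTimes s rw)         ∎
  diaF≃ k s (l ∷ rv) [] le = ≃-trans (⊠-congˡ (ψφ-emb s (reverse (l ∷ rv)))) (≃-sym (K-ζ s (l ∷ rv)))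
  diaF≃ (suc k) s (l ∷ rv) (m ∷ rw) (s≤s le) = rule l m
    where
    p = zδTimes s rw
    open Rules rv p

    keep-w : ∀ m → ζ s ⊠ diaF k s rv (m ∷ rw) ≃ K rv (p ⊠ mon (m ∷ []))
    keep-w m = diaF≃ k s rv (m ∷ rw) le

    keep-v : ∀ l → ζ s ⊠ diaF k s (l ∷ rv) rw ≃ K (l ∷ rv) p
    keep-v l = diaF≃ k s (l ∷ rv) rw (subst (_≤ k) (ℕₚ.+-suc (length rv) (length rw)) le)

    two⊟ : ∀ q r l m → ζ s ⊠ (q ◃ l ⊝ r ◃ m) ≃ ζ s ⊠ q ⊠ mon (l ∷ []) ⊟ ζ s ⊠ r ⊠ mon (m ∷ [])
    two⊟ q r l m = ≃-trans (⊠-congˡ (⊝≃ (◃≃ l ≃-refl) (◃≃ m ≃-refl)))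
      (ring (ζ s ∷ q ∷ r ∷ mon (l ∷ []) ∷ mon (m ∷ []) ∷ [])
        (a₀ :* (a₁ :* a₃ :- a₂ :* a₄)) (a₀ :* a₁ :* a₃ :- a₀ :* a₂ :* a₄))

    two⊞ : ∀ q r l m → ζ s ⊠ (q ◃ l ⊕ r ◃ m) ≃ ζ s ⊠ q ⊠ mon (l ∷ []) ⊞ ζ s ⊠ r ⊠ mon (m ∷ [])
    two⊞ q r l m = ≃-trans (⊠-congˡ (⊕≃ (◃≃ l ≃-refl) (◃≃ m ≃-refl)))
      (ring (ζ s ∷ q ∷ r ∷ mon (l ∷ []) ∷ mon (m ∷ []) ∷ [])
        (a₀ :* (a₁ :* a₃ :+ a₂ :* a₄)) (a₀ :* a₁ :* a₃ :+ a₀ :* a₂ :* a₄))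

    rule : ∀ l m → ζ s ⊠ diaF (suc k) s (l ∷ rv) (m ∷ rw) ≃ K (l ∷ rv) (p ⊠ mon (m ∷ []))
    rule x₁ X = ≃-trans (two⊟ _ _ X X)
      (≃-trans (⊟-cong (⊠-congʳ (keep-w X)) (⊠-congʳ (keep-v y₁))) (≃-sym xx))
    rule y₁ X = ≃-trans (two⊞ _ _ (Y fz) X)
      (≃-trans (⊞-cong (⊠-congʳ (keep-w X)) (⊠-congʳ (keep-v y₁))) (≃-sym yx))
    rule x₁ (Y fz) = ≃-trans (two⊞ _ _ X (Y fz))
      (≃-trans (⊞-cong (⊠-congʳ (keep-w (Y fz))) (⊠-congʳ (keep-v x₁))) (≃-sym xy))
    rule y₁ (Y fz) = ≃-trans (two⊟ _ _ (Y fz) (Y fz))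
      (≃-trans (⊟-cong (⊠-congʳ (keep-w (Y fz))) (⊠-congʳ (keep-v x₁))) (≃-sym yy))
    rule x₁ (Y (fs t)) = ≃-trans
      (⊠-congˡ (⊝≃ (⊕≃ (◃≃ X ≃-refl) (◃≃ (Y (fs t)) (⊕≃ ≃-refl ≃-refl))) (◃≃ (Y (fs t)) ≃-refl)))
      (≃-trans (ring (ζ s ∷ diaF k s rv (Y (fs t) ∷ rw) ∷ diaF k s rv (X ∷ rw) ∷ diaF k s (y₁ ∷ rv) rw ∷ 𝕩 ∷ 𝕪 (fs t) ∷ [])
        (a₀ :* (a₁ :* a₄ :+ (a₂ :+ a₁) :* a₅ :- a₃ :* a₅))
        (a₀ :* a₁ :* a₄ :+ (a₀ :* a₂ :+ a₀ :* a₁) :* a₅ :- a₀ :* a₃ :* a₅))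
      (≃-trans (⊟-cong (⊞-cong (⊠-congʳ (keep-w (Y (fs t)))) (⊠-congʳ (⊞-cong (keep-w X) (keep-w (Y (fs t))))))
        (⊠-congʳ (keep-v y₁))) (≃-sym (xt t))))
    rule y₁ (Y (fs t)) = ≃-trans
      (⊠-congˡ (⊕≃ (⊝≃ (◃≃ (Y fz) ≃-refl) (◃≃ (Y (fs t)) (⊕≃ ≃-refl ≃-refl))) (◃≃ (Y (fs t)) ≃-refl)))
      (≃-trans (ring (ζ s ∷ diaF k s rv (Y (fs t) ∷ rw) ∷ diaF k s rv (X ∷ rw) ∷ diaF k s (y₁ ∷ rv) rw ∷ 𝕪 fz ∷ 𝕪 (fs t) ∷ [])
        (a₀ :* (a₁ :* a₄ :- (a₂ :+ a₁) :* a₅ :+ a₃ :* a₅))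
        (a₀ :* a₁ :* a₄ :- (a₀ :* a₂ :+ a₀ :* a₁) :* a₅ :+ a₀ :* a₃ :* a₅))
      (≃-trans (⊞-cong (⊟-cong (⊠-congʳ (keep-w (Y (fs t)))) (⊠-congʳ (⊞-cong (keep-w X) (keep-w (Y (fs t))))))
        (⊠-congʳ (keep-v y₁))) (≃-sym (yt t))))

  diaW≃ : (s : μ) (v : Word L1) (w : Word (Letter n)) →
    ζ s ⊠ diaW s v w ≃ K (reverse v) (ζ s ⊠ mon w)
  diaW≃ s v w = ≃-trans
    (diaF≃ _ s (reverse v) (reverse w)
      (ℕₚ.≤-reflexive (cong₂ _+ℕ_ (Listₚ.length-reverse v) (Listₚ.length-reverse w))))
    (respects (K-linear (reverse v)) (≃-trans (zδTimes≃ s (reverse w))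
      (≃-reflexive (cong (λ u → ζ s ⊠ mon u) (Listₚ.reverse-involutive w)))))

  zδ-◇ : (G : 𝒜₁) (s : μ) (w : 𝒜) → zδ s ⊗ (G ◇[ s ] w) ≃ ext (λ v → K (reverse v) (ζ s ⊠ w)) G
  zδ-◇ G s w = begin
    zδ s ⊗ (G ◇[ s ] w)
      ≈⟨ ⊗≃ (zδ≃ s) (linExt≃ (λ v → linExt≃ (λ u → ≃-refl) ≃-refl) ≃-refl) ⟩
    ζ s ⊠ ext (λ v → ext (diaW s v) w) G
      ≈⟨ linear-ext (⊠ˡ-linear (ζ s)) _ G ⟩
    ext (λ v → ζ s ⊠ ext (diaW s v) w) G
      ≈⟨ ext-cong G (λ v → linear-ext (⊠ˡ-linear (ζ s)) _ w) ⟩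
    ext (λ v → ext (λ u → ζ s ⊠ diaW s v u) w) G
      ≈⟨ ext-cong G (λ v → ext-cong w (λ u → diaW≃ s v u)) ⟩
    ext (λ v → ext (λ u → K (reverse v) (ζ s ⊠ mon u)) w) G
      ≈⟨ ext-cong G (λ v → ≃-sym (linear-≃-ext (linear-∘ (K-linear (reverse v)) (⊠ˡ-linear (ζ s))) w)) ⟩
    ext (λ v → K (reverse v) (ζ s ⊠ w)) G ∎

-- The elements G_f

module CoeffEv {A : Set} (_≟_ : (u v : Word A) → Dec (u ≡ v)) where
  open Coeff _≟_

  indicator : Word A → Word A → ℚ
  indicator w u with u ≟ w
  ... | yes _ = 1ℚ
  ... | no _ = 0ℚ

  indicator-≢ : {u w : Word A} → u ≢ w → indicator w u ≡ 0ℚ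
  indicator-≢ {u} {w} u≢w with u ≟ w
  ... | yes u≡w = contradiction u≡w u≢w
  ... | no _ = refl

  coeff-ev : (p : Poly A) (w : Word A) → coeff p w ≡ ev p (indicator w)
  coeff-ev [] w = refl
  coeff-ev ((c , u) ∷ p) w with u ≟ w
  ... | yes _ = cong₂ _+_ (sym (*-identityʳ c)) (coeff-ev p w)
  ... | no _ = trans (coeff-ev p w) (sym (trans (cong (_+ ev p (indicator w)) (*-zeroʳ c)) (+-identityˡ _)))

  -- A coefficient is one particular linear functional, evaluation against an indicator.
  ≃⇒≈ : {p q : Poly A} → p ≃ q → p ≈ q
  ≃⇒≈ {p} {q} e w = trans (coeff-ev p w) (trans (at e _) (sym (coeff-ev q w)))

indicator-map : (_≟A_ : (u v : Word A) → Dec (u ≡ v)) (_≟B_ : (u v : Word B) → Dec (u ≡ v))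
  (f : Word A → Word B) → (∀ {u v} → f u ≡ f v → u ≡ v) → (w u : Word A) →
  CoeffEv.indicator _≟B_ (f w) (f u) ≡ CoeffEv.indicator _≟A_ w u
indicator-map _≟A_ _≟B_ f inj w u with f u ≟B f w | u ≟A w
... | yes _ | yes _ = refl
... | no _ | no _ = refl
... | yes e | no u≢w = contradiction (inj e) u≢w
... | no fu≢fw | yes e = contradiction (cong f e) fu≢fw

module C₁ = CoeffEv (≟W _≟1_)

z₁ : Poly L1
z₁ = mon (x₁ ∷ []) ⊞ mon (y₁ ∷ [])

z₁^ : ℕ → Poly L1
z₁^ zero = 𝟙
z₁^ (suc k) = z₁^ k ⊠ z₁

fromComp : Comp → Poly L1
fromComp [] = 𝟙
fromComp (k ∷ v) = fromComp v ⊠ z₁^ k ⊠ mon (y₁ ∷ [])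

expandPoly : (ℕ → Comp → Poly B) → Poly L1 → Poly B
expandPoly G = ext (λ r → expandWord (reverse r) G)

expandPoly-∷ʳ : (G : ℕ → Comp → Poly B) (p : Poly L1) (l : L1) →
  expandPoly G (p ⊠ mon (l ∷ [])) ≃ ext (λ r → expandWord (l ∷ reverse r) G) p
expandPoly-∷ʳ G p l = linear-unique (linear-∘ (ext-linear _) (⊠ʳ-linear _)) (ext-linear _)
  (λ w → begin
    expandPoly G (mon w ⊠ mon (l ∷ []))   ≈⟨ respects (ext-linear _) (mon-⊠ w _) ⟩
    expandPoly G (mon (w ++ l ∷ []))      ≈⟨ ext-mon _ _ ⟩
    expandWord (reverse (w ++ l ∷ [])) G        ≈⟨ ≃-reflexive (cong (λ r → expandWord r G) (Listₚ.reverse-++ w (l ∷ []))) ⟩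
    expandWord (l ∷ reverse w) G                ≈⟨ ≃-sym (ext-mon _ w) ⟩
    ext (λ r → expandWord (l ∷ reverse r) G) (mon w) ∎) p
  where open ≃-Reasoning

-- The part - y in the expansion x = z - y cancels against the summand y of z = x + y, leaving only
-- a higher power of z.
expandPoly-z₁ : (G : ℕ → Comp → Poly B) (p : Poly L1) →
  expandPoly G (p ⊠ z₁) ≃ expandPoly (λ m v → G (suc m) v) p
expandPoly-z₁ G p = begin
  expandPoly G (p ⊠ z₁)
    ≈⟨ add (linear-∘ (ext-linear _) (⊠ˡ-linear p)) _ _ ⟩
  expandPoly G (p ⊠ mon (x₁ ∷ [])) ⊞ expandPoly G (p ⊠ mon (y₁ ∷ []))
    ≈⟨ ⊞-cong (≃-trans (expandPoly-∷ʳ G p x₁) (ext-⊟ _ _ p)) (expandPoly-∷ʳ G p y₁) ⟩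
  expandPoly (λ m v → G (suc m) v) p ⊟ P ⊞ P
    ≈⟨ ring (expandPoly (λ m v → G (suc m) v) p ∷ P ∷ []) (a₀ :- a₁ :+ a₁) a₀ ⟩
  expandPoly (λ m v → G (suc m) v) p ∎
  where
  open ≃-Reasoning
  P = ext (λ r → expandWord (y₁ ∷ reverse r) G) p

-- The expansion recovers the composition: each factor z raises the exponent by one, and a following
-- y stores the exponent as a new letter and resets it to 0.
expandPoly-fromComp : (G : ℕ → Comp → Poly B) (v : Comp) (k : ℕ) → expandPoly G (fromComp v ⊠ z₁^ k) ≃ G k v
expandPoly-fromComp₀ : (G : ℕ → Comp → Poly B) (v : Comp) → expandPoly G (fromComp v) ≃ G 0 v
expandPoly-fromComp G v zero = ≃-trans (respects (ext-linear _) (⊠-identityʳ _)) (expandPoly-fromComp₀ G v)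
expandPoly-fromComp G v (suc k) = ≃-trans (respects (ext-linear _) (≃-sym (⊠-assoc _ _ _)))
  (≃-trans (expandPoly-z₁ G _) (expandPoly-fromComp _ v k))
expandPoly-fromComp₀ G [] = ≃-trans (respects (ext-linear _) 𝟙≃mon) (ext-mon _ [])
expandPoly-fromComp₀ G (k ∷ v) = ≃-trans (expandPoly-∷ʳ G _ y₁) (expandPoly-fromComp _ v k)

fromComp-no-x : (v : Comp) (u : Word L1) → ev (fromComp v) (C₁.indicator (u ++ x₁ ∷ [])) ≡ 0ℚ
fromComp-no-x [] u = trans (ev-𝟙 _) (C₁.indicator-≢ ([]≢ u))
  where
  []≢ : (u : Word L1) → [] ≢ u ++ x₁ ∷ []
  []≢ [] ()
  []≢ (_ ∷ _) ()
fromComp-no-x (k ∷ v) u = begin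
  ev (p ⊠ mon (y₁ ∷ [])) ind                          ≡⟨ ev-⊠ p _ ind ⟩
  ev p (λ r → ev (mon (y₁ ∷ [])) (λ t → ind (r ++ t)))
    ≡⟨ ev-cong p (λ r → trans (ev-mon _ _) (C₁.indicator-≢ (λ e → contradiction (Listₚ.∷ʳ-injectiveʳ r u e) λ ()))) ⟩
  ev p (λ _ → 0ℚ)                                     ≡⟨ ev-0 p ⟩
  0ℚ                                                  ∎
  where
  open ≡-Reasoning
  p = fromComp v ⊠ z₁^ k
  ind = C₁.indicator (u ++ x₁ ∷ [])

module Main (n : ℕ) where
  open Setup n
  open TreeMaps n
  open Action n
  open TreeAction n
  open Diamond n
  module Cₙ = CoeffEv {Letter n} (≟W _≟L_)

  fromComp-InA11 : (E : Poly ℕ) → InA11 (ext fromComp E)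
  fromComp-InA11 E u = trans (C₁.coeff-ev (ext fromComp E) _) (trans (ev-ext fromComp E _)
    (trans (ev-cong E (λ v → fromComp-no-x v u)) (ev-0 E)))

  zδ-fromComp-◇ : (E : Poly ℕ) (s : μ) (w : 𝒜) →
    zδ s ⊗ (ext fromComp E ◇[ s ] w) ≃ ext (λ v → T v (ζ s ⊠ w)) E
  zδ-fromComp-◇ E s w = begin
    zδ s ⊗ (ext fromComp E ◇[ s ] w)                        ≈⟨ zδ-◇ (ext fromComp E) s w ⟩
    expandPoly (λ m v → T v q ⊠ 𝕫^ m) (ext fromComp E)       ≈⟨ ext-ext _ fromComp E ⟩
    ext (λ v → expandPoly (λ m v → T v q ⊠ 𝕫^ m) (fromComp v)) E
      -- An element of 𝒜_1^1 leaves no final power of z, so the exponent is 0.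
      ≈⟨ ext-cong E (λ v → ≃-trans (expandPoly-fromComp₀ _ v) (⊠-identityʳ _)) ⟩
    ext (λ v → T v q) E                                 ∎
    where
    open ≃-Reasoning
    q = ζ s ⊠ w

  treeMapH-zδ : (h : ℋ) (s : μ) (w : 𝒜) →
    treeMapH h (zδ s ⊗ w) ≃ zδ s ⊗ (ext fromComp (compH h) ◇[ s ] w)
  treeMapH-zδ h s w = ≃-trans (treeMapH≃ h (zδ s ⊗ w)) (≃-trans
    (ext-cong (compH h) (λ v → respects (T-linear v) (⊗≃ (zδ≃ s) ≃-refl)))
    (≃-sym (zδ-fromComp-◇ (compH h) s w)))

  -- Uniqueness, from s = 1 and w = 1

  homD-one : (w : Word L1) → homD fz w ≃ mon (map (letter fz) w)
  homD-one [] = 𝟙≃mon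
  homD-one (x₁ ∷ w) = ≃-trans (⊠-congˡ (homD-one w)) (mon-⊠ _ _)
  homD-one (y₁ ∷ w) = ≃-trans
    (⊠-cong (ring (𝕩 ∷ 𝕪 fz ∷ []) (a₀ :+ a₁ :- a₀) a₁) (homD-one w)) (mon-⊠ _ _)

  -- At s = 1 one has z_s^δ = x and β = y_1, so D_1 is the inclusion of 𝒜_1 in 𝒜_r.
  zδ-◇-1P : (G : 𝒜₁) → zδ one ⊗ (G ◇[ one ] 1P) ≃ ext (λ v → mon (X ∷ map (letter fz) v)) G
  zδ-◇-1P G = ≃-trans (zδ-◇ G one 1P) (ext-cong G (λ v → begin
    K (reverse v) (𝕩 ⊠ 1P)         ≈⟨ respects (K-linear (reverse v)) (≃-trans (⊠-congˡ 1P≃) (⊠-identityʳ _)) ⟩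
    K (reverse v) 𝕩                ≈⟨ K-ζ fz (reverse v) ⟩
    𝕩 ⊠ homD fz (reverse (reverse v)) ≈⟨ ⊠-congˡ (≃-trans (≃-reflexive (cong (homD fz) (Listₚ.reverse-involutive v))) (homD-one v)) ⟩
    𝕩 ⊠ mon (map (letter fz) v)    ≈⟨ mon-⊠ _ _ ⟩
    mon (X ∷ map (letter fz) v)    ∎))
    where open ≃-Reasoning

  X∷letters-injective : {u v : Word L1} →
    _≡_ {A = Word (Letter n)} (X ∷ map (letter fz) u) (X ∷ map (letter fz) v) → u ≡ v
  X∷letters-injective e = Listₚ.map-injective letter-injective (Listₚ.∷-injectiveʳ e)
    where
    letter-injective : {a b : L1} → letter fz a ≡ letter fz b → a ≡ b
    letter-injective {x₁} {x₁} _ = refl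
    letter-injective {y₁} {y₁} _ = refl

  -- Prefixing x to the included word is injective on words, so no two coefficients of `G` are
  -- merged.
  coeff-recovered : (G : 𝒜₁) (u : Word L1) →
    Ar.coeff n (zδ one ⊗ (G ◇[ one ] 1P)) (X ∷ map (letter fz) u) ≡ A1.coeff G u
  coeff-recovered G u = begin
    Ar.coeff n (zδ one ⊗ (G ◇[ one ] 1P)) (X ∷ map (letter fz) u)
      ≡⟨ Cₙ.coeff-ev (zδ one ⊗ (G ◇[ one ] 1P)) _ ⟩
    ev (zδ one ⊗ (G ◇[ one ] 1P)) (Cₙ.indicator (X ∷ map (letter fz) u))
      ≡⟨ at (zδ-◇-1P G) _ ⟩
    ev (ext (λ v → mon (X ∷ map (letter fz) v)) G) (Cₙ.indicator (X ∷ map (letter fz) u))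
      ≡⟨ trans (ev-ext _ G _) (ev-cong G (λ v → ev-mon _ _)) ⟩
    ev G (λ v → Cₙ.indicator (X ∷ map (letter fz) u) (X ∷ map (letter fz) v))
      ≡⟨ ev-cong G (λ v → indicator-map (≟W _≟1_) (≟W _≟L_) (λ w → X ∷ map (letter fz) w) X∷letters-injective u v) ⟩
    ev G (C₁.indicator u)
      ≡⟨ sym (C₁.coeff-ev G u) ⟩
    A1.coeff G u ∎
    where open ≡-Reasoning

  ◇-determines : (G G′ : 𝒜₁) →
    Ar._≈_ n (zδ one ⊗ (G ◇[ one ] 1P)) (zδ one ⊗ (G′ ◇[ one ] 1P)) → A1._≈_ G G′
  ◇-determines G G′ e u =
    trans (sym (coeff-recovered G u)) (trans (e _) (coeff-recovered G′ u))

theorem2p4 : (n : ℕ) (f : ℋ) →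
    let open Setup n
        open TreeMaps n
    in Σ 𝒜₁ (λ G → InA11 G
         × (∀ (s : μ) (w : 𝒜) → Thm24Eq f G s w)
         × (∀ (G′ : 𝒜₁) → InA11 G′ → (∀ (s : μ) (w : 𝒜) → Thm24Eq f G′ s w) → A1._≈_ G′ G))
theorem2p4 n f = G , fromComp-InA11 E , holds , λ G′ _ holds′ →
  ◇-determines G′ G (λ u → trans (sym (holds′ one 1P u)) (holds one 1P u))
  where
  open Setup n
  open TreeMaps n
  open Main n
  E : Poly ℕ
  E = compH (S f)
  G : 𝒜₁
  G = ext fromComp E
  holds : ∀ s w → Thm24Eq f G s w
  holds s w = Cₙ.≃⇒≈ (treeMapH-zδ (S f) s w)
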